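{- Let $d,m$ be positive integers, let $p$ be a prime number, put $n=p^m$ and assume $1\le d\le n$. Then the following hold: (1) For every $p$-monotone Ferrers diagram $\mathcal{D}$ of order $n$ and every finite field $\mathbb{F}$ of characteristic $p$, there exists a $[\mathcal{D},\nu_{\min}(\mathcal{D},d),d]_{\mathbb{F}}$ code. (2) For every $p$-convex Ferrers diagram $\mathcal{D}$ of order $n$ and every finite field $\mathbb{F}$ of characteristic $p$, there exists a $[\mathcal{D},\nu_{\min}(\mathcal{D},d),d]_{\mathbb{F}}$ code.
   Context: Write $[n]=\{1,\ldots,n\}$. A (top-right justified) Ferrers diagram of order $n$ is a subset $\mathcal{D}\subseteq[n]^2$ such that: if $(i,j)\in\mathcal{D}$ and $j\le j'\le n$, then $(i,j')\in\mathcal{D}$; and if $(i,j)\in\mathcal{D}$ and $1\le i'\le i$, then $(i',j)\in\mathcal{D}$. It is identified with the vector $(c_1,\ldots,c_n)$, $c_j=|\{i\in[n]:(i,j)\in\mathcal{D}\}|$, so $0\le c_1\le\cdots\le c_n\le n$ and $\mathcal{D}=\{(i,j)\in[n]^2: i\le c_j\}$. For a field $\mathbb{F}$, $\mathbb{F}^{\mathcal{D}}$ is the space of matrices $(a_{i,j})\in\mathbb{F}^{n\times n}$ with $a_{i,j}=0$ for all $(i,j)\notin\mathcal{D}$. A $[\mathcal{D},k,d]_{\mathbb{F}}$ (Ferrers diagram rank-metric) code is a $k$-dimensional $\mathbb{F}$-subspace $\mathcal{C}\subseteq\mathbb{F}^{\mathcal{D}}$ whose minimum rank distance $\min\{\operatorname{rk}(A):A\in\mathcal{C},A\ne0\}$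 equals $d$. (Convention: for $k=0$ the zero subspace counts as a $[\mathcal{D},0,d]_{\mathbb{F}}$ code.) Define $$\nu_{\min}(\mathcal{D},d)=\min_{0\le j\le d-1}\ \sum_{i=1}^{n-j}\max\{0,c_i-d+1+j\}.$$ A Ferrers diagram $(c_1,\ldots,c_n)$ is monotone if for every $i\in\{1,\ldots,n-1\}$ with $0<c_i<n$ one has $c_{i+1}>c_i$. It is convex if $c_{i+1}-c_i\le1$ for every $i\in\{1,\ldots,n-1\}$. For a prime $p$, the $p$-height of $\mathcal{D}=(c_1,\ldots,c_n)$ is the largest integer $h\ge0$ such that: (i) $p^h\mid n$; (ii) $p^h\mid c_i$ for all $i\in[n]$; (iii) whenever $r,s\in\{0,\ldots,n-1\}$ both lie in $\{Qp^h,Qp^h+1,\ldots,(Q+1)p^h-1\}$ for some integer $Q\ge0$, one has $c_{n-r}=c_{n-s}$. The $p$-contraction of $\mathcal{D}$ is the Ferrers diagram $\mathcal{D}^{(p)}=(c_1',\ldots,c'_{n/p^h})$ of order $n/p^h$ with $c_i'=c_{p^hi}/p^h$. The diagram $\mathcal{D}$ is $p$-monotone (resp. $p$-convex) if $\mathcal{D}^{(p)}$ is monotone (resp. convex) as a Ferrers diagram of order $n/p^h$. -}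

module Defs where

open import Level using (_⊔_; suc)
open import Algebra.Apartness.Bundles using (HeytingField; HeytingCommutativeRing)
open import Algebra.Bundles using (CommutativeRing)
import Algebra.Properties.Semiring.Mult as Mult
import Algebra.Properties.Semiring.Sum as Sum
open import Data.Fin.Base as Fin using (Fin; toℕ; fromℕ<; inject≤; opposite)
open import Data.Fin.Properties using (toℕ<n; toℕ-fromℕ<)
open import Data.List.Base using (map; tabulate; upTo)
import Data.Nat.ListAction as List
open import Data.List.Extrema.Nat using (min)
open import Data.Nat.Base as ℕ using (ℕ; _<_; _≤_; _∸_; _^_; _/_; NonZero)
open import Data.Nat.Divisibility using (_∣_)
open import Data.Nat.DivMod using (m/n*n≤m; /-monoˡ-≤)
open import Data.Nat.Primality using (Prime; prime⇒nonZero)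
import Data.Nat.Properties as ℕₚ
open import Data.Product.Base using (Σ; ∃; ∃-syntax; _×_; _,_)
open import Function.Bundles using (Inverse; _⇔_)
open import Relation.Binary.PropositionalEquality as ≡ using (_≡_)
open import Relation.Nullary.Negation using (¬_)
open import Relation.Unary using (Pred)

-- A Ferrers diagram of order n, given by its vector of column heights.
-- Indices are shifted by one throughout: `j : Fin n` stands for column
-- 1 + toℕ j (and likewise for rows), so `height j` is c_{1 + toℕ j}.
record FerrersDiagram (n : ℕ) : Set where
  field
    height      : Fin n → ℕ
    height-mono : ∀ {i j} → i Fin.≤ j → height i ≤ height j
    height≤n    : ∀ j → height j ≤ n

open FerrersDiagram public

-- The set of cells: with 1-based row i and column j this says i ≤ c_j.
infix 4 _∈ᶠ_
_∈ᶠ_ : ∀ {n} → Fin n × Fin n → FerrersDiagram n → Set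
(i , j) ∈ᶠ D = toℕ i < height D j

Monotone : ∀ {n} → FerrersDiagram n → Set
Monotone {n} D = ∀ (i j : Fin n) → toℕ j ≡ ℕ.suc (toℕ i) →
  0 < height D i → height D i < n → height D i < height D j

-- Truncated subtraction is genuine subtraction here, by `height-mono`.
Convex : ∀ {n} → FerrersDiagram n → Set
Convex {n} D = ∀ (i j : Fin n) → toℕ j ≡ ℕ.suc (toℕ i) →
  height D j ∸ height D i ≤ 1

-- Σ_{i=1}^{n-j} max{0 , c_i - d + 1 + j}
ν : ∀ {n} → FerrersDiagram n → ℕ → ℕ → ℕ
ν {n} D d j = List.sum (tabulate {n = n ∸ j} λ i →
  (height D (inject≤ i (ℕₚ.m∸n≤m n j)) ℕ.+ 1 ℕ.+ j) ∸ d)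

-- The minimum over 0 ≤ j ≤ d - 1.  The first argument of `min` is a starting
-- value; for d ≥ 1 it is one of the list entries.
νmin : ∀ {n} → FerrersDiagram n → ℕ → ℕ
νmin D d = min (ν D d 0) (map (ν D d) (upTo d))

-- Conditions (i)-(iii) of the p-height for the block length q = p ^ h.
-- `opposite r` is the (shifted) index of column n - r.
record Blocked (q : ℕ) {n} (D : FerrersDiagram n) : Set where
  field
    ∣order      : q ∣ n
    ∣height     : ∀ j → q ∣ height D j
    block-const : ∀ (Q : ℕ) (r s : Fin n) →
      Q ℕ.* q ≤ toℕ r → toℕ r < (Q ℕ.+ 1) ℕ.* q →
      Q ℕ.* q ≤ toℕ s → toℕ s < (Q ℕ.+ 1) ℕ.* q →
      height D (opposite r) ≡ height D (opposite s)

IsPHeight : ℕ → ∀ {n} → FerrersDiagram n → ℕ → Set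
IsPHeight p D h = Blocked (p ^ h) D × (∀ h′ → Blocked (p ^ h′) D → h′ ≤ h)

module _ (q : ℕ) .{{_ : NonZero q}} {n : ℕ} where

  -- With 1-based columns this is k ↦ q k.
  contractIndex< : ∀ (k : Fin (n / q)) → ℕ.pred (ℕ.suc (toℕ k) ℕ.* q) < n
  contractIndex< k = begin-strict
    ℕ.pred (ℕ.suc (toℕ k) ℕ.* q)  <⟨ pred[m]<m (ℕ.suc (toℕ k) ℕ.* q) ⟩
    ℕ.suc (toℕ k) ℕ.* q           ≤⟨ ℕₚ.*-monoˡ-≤ q (toℕ<n k) ⟩
    n / q ℕ.* q                   ≤⟨ m/n*n≤m n q ⟩
    n                             ∎
    where
    open ℕₚ.≤-Reasoning
    instance
      _ : NonZero (ℕ.suc (toℕ k) ℕ.* q)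
      _ = ℕₚ.m*n≢0 (ℕ.suc (toℕ k)) q
    pred[m]<m : ∀ m .{{_ : NonZero m}} → ℕ.pred m < m
    pred[m]<m (ℕ.suc m) = ℕₚ.n<1+n m

  contractIndex : Fin (n / q) → Fin n
  contractIndex k = fromℕ< (contractIndex< k)

  contractIndex-mono : ∀ {i j} → i Fin.≤ j → contractIndex i Fin.≤ contractIndex j
  contractIndex-mono {i} {j} i≤j = ≡.subst₂ _≤_
    (≡.sym (toℕ-fromℕ< (contractIndex< i))) (≡.sym (toℕ-fromℕ< (contractIndex< j)))
    (ℕₚ.pred-mono-≤ (ℕₚ.*-monoˡ-≤ q (ℕ.s≤s i≤j)))

  contraction : FerrersDiagram n → FerrersDiagram (n / q)
  contraction D = record
    { height      = λ k → height D (contractIndex k) / q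
    ; height-mono = λ i≤j → /-monoˡ-≤ q (height-mono D (contractIndex-mono i≤j))
    ; height≤n    = λ k → /-monoˡ-≤ q (height≤n D (contractIndex k))
    }

module _ {p : ℕ} (p-prime : Prime p) {n : ℕ} (D : FerrersDiagram n) where

  instance
    private
      p≢0 : NonZero p
      p≢0 = prime⇒nonZero p-prime

  -- D⁽ᵖ⁾ when h is the p-height of D.
  pContraction : ∀ h → FerrersDiagram (_/_ n (p ^ h) {{ℕₚ.m^n≢0 p h}})
  pContraction h = contraction (p ^ h) {{ℕₚ.m^n≢0 p h}} D

  -- For n ≥ 1 the p-height exists and is unique, so h is determined by D.
  PMonotone : Set
  PMonotone = ∃[ h ] IsPHeight p D h × Monotone (pContraction h)

  PConvex : Set
  PConvex = ∃[ h ] IsPHeight p D h × Convex (pContraction h)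

-- A finite field is a Heyting field whose carrier setoid is in bijection with
-- some Fin q.  Equality and invertibility are then decidable by search, so
-- tightness and `#⇒invertible` make every x ≉ 0 invertible, and 1 ≉ 0.
module _ {c ℓ₁ ℓ₂} (F : HeytingField c ℓ₁ ℓ₂) where

  open HeytingField F using (heytingCommutativeRing)
  open HeytingCommutativeRing heytingCommutativeRing using (commutativeRing)
  open CommutativeRing commutativeRing
  open Mult semiring using () renaming (_×_ to _·_)
  open Sum semiring using (sum; sum-cong-≋; sum-replicate-zero; ∑-distrib-+; *-distribˡ-sum)

  IsFinite : Set (c ⊔ ℓ₁)
  IsFinite = ∃[ q ] Inverse setoid (≡.setoid (Fin q))

  HasCharacteristic : ℕ → Set ℓ₁
  HasCharacteristic p = ∀ k → (k · 1# ≈ 0#) ⇔ (p ∣ k)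

  -- The coordinate space F^I; I = Fin n gives column vectors and
  -- I = Fin n × Fin n gives n × n matrices.
  Vector : Set → Set c
  Vector I = I → Carrier

  infix 4 _≋_
  _≋_ : ∀ {I} → Vector I → Vector I → Set ℓ₁
  v ≋ w = ∀ i → v i ≈ w i

  𝟎 : ∀ {I} → Vector I
  𝟎 _ = 0#

  record Subspace (I : Set) : Set (suc (c ⊔ ℓ₁)) where
    field
      Member   : Pred (Vector I) (c ⊔ ℓ₁)
      resp-≋   : ∀ {v w} → v ≋ w → Member v → Member w
      𝟎-closed : Member 𝟎
      +-closed : ∀ {v w} → Member v → Member w → Member (λ i → v i + w i)
      *-closed : ∀ a {v} → Member v → Member (λ i → a * v i)

  open Subspace public

  lincomb : ∀ {I k} → (Fin k → Carrier) → (Fin k → Vector I) → Vector I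
  lincomb a b i = sum (λ t → a t * b t i)

  span : ∀ {I k} → (Fin k → Vector I) → Subspace I
  span {k = k} b = record
    { Member   = λ v → ∃[ a ] v ≋ lincomb a b
    ; resp-≋   = λ v≋w (a , v≋) → a , λ i → trans (sym (v≋w i)) (v≋ i)
    ; 𝟎-closed = (λ _ → 0#) , λ i → sym
        (trans (sum-cong-≋ (λ t → zeroˡ (b t i))) (sum-replicate-zero k))
    ; +-closed = λ (a , v≋) (a′ , w≋) → (λ t → a t + a′ t) , λ i →
        trans (+-cong (v≋ i) (w≋ i))
          (trans (sym (∑-distrib-+ (λ t → a t * b t i) (λ t → a′ t * b t i)))
            (sum-cong-≋ (λ t → sym (distribʳ (b t i) (a t) (a′ t)))))
    ; *-closed = λ x (a , v≋) → (λ t → x * a t) , λ i →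
        trans (*-congˡ (v≋ i))
          (trans (*-distribˡ-sum x (λ t → a t * b t i))
            (sum-cong-≋ (λ t → sym (*-assoc x (a t) (b t i)))))
    }

  LinearlyIndependent : ∀ {I k} → (Fin k → Vector I) → Set (c ⊔ ℓ₁)
  LinearlyIndependent b = ∀ a → lincomb a b ≋ 𝟎 → ∀ t → a t ≈ 0#

  record IsBasis {I k} (W : Subspace I) (b : Fin k → Vector I) : Set (c ⊔ ℓ₁) where
    field
      inside      : ∀ t → Member W (b t)
      independent : LinearlyIndependent b
      spanning    : ∀ {v} → Member W v → Member (span b) v

  HasDimension : ∀ {I} → Subspace I → ℕ → Set (c ⊔ ℓ₁)
  HasDimension {I} W k = Σ (Fin k → Vector I) (IsBasis W)

  Matrix : ℕ → Set c
  Matrix n = Vector (Fin n × Fin n)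

  columnSpace : ∀ {n} → Matrix n → Subspace (Fin n)
  columnSpace A = span (λ j i → A (i , j))

  HasRank : ∀ {n} → Matrix n → ℕ → Set (c ⊔ ℓ₁)
  HasRank A r = HasDimension (columnSpace A) r

  record MinRankDistance {n} (C : Subspace (Fin n × Fin n)) (d : ℕ) : Set (c ⊔ ℓ₁) where
    field
      attained : ∃[ A ] Member C A × ¬ (A ≋ 𝟎) × HasRank A d
      minimal  : ∀ A → Member C A → ¬ (A ≋ 𝟎) → ∀ r → HasRank A r → d ≤ r

  SupportedOn : ∀ {n} → FerrersDiagram n → Matrix n → Set ℓ₁
  SupportedOn D A = ∀ ij → ¬ (ij ∈ᶠ D) → A ij ≈ 0#

  -- A [D , k , d] code over F.  The zero code has no minimum distance; it
  -- counts as a [D , 0 , d] code for every d.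
  record Code {n} (D : FerrersDiagram n) (k d : ℕ) : Set (suc (c ⊔ ℓ₁)) where
    field
      code      : Subspace (Fin n × Fin n)
      supported : ∀ {A} → Member code A → SupportedOn D A
      dimension : HasDimension code k
      distance  : 0 < k → MinRankDistance code d

{-# OPTIONS --safe #-}
-- Let L / F be cyclic of degree n = pᵐ with Galois group generated by θ, and put Δ = θ − 1.  As
-- Δⁿ = θⁿ − 1 = 0, there is a basis e₀ = 1, …, e_{n−1} with Δ e_{i+1} = e_i, so the spaces
-- V_s = ker Δˢ form a flag, and matrices supported on D are the F-linear maps f with
-- f (V_j) ⊆ V_{c_j} for all j.  A nonzero operator Σ_{i ≤ n−d} a_i Δⁱ has kernel of dimension at most
-- n − d, hence rank at least d (Gabidulin).  Since Δ^q = θ^q − 1 for q = pʰ is a skew derivation,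
-- V_{qa} V_{qb} ⊆ V_{q(a+b−1)}.  Therefore the operators e_j Δⁱ with i ≤ n − d and j < c_{i+1} respect
-- a p-monotone diagram; there are ν(D, d, d − 1) of them.  Dually, the operators Δ^{n−d−s} e_{n−j} with
-- j ∈ [n] and s < c_j − d + 1 respect a p-convex diagram; there are ν(D, d, 0) of them.  Both families
-- contain Δ^{n−d}, of rank d, as soon as they are nonempty, so νmin(D, d) members including it span the
-- code.  The extension L is a tower of Artin–Schreier extensions x^p − x = a, along which θ is lifted by
-- θ x = x + b with Δ^{N−1} b = 1, where N is the degree reached so far.
module Submission where

open import Defs
open import Level using (Level; _⊔_)
open import Algebra.Apartness.Bundles using (HeytingField; HeytingCommutativeRing)
open import Algebra.Bundles using (CommutativeRing; Semiring)
import Algebra.Properties.CommutativeSemiring.Exp as CommutativeExp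
import Algebra.Properties.Group as GroupProperties
import Algebra.Properties.Ring as RingProperties
import Algebra.Properties.Semiring.Binomial as Binomial
import Algebra.Properties.Semiring.Exp as Exp
import Algebra.Properties.Semiring.Mult as Mult
import Algebra.Properties.Semiring.Sum as Sum
import Algebra.Solver.Ring as RingSolver
open import Algebra.Solver.Ring.AlmostCommutativeRing using (fromCommutativeRing; _-Raw-AlmostCommutative⟶_)
open import Data.Empty using (⊥-elim)
open import Data.Fin.Base
  using (Fin; zero; suc; toℕ; fromℕ; inject₁; fromℕ<; inject≤; punchIn; punchOut; opposite; _↑ˡ_; _↑ʳ_; splitAt)
open import Data.Fin.Properties as Finₚ
  using (toℕ<n; toℕ-fromℕ; toℕ-inject₁; toℕ-fromℕ<; toℕ-injective; toℕ-inject≤; punchIn-punchOut; opposite-prop; opposite-involutive)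
import Data.Integer.Base as ℤ
import Data.Integer.Properties as ℤₚ
open import Data.List.Base as List using (tabulate; upTo)
open import Data.List.Extrema.Nat using (min≤xs)
open import Data.List.Membership.Propositional.Properties using (∈-map⁺; ∈-upTo⁺)
import Data.List.Relation.Unary.All as All
open import Data.Maybe.Base using (Maybe; just; nothing)
open import Data.Nat.Base as ℕ using (ℕ; zero; suc; _≤_; _<_; _∸_; _/_; _%_; z≤n; s≤s; NonZero; _!)
open import Data.Nat.Combinatorics using (_C_; nCn≡1; nCk≡n!/k![n-k]!; k![n∸k]!∣n!)
open import Data.Nat.Divisibility using (_∣_; divides; ∣⇒≤; ∣-refl; m∣m*n)
open import Data.Nat.DivMod using (m/n*n≡m; m/n*n≤m; m≡m%n+[m/n]*n; m%n<n; m<n*o⇒m/o<n; /-monoˡ-≤)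
import Data.Nat.ListAction as ListAction
open import Data.Nat.Primality using (Prime; euclidsLemma; prime⇒nonZero; prime⇒nonTrivial)
import Data.Nat.Properties as ℕₚ
open import Data.Nat.Tactic.RingSolver using (solve-∀)
open import Data.Product.Base using (Σ; ∃-syntax; _×_; _,_; proj₁; proj₂)
open import Data.Sum.Base using (_⊎_; inj₁; inj₂)
open import Function.Base using (_∘_; id)
open import Function.Bundles using (Inverse; Equivalence)
open import Relation.Binary.Definitions using (tri<; tri≈; tri>)
open import Relation.Binary.PropositionalEquality.Core as ≡ using (_≡_)
import Relation.Binary.Reasoning.Setoid as SetoidReasoning
open import Relation.Nullary using (Dec; yes; no; ¬_; ¬?)
open import Relation.Nullary.Decidable using (decidable-stable; map′)

-- The extension must come with an explicit generator θ and a computable Δ, which a bare irreducible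
-- polynomial does not supply. So K[x] / (xᵖ - x - a) is first taken as a mere ring, and the map x ↦
-- x + 1 does the work: below degree p its difference operator lowers degrees by exactly one, which
-- exhibits independence of the powers of x, kernel and nilpotence, and the same map shows that
-- nonzero elements are invertible. Irreducibility is replaced by the absence of roots of zᵖ + a =
-- z. Finiteness of F yields the first such a. Later ones solve Δ a = yᵖ - y, where Δ^(N-1) y = 1:
-- as Δ^(N-1) is the trace in characteristic p, the right side has trace zero, and roots are
-- excluded by the invariant that elements fixed by the p-th power lie in F. The two families put e
-- on opposite sides of Δⁱ. On the left, a column height bounds the index of e; on the right, it
-- bounds how far the exponent of Δ falls below n - d. These are the terms j = d - 1 and j = 0 of
-- the minimum, so each family has at least νmin members and surplus ones are discarded.

private variable
  c ℓ ℓ₁ ℓ₂ c′ ℓ′ : Level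

-- Rings of characteristic p

-- Normalisation has to recognise cancelling coefficients, and equality in `R` need not be
-- decidable. Integer coefficients, mapped to `R` by `embed`, provide the decision.
module ℤSolver (R : CommutativeRing c ℓ) where
  open import Data.Integer.Base using (ℤ; +_; -[1+_])
  open CommutativeRing R hiding (zero)
  open Mult semiring renaming (_×_ to _·_; ×-homo-+ to ·-homo-+; ×1-homo-* to ·1-homo-*)
  open RingProperties ring
  open GroupProperties +-group using (⁻¹-anti-homo-∙; ε⁻¹≈ε; ⁻¹-involutive)
  open SetoidReasoning setoid

  embed : ℤ → Carrier
  embed (+ n)     = n · 1#
  embed -[1+ n ]  = - (suc n · 1#)

  private
    embed-⊖ : ∀ m n → embed (m ℤ.⊖ n) ≈ m · 1# + - (n · 1#)
    embed-⊖ zero    zero    = sym (-‿inverseʳ 0#)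
    embed-⊖ zero    (suc n) = sym (+-identityˡ _)
    embed-⊖ (suc m) zero    = sym (trans (+-congˡ ε⁻¹≈ε) (+-identityʳ _))
    embed-⊖ (suc m) (suc n) = begin
      embed (suc m ℤ.⊖ suc n)  ≡⟨ ≡.cong embed (ℤₚ.[1+m]⊖[1+n]≡m⊖n m n) ⟩
      embed (m ℤ.⊖ n)  ≈⟨ embed-⊖ m n ⟩
      m · 1# + - (n · 1#)  ≈⟨ +-identityˡ _ ⟨
      0# + (m · 1# + - (n · 1#))  ≈⟨ +-congʳ (-‿inverseʳ 1#) ⟨
      1# + - 1# + (m · 1# + - (n · 1#))  ≈⟨ +-assoc 1# (- 1#) _ ⟩
      1# + (- 1# + (m · 1# + - (n · 1#)))  ≈⟨ +-congˡ (+-comm _ _) ⟩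
      1# + (m · 1# + - (n · 1#) + - 1#)  ≈⟨ +-congˡ (+-assoc _ _ _) ⟩
      1# + (m · 1# + (- (n · 1#) + - 1#))  ≈⟨ +-assoc _ _ _ ⟨
      1# + m · 1# + (- (n · 1#) + - 1#)  ≈⟨ +-congˡ (⁻¹-anti-homo-∙ 1# (n · 1#)) ⟨
      1# + m · 1# + - (1# + n · 1#)                   ∎

    embed-+ : ∀ i j → embed (i ℤ.+ j) ≈ embed i + embed j
    embed-+ (+ m)    (+ n)    = ·-homo-+ 1# m n
    embed-+ (+ m)    -[1+ n ] = embed-⊖ m (suc n)
    embed-+ -[1+ m ] (+ n)    = trans (embed-⊖ n (suc m)) (+-comm _ _)
    embed-+ -[1+ m ] -[1+ n ] = begin
      - (suc (suc (m ℕ.+ n)) · 1#)          ≡⟨ ≡.cong (λ k → - (suc k · 1#)) (ℕₚ.+-suc m n) ⟨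
      - ((suc m ℕ.+ suc n) · 1#)  ≈⟨ -‿cong (·-homo-+ 1# (suc m) (suc n)) ⟩
      - (suc m · 1# + suc n · 1#)           ≈⟨ -‿cong (+-comm _ _) ⟩
      - (suc n · 1# + suc m · 1#)           ≈⟨ ⁻¹-anti-homo-∙ _ _ ⟩
      - (suc m · 1#) + - (suc n · 1#)       ∎

    embed-neg : ∀ i → embed (ℤ.- i) ≈ - embed i
    embed-neg (+ zero)  = sym ε⁻¹≈ε
    embed-neg (+ suc n) = refl
    embed-neg -[1+ n ]  = sym (⁻¹-involutive _)

    embed-*⁺ : ∀ m j → embed (+ m ℤ.* j) ≈ m · 1# * embed j
    embed-*⁺ m (+ n) = begin
      embed (+ m ℤ.* + n)   ≡⟨ ≡.cong embed (ℤₚ.pos-* m n) ⟨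
      (m ℕ.* n) · 1#        ≈⟨ ·1-homo-* m n ⟩
      m · 1# * n · 1#       ∎
    embed-*⁺ m -[1+ n ] = begin
      embed (+ m ℤ.* -[1+ n ])          ≡⟨ ≡.cong embed (ℤₚ.neg-distribʳ-* (+ m) (+ suc n)) ⟨
      embed (ℤ.- (+ m ℤ.* + suc n))     ≈⟨ embed-neg (+ m ℤ.* + suc n) ⟩
      - embed (+ m ℤ.* + suc n)         ≈⟨ -‿cong (embed-*⁺ m (+ suc n)) ⟩
      - (m · 1# * suc n · 1#)           ≈⟨ -‿distribʳ-* _ _ ⟩
      m · 1# * - (suc n · 1#)           ∎

    embed-* : ∀ i j → embed (i ℤ.* j) ≈ embed i * embed j
    embed-* (+ m)    j = embed-*⁺ m j
    embed-* -[1+ m ] j = begin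
      embed (-[1+ m ] ℤ.* j)          ≡⟨ ≡.cong embed (ℤₚ.neg-distribˡ-* (+ suc m) j) ⟨
      embed (ℤ.- (+ suc m ℤ.* j))     ≈⟨ embed-neg (+ suc m ℤ.* j) ⟩
      - embed (+ suc m ℤ.* j)         ≈⟨ -‿cong (embed-*⁺ (suc m) j) ⟩
      - (suc m · 1# * embed j)        ≈⟨ -‿distribˡ-* _ _ ⟩
      - (suc m · 1#) * embed j        ∎

    morphism : ℤ.+-*-rawRing -Raw-AlmostCommutative⟶ fromCommutativeRing R
    morphism = record
      { ⟦_⟧ = embed ; +-homo = embed-+ ; *-homo = embed-* ; -‿homo = embed-neg
      ; 0-homo = refl ; 1-homo = +-identityʳ 1# }

    _≟ᶜ_ : ∀ i j → Maybe (embed i ≈ embed j)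
    i ≟ᶜ j with i ℤₚ.≟ j
    ... | yes i≡j = just (reflexive (≡.cong embed i≡j))
    ... | no  _   = nothing

  open RingSolver ℤ.+-*-rawRing (fromCommutativeRing R) morphism _≟ᶜ_ public

-- Binomial coefficients modulo p and the freshman's dream

prime⇒1< : ∀ {p} → Prime p → 1 < p
prime⇒1< pp = ℕ.nonTrivial⇒n>1 _ {{prime⇒nonTrivial pp}}

prime∣!⇒≤ : ∀ {p} → Prime p → ∀ m → p ∣ m ! → p ≤ m
prime∣!⇒≤ pp zero    p∣1 = ⊥-elim (ℕₚ.<⇒≱ (prime⇒1< pp) (∣⇒≤ p∣1))
prime∣!⇒≤ pp (suc m) p∣  with euclidsLemma (suc m) (m !) pp p∣
... | inj₁ p∣1+m = ∣⇒≤ p∣1+m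
... | inj₂ p∣m!  = ℕₚ.m≤n⇒m≤1+n (prime∣!⇒≤ pp m p∣m!)

-- p divides p! = (p C k) · k! · (p - k)!, but neither factorial, since k and p - k are both less
-- than p.
prime∣binomial : ∀ {p} → Prime p → ∀ {k} → 0 < k → k < p → p ∣ p C k
prime∣binomial {p@(suc p-1)} pp {k} 0<k k<p with euclidsLemma (p C k) (k ! ℕ.* (p ∸ k) !) pp p∣prod
  where
  prod≡p! : (p C k) ℕ.* (k ! ℕ.* (p ∸ k) !) ≡ p !
  prod≡p! = ≡.trans (≡.cong (ℕ._* (k ! ℕ.* (p ∸ k) !)) (nCk≡n!/k![n-k]! (ℕₚ.<⇒≤ k<p)))
    (m/n*n≡m {{k ℕₚ.!* (p ∸ k) !≢0}} (k![n∸k]!∣n! (ℕₚ.<⇒≤ k<p)))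
  p∣prod : p ∣ (p C k) ℕ.* (k ! ℕ.* (p ∸ k) !)
  p∣prod = ≡.subst (p ∣_) (≡.sym prod≡p!) (m∣m*n (p-1 !))
... | inj₁ p∣C = p∣C
... | inj₂ p∣!! with euclidsLemma (k !) ((p ∸ k) !) pp p∣!!
...   | inj₁ p∣k! = ⊥-elim (ℕₚ.<⇒≱ k<p (prime∣!⇒≤ pp k p∣k!))
...   | inj₂ p∣[p-k]! = ⊥-elim (ℕₚ.<⇒≱ (ℕₚ.∸-monoʳ-< 0<k (ℕₚ.<⇒≤ k<p)) (prime∣!⇒≤ pp (p ∸ k) p∣[p-k]!))
prime∣binomial {zero} pp 0<k ()

module Freshman (S : Semiring c ℓ) where
  open Semiring S hiding (zero)
  open Exp S
  open Mult S renaming (_×_ to _·_; ×-assocˡ to ·-assocˡ; ×-assoc-* to ·-assoc-*; ×-congʳ to ·-congʳ)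
  open Sum S using (sum; sum-cong-≋; sum-init-last; sum-replicate-zero)
  open SetoidReasoning setoid

  1^n≈1 : ∀ n → 1# ^ n ≈ 1#
  1^n≈1 zero    = refl
  1^n≈1 (suc n) = trans (*-identityˡ _) (1^n≈1 n)

  p·1≈0⇒p∣n⇒n·x≈0 : ∀ {p} → p · 1# ≈ 0# → ∀ {n} → p ∣ n → ∀ x → n · x ≈ 0#
  p·1≈0⇒p∣n⇒n·x≈0 {p} p·1≈0 (divides q ≡.refl) x = begin
    (q ℕ.* p) · x         ≈⟨ ·-congʳ (q ℕ.* p) (*-identityˡ x) ⟨
    (q ℕ.* p) · (1# * x)  ≈⟨ ·-assoc-* (q ℕ.* p) 1# x ⟨
    (q ℕ.* p) · 1# * x    ≈⟨ *-congʳ (·-assocˡ 1# q p) ⟨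
    q · (p · 1#) * x      ≈⟨ *-congʳ (·-congʳ q p·1≈0) ⟩
    q · 0# * x  ≈⟨ *-congʳ (n·0≈0 q) ⟩
    0# * x  ≈⟨ zeroˡ x ⟩
    0#                    ∎
    where
    n·0≈0 : ∀ n → n · 0# ≈ 0#
    n·0≈0 zero    = refl
    n·0≈0 (suc n) = trans (+-identityˡ _) (n·0≈0 n)

  module _ {p} (pp : Prime p) (p·1≈0 : p · 1# ≈ 0#) where

    -- The inner binomial coefficients vanish. Only commutation of x and y is asked for, because the
    -- identity serves both for ring elements and for operators such as Δ and 1.
    freshman : ∀ {x y} → x * y ≈ y * x → (x + y) ^ p ≈ x ^ p + y ^ p
    freshman {x} {y} xy≈yx = lem p ≡.refl
      where
      module B = Binomial S x y
      lem : ∀ n → n ≡ p → (x + y) ^ n ≈ x ^ n + y ^ n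
      lem zero ≡.refl = ⊥-elim (ℕ.≢-nonZero⁻¹ 0 {{prime⇒nonZero pp}} ≡.refl)
      lem (suc n) ≡.refl = begin
        (x + y) ^ suc n ≈⟨ B.theorem xy≈yx (suc n) ⟩
        first + sum rest ≈⟨ +-congˡ (sum-init-last rest) ⟩
        first + (sum (rest ∘ inject₁) + rest (fromℕ n))
          ≈⟨ +-cong first≈ (+-cong middle≈ last≈) ⟩
        y ^ suc n + (0# + x ^ suc n) ≈⟨ +-congˡ (+-identityˡ _) ⟩
        y ^ suc n + x ^ suc n ≈⟨ +-comm _ _ ⟩
        x ^ suc n + y ^ suc n ∎
        where
        first = B.binomialTerm (suc n) zero
        rest : Fin (suc n) → Carrier
        rest k = B.binomialTerm (suc n) (suc k)
        first≈ : first ≈ y ^ suc n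
        first≈ = trans (+-identityʳ _) (*-identityˡ _)
        middle≈ : sum (rest ∘ inject₁) ≈ 0#
        middle≈ = trans (sum-cong-≋ λ k → p·1≈0⇒p∣n⇒n·x≈0 p·1≈0
            (prime∣binomial pp {suc (toℕ (inject₁ k))} (s≤s z≤n) (s≤s (≡.subst (_< n) (≡.sym (toℕ-inject₁ k)) (toℕ<n k)))) _)
          (sum-replicate-zero n)
        last≈ : rest (fromℕ n) ≈ x ^ suc n
        last≈ = begin
          (suc n C suc (toℕ (fromℕ n))) · (x ^ suc (toℕ (fromℕ n)) * y ^ (n ∸ toℕ (fromℕ n)))
            ≡⟨ ≡.cong (λ i → (suc n C suc i) · (x ^ suc i * y ^ (n ∸ i))) (toℕ-fromℕ n) ⟩
          (suc n C suc n) · (x ^ suc n * y ^ (n ∸ n))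
            ≡⟨ ≡.cong₂ (λ i j → i · (x ^ suc n * y ^ j)) (nCn≡1 (suc n)) (ℕₚ.n∸n≡0 n) ⟩
          1 · (x ^ suc n * 1#) ≈⟨ +-identityʳ _ ⟩
          x ^ suc n * 1#       ≈⟨ *-identityʳ _ ⟩
          x ^ suc n ∎

    freshman-1 : ∀ {x} k → (x + 1#) ^ (p ℕ.^ k) ≈ x ^ (p ℕ.^ k) + 1#
    freshman-1 {x} zero    = trans (*-identityʳ _) (+-congʳ (sym (*-identityʳ _)))
    freshman-1 {x} (suc k) = begin
      (x + 1#) ^ (p ℕ.* q)    ≡⟨ ≡.cong ((x + 1#) ^_) (ℕₚ.*-comm p q) ⟩
      (x + 1#) ^ (q ℕ.* p)    ≈⟨ ^-assocʳ (x + 1#) q p ⟨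
      ((x + 1#) ^ q) ^ p      ≈⟨ ^-congˡ p (freshman-1 k) ⟩
      (x ^ q + 1#) ^ p        ≈⟨ freshman (trans (*-identityʳ _) (sym (*-identityˡ _))) ⟩
      (x ^ q) ^ p + 1# ^ p    ≈⟨ +-cong (^-assocʳ x q p) (1^n≈1 p) ⟩
      x ^ (q ℕ.* p) + 1#      ≡⟨ ≡.cong (λ i → x ^ i + 1#) (ℕₚ.*-comm q p) ⟩
      x ^ (p ℕ.* q) + 1#      ∎
      where
      q = p ℕ.^ k

AnnihilatesOne : CommutativeRing c ℓ → ℕ → Set ℓ
AnnihilatesOne R n = n · 1# ≈ 0#
  where
  open CommutativeRing R
  open Mult semiring renaming (_×_ to _·_)

-- Additive operators on a ring

module Endomorphisms (R : CommutativeRing c ℓ) where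
  open CommutativeRing R hiding (zero)
  open ℤSolver R using (solve; _:=_; _:+_)
  open SetoidReasoning setoid

  record End : Set (c ⊔ ℓ) where
    field
      app     : Carrier → Carrier
      app-cong : ∀ {x y} → x ≈ y → app x ≈ app y
      app-+   : ∀ x y → app (x + y) ≈ app x + app y

    app-0 : app 0# ≈ 0#
    app-0 = identityʳ-unique (app 0#) (app 0#)
      (trans (sym (app-+ 0# 0#)) (app-cong (+-identityˡ 0#)))
      where open GroupProperties +-group using (identityʳ-unique)

    app-neg : ∀ x → app (- x) ≈ - app x
    app-neg x = inverseʳ-unique (app x) (app (- x))
      (trans (sym (app-+ x (- x))) (trans (app-cong (-‿inverseʳ x)) app-0))
      where open GroupProperties +-group using (inverseʳ-unique)

    app-sub : ∀ x y → app (x + - y) ≈ app x + - app y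
    app-sub x y = trans (app-+ x (- y)) (+-congˡ (app-neg y))

    app-sum : ∀ {n} (f : Fin n → Carrier) → app (Sum.sum semiring f) ≈ Sum.sum semiring (app ∘ f)
    app-sum {zero}  f = app-0
    app-sum {suc n} f = trans (app-+ _ _) (+-congˡ (app-sum (f ∘ suc)))

  open End public

  -- With composition as product, powers of operators and the binomial theorem for them come for
  -- free. Additivity is the common ground of θ, Δ and multiplications by elements.
  endSemiring : Semiring (c ⊔ ℓ) (c ⊔ ℓ)
  endSemiring = record
    { Carrier = End
    ; _≈_ = λ f g → ∀ x → app f x ≈ app g x
    ; _+_ = λ f g → record
        { app = λ x → app f x + app g x
        ; app-cong = λ e → +-cong (app-cong f e) (app-cong g e)
        ; app-+ = λ x y → trans (+-cong (app-+ f x y) (app-+ g x y))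
            (solve 4 (λ a b c d → a :+ b :+ (c :+ d) := a :+ c :+ (b :+ d)) refl _ _ _ _)
        }
    ; _*_ = λ f g → record
        { app = λ x → app f (app g x)
        ; app-cong = λ e → app-cong f (app-cong g e)
        ; app-+ = λ x y → trans (app-cong f (app-+ g x y)) (app-+ f _ _)
        }
    ; 0# = record { app = λ _ → 0# ; app-cong = λ _ → refl ; app-+ = λ _ _ → sym (+-identityˡ 0#) }
    ; 1# = record { app = id ; app-cong = id ; app-+ = λ _ _ → refl }
    ; isSemiring = record
      { isSemiringWithoutAnnihilatingZero = record
        { +-isCommutativeMonoid = record
          { isMonoid = record
            { isSemigroup = record
              { isMagma = record
                { isEquivalence = record
                  { refl = λ _ → refl ; sym = λ e x → sym (e x) ; trans = λ e e′ x → trans (e x) (e′ x) }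
                ; ∙-cong = λ e e′ x → +-cong (e x) (e′ x) }
              ; assoc = λ f g h x → +-assoc _ _ _ }
            ; identity = (λ f x → +-identityˡ _) , (λ f x → +-identityʳ _) }
          ; comm = λ f g x → +-comm _ _ }
        ; *-cong = λ {f} e e′ x → trans (app-cong f (e′ x)) (e _)
        ; *-assoc = λ f g h x → refl
        ; *-identity = (λ f x → refl) , (λ f x → refl)
        ; distrib = (λ f g h x → app-+ f _ _) , (λ f g h x → refl)
        }
      ; zero = (λ f x → refl) , (λ f x → app-0 f)
      }
    }

  open Semiring endSemiring public using () renaming (_+_ to _⊕_; _*_ to _⊚_; _≈_ to _≈ᴱ_; 1# to 1ᴱ; 0# to 0ᴱ)
  open Exp endSemiring public using () renaming (_^_ to _↑_; ^-homo-* to ↑-homo-⊚; ^-assocʳ to ↑-assocʳ; ^-congˡ to ↑-congˡ)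

  open Mult semiring using () renaming (_×_ to _·_)
  open Mult endSemiring using () renaming (_×_ to _·ᴱ_)

  private
    ·ᴱ-app : ∀ n f x → app (n ·ᴱ f) x ≈ n · app f x
    ·ᴱ-app zero    f x = refl
    ·ᴱ-app (suc n) f x = +-congˡ (·ᴱ-app n f x)

  freshmanᴱ : ∀ {p} → Prime p → AnnihilatesOne R p → ∀ δ k → (δ ⊕ 1ᴱ) ↑ (p ℕ.^ k) ≈ᴱ (δ ↑ (p ℕ.^ k)) ⊕ 1ᴱ
  freshmanᴱ {p} pp p·1≈0 δ k = Freshman.freshman-1 endSemiring pp
    (λ x → trans (·ᴱ-app p 1ᴱ x) (Freshman.p·1≈0⇒p∣n⇒n·x≈0 semiring p·1≈0 (divides 1 (≡.sym (ℕₚ.*-identityˡ p))) x)) {δ} k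

  ↑-suc-comm : ∀ f n x → app (f ↑ n) (app f x) ≈ app f (app (f ↑ n) x)
  ↑-suc-comm f zero    x = refl
  ↑-suc-comm f (suc n) x = app-cong f (↑-suc-comm f n x)

  ↑-zero : ∀ f {x} → app f x ≈ 0# → ∀ {n} → 0 < n → app (f ↑ n) x ≈ 0#
  ↑-zero f {x} fx≈0 {suc n} _ = trans (sym (↑-suc-comm f n x)) (trans (app-cong (f ↑ n) fx≈0) (app-0 (f ↑ n)))

  ↑-+ : ∀ f m n x → app (f ↑ (m ℕ.+ n)) x ≈ app (f ↑ m) (app (f ↑ n) x)
  ↑-+ f m n = ↑-homo-⊚ f m n

-- Decidable equality takes the place of apartness: each step of the tower inherits it
-- coordinatewise, and degrees of polynomials are found by it.
record DecField c ℓ : Set (Level.suc (c ⊔ ℓ)) where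
  field
    commutativeRing : CommutativeRing c ℓ
  open CommutativeRing commutativeRing public hiding (zero)
  infix 4 _≟_
  field
    _≟_     : ∀ x y → Dec (x ≈ y)
    1≉0     : ¬ 1# ≈ 0#
    inverse : ∀ x → ¬ x ≈ 0# → ∃[ y ] x * y ≈ 1#

  cancel-≉0 : ∀ {x y} → ¬ x ≈ 0# → x * y ≈ 0# → y ≈ 0#
  cancel-≉0 {x} {y} x≉0 xy≈0 with inverse x x≉0
  ... | z , xz≈1 = begin
    y           ≈⟨ *-identityˡ y ⟨
    1# * y      ≈⟨ *-congʳ xz≈1 ⟨
    x * z * y   ≈⟨ *-congʳ (*-comm x z) ⟩
    z * x * y   ≈⟨ *-assoc z x y ⟩
    z * (x * y) ≈⟨ *-congˡ xy≈0 ⟩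
    z * 0#      ≈⟨ zeroʳ z ⟩
    0#          ∎
    where open SetoidReasoning setoid

  open Exp semiring using (_^_)

  x^n≈0⇒x≈0 : ∀ {x} n → x ^ n ≈ 0# → x ≈ 0#
  x^n≈0⇒x≈0 zero    1≈0 = ⊥-elim (1≉0 1≈0)
  x^n≈0⇒x≈0 {x} (suc n) e with x ≟ 0#
  ... | yes x≈0 = x≈0
  ... | no  x≉0 = x^n≈0⇒x≈0 n (cancel-≉0 x≉0 e)

record Hom (R : CommutativeRing c ℓ) (S : CommutativeRing c′ ℓ′) : Set (c ⊔ ℓ ⊔ c′ ⊔ ℓ′) where
  private
    module R = CommutativeRing R
    module S = CommutativeRing S
  field
    ⟦_⟧    : R.Carrier → S.Carrier
    ⟦⟧-cong : ∀ {x y} → x R.≈ y → ⟦ x ⟧ S.≈ ⟦ y ⟧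
    +-homo : ∀ x y → ⟦ x R.+ y ⟧ S.≈ ⟦ x ⟧ S.+ ⟦ y ⟧
    *-homo : ∀ x y → ⟦ x R.* y ⟧ S.≈ ⟦ x ⟧ S.* ⟦ y ⟧
    1-homo : ⟦ R.1# ⟧ S.≈ S.1#

  open Exp R.semiring using () renaming (_^_ to _^ᴿ_)
  open Exp S.semiring using () renaming (_^_ to _^ˢ_)
  open Mult R.semiring using () renaming (_×_ to _·ᴿ_)
  open Mult S.semiring using () renaming (_×_ to _·ˢ_)

  0-homo : ⟦ R.0# ⟧ S.≈ S.0#
  0-homo = identityʳ-unique ⟦ R.0# ⟧ ⟦ R.0# ⟧
    (S.trans (S.sym (+-homo R.0# R.0#)) (⟦⟧-cong (R.+-identityˡ R.0#)))
    where open GroupProperties S.+-group using (identityʳ-unique)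

  neg-homo : ∀ x → ⟦ R.- x ⟧ S.≈ S.- ⟦ x ⟧
  neg-homo x = inverseʳ-unique ⟦ x ⟧ ⟦ R.- x ⟧
    (S.trans (S.sym (+-homo x (R.- x))) (S.trans (⟦⟧-cong (R.-‿inverseʳ x)) 0-homo))
    where open GroupProperties S.+-group using (inverseʳ-unique)

  ^-homo : ∀ x n → ⟦ x ^ᴿ n ⟧ S.≈ ⟦ x ⟧ ^ˢ n
  ^-homo x zero    = 1-homo
  ^-homo x (suc n) = S.trans (*-homo _ _) (S.*-congˡ (^-homo x n))

  ·-homo : ∀ n x → ⟦ n ·ᴿ x ⟧ S.≈ n ·ˢ ⟦ x ⟧
  ·-homo zero    x = 0-homo
  ·-homo (suc n) x = S.trans (+-homo _ _) (S.+-congˡ (·-homo n x))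

  ·1≈0-homo : ∀ n → AnnihilatesOne R n → AnnihilatesOne S n
  ·1≈0-homo n n·1≈0 = S.trans (Mult.×-congʳ S.semiring n (S.sym 1-homo))
    (S.trans (S.sym (·-homo n R.1#)) (S.trans (⟦⟧-cong n·1≈0) 0-homo))


open Hom

_∘ʰ_ : ∀ {c″ ℓ″} {R : CommutativeRing c ℓ} {S : CommutativeRing c′ ℓ′} {T : CommutativeRing c″ ℓ″} →
  Hom S T → Hom R S → Hom R T
_∘ʰ_ {T = T} g f = record
  { ⟦_⟧ = λ x → ⟦ g ⟧ (⟦ f ⟧ x)
  ; ⟦⟧-cong = λ e → ⟦⟧-cong g (⟦⟧-cong f e)
  ; +-homo = λ x y → trans (⟦⟧-cong g (+-homo f x y)) (+-homo g _ _)
  ; *-homo = λ x y → trans (⟦⟧-cong g (*-homo f x y)) (*-homo g _ _)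
  ; 1-homo = trans (⟦⟧-cong g (1-homo f)) (1-homo g)
  }
  where open CommutativeRing T using (trans)

idʰ : ∀ {R : CommutativeRing c ℓ} → Hom R R
idʰ {R = R} = record
  { ⟦_⟧ = id ; ⟦⟧-cong = id ; +-homo = λ _ _ → refl ; *-homo = λ _ _ → refl ; 1-homo = refl }
  where open CommutativeRing R using (refl)

-- A nonzero element is invertible, so its image is a unit and cannot be 0 unless 1 = 0. The target
-- is only a ring, because this is applied before the extension is known to be a field.
Hom-injective : (K : DecField c ℓ) (S : CommutativeRing c′ ℓ′) →
  ¬ CommutativeRing._≈_ S (CommutativeRing.1# S) (CommutativeRing.0# S) →
  (f : Hom (DecField.commutativeRing K) S) → ∀ {x} →
  CommutativeRing._≈_ S (⟦ f ⟧ x) (CommutativeRing.0# S) → DecField._≈_ K x (DecField.0# K)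
Hom-injective K S 1≉0 f {x} fx≈0 with x K.≟ K.0#
  where module K = DecField K
... | yes x≈0 = x≈0
... | no  x≉0 with DecField.inverse K x x≉0
...   | y , xy≈1 = ⊥-elim (1≉0 (begin
    1#  ≈⟨ 1-homo f ⟨
    ⟦ f ⟧ K.1#          ≈⟨ ⟦⟧-cong f xy≈1 ⟨
    ⟦ f ⟧ (x K.* y)     ≈⟨ *-homo f x y ⟩
    ⟦ f ⟧ x * ⟦ f ⟧ y   ≈⟨ *-congʳ fx≈0 ⟩
    0# * ⟦ f ⟧ y        ≈⟨ zeroˡ _ ⟩
    0#                  ∎))
  where
  module K = DecField K
  open CommutativeRing S
  open SetoidReasoning setoid

-- Unit vectors and rings generated by one element

module Kronecker (R : CommutativeRing c ℓ) where
  open CommutativeRing R hiding (zero)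
  open Sum semiring using (sum; sum-cong-≋; sum-replicate-zero)

  unit : ∀ {n} → Fin n → Fin n → Carrier
  unit zero    zero    = 1#
  unit zero    (suc _) = 0#
  unit (suc _) zero    = 0#
  unit (suc i) (suc j) = unit i j

  unit-≡ : ∀ {n} (i : Fin n) → unit i i ≡ 1#
  unit-≡ zero    = ≡.refl
  unit-≡ (suc i) = unit-≡ i

  unit-≢ : ∀ {n} {i j : Fin n} → ¬ i ≡ j → unit i j ≡ 0#
  unit-≢ {i = zero}  {zero}  i≢j = ⊥-elim (i≢j ≡.refl)
  unit-≢ {i = zero}  {suc j} i≢j = ≡.refl
  unit-≢ {i = suc i} {zero}  i≢j = ≡.refl
  unit-≢ {i = suc i} {suc j} i≢j = unit-≢ (i≢j ∘ ≡.cong suc)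

  sum-single : ∀ {n} (f : Fin n → Carrier) (i : Fin n) → (∀ j → ¬ j ≡ i → f j ≈ 0#) → sum f ≈ f i
  sum-single {suc n} f zero f≈0 = trans (+-congˡ
    (trans (sum-cong-≋ {n} (λ j → f≈0 (suc j) (λ ()))) (sum-replicate-zero n))) (+-identityʳ _)
  sum-single f (suc i) f≈0 = trans (+-cong (f≈0 zero (λ ()))
    (sum-single (f ∘ suc) i (λ j j≢i → f≈0 (suc j) (j≢i ∘ Finₚ.suc-injective)))) (+-identityˡ _)

  sum-zero : ∀ {n} (f : Fin n → Carrier) → (∀ j → f j ≈ 0#) → sum f ≈ 0#
  sum-zero {n} f f≈0 = trans (sum-cong-≋ f≈0) (sum-replicate-zero n)

  sum-*-unit : ∀ {n} (f : Fin n → Carrier) i → sum (λ j → f j * unit j i) ≈ f i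
  sum-*-unit f i = trans (sum-single _ i λ j j≢i →
      trans (*-congˡ (reflexive (unit-≢ j≢i))) (zeroʳ _))
    (trans (*-congˡ (reflexive (unit-≡ i))) (*-identityʳ _))

  sum-unit-* : ∀ {n} (f : Fin n → Carrier) i → sum (λ j → unit i j * f j) ≈ f i
  sum-unit-* f i = trans (sum-single _ i λ j j≢i →
      trans (*-congʳ (reflexive (unit-≢ (j≢i ∘ ≡.sym)))) (zeroˡ _))
    (trans (*-congʳ (reflexive (unit-≡ i))) (*-identityˡ _))

-- If e is a cyclic vector of the operator X on Kⁿ, then Kⁿ is a commutative ring with unit e, in which
-- multiplication by u is the polynomial Σ_j u_j Xʲ.
module Cyclic (K : CommutativeRing c ℓ) (n : ℕ)
  (X : (Fin n → CommutativeRing.Carrier K) → (Fin n → CommutativeRing.Carrier K))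
  where
  open CommutativeRing K hiding (zero)
  open ℤSolver K using (solve; _:=_; _:*_)
  open Sum semiring
  open Kronecker K
  open SetoidReasoning setoid

  V : Set _
  V = Fin n → Carrier

  infix 4 _≋ⱽ_
  _≋ⱽ_ : V → V → Set _
  u ≋ⱽ v = ∀ i → u i ≈ v i

  pow : ℕ → V → V
  pow zero    v = v
  pow (suc j) v = X (pow j v)

  pow-+ : ∀ j l v → pow j (pow l v) ≡ pow (j ℕ.+ l) v
  pow-+ zero    l v = ≡.refl
  pow-+ (suc j) l v = ≡.cong X (pow-+ j l v)

  mul : V → V → V
  mul u v i = sum (λ j → u j * pow (toℕ j) v i)

  record IsCyclic : Set (c ⊔ ℓ) where
    field
      X-cong  : ∀ {u v} → u ≋ⱽ v → X u ≋ⱽ X v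
      X-+     : ∀ u v → X (λ i → u i + v i) ≋ⱽ λ i → X u i + X v i
      X-*     : ∀ a v → X (λ i → a * v i) ≋ⱽ λ i → a * X v i
      one     : V
      pow-one : ∀ j → pow (toℕ j) one ≋ⱽ unit j

  module Multiplication (isCyclic : IsCyclic) where
    open IsCyclic isCyclic

    X-0 : X (λ _ → 0#) ≋ⱽ λ _ → 0#
    X-0 i = trans (X-cong (λ _ → sym (zeroˡ 0#)) i) (trans (X-* 0# (λ _ → 0#) i) (zeroˡ _))

    X-sum : ∀ {m} (a : Fin m → Carrier) (f : Fin m → V) →
      X (λ i → sum (λ j → a j * f j i)) ≋ⱽ λ i → sum (λ j → a j * X (f j) i)
    X-sum {zero}  a f = X-0
    X-sum {suc m} a f i = trans (X-+ (λ i → a zero * f zero i) (λ i → sum (λ j → a (suc j) * f (suc j) i)) i)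
      (+-cong (X-* _ _ i) (X-sum (a ∘ suc) (f ∘ suc) i))

    pow-cong : ∀ j {u v} → u ≋ⱽ v → pow j u ≋ⱽ pow j v
    pow-cong zero    e = e
    pow-cong (suc j) e = X-cong (pow-cong j e)

    pow-sum : ∀ l {m} (a : Fin m → Carrier) (f : Fin m → V) →
      pow l (λ i → sum (λ j → a j * f j i)) ≋ⱽ λ i → sum (λ j → a j * pow l (f j) i)
    pow-sum zero    a f i = refl
    pow-sum (suc l) a f i = trans (X-cong (pow-sum l a f) i) (X-sum a (pow l ∘ f) i)

    mul-mul : ∀ u w v i → mul u (mul w v) i ≈ sum (λ j → sum (λ l → u j * (w l * pow (toℕ j ℕ.+ toℕ l) v i)))
    mul-mul u w v i = sum-cong-≋ λ j → begin
      u j * pow (toℕ j) (mul w v) i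
        ≈⟨ *-congˡ (pow-sum (toℕ j) w (λ l → pow (toℕ l) v) i) ⟩
      u j * sum (λ l → w l * pow (toℕ j) (pow (toℕ l) v) i)
        ≈⟨ *-distribˡ-sum (u j) (λ l → w l * pow (toℕ j) (pow (toℕ l) v) i) ⟩
      sum (λ l → u j * (w l * pow (toℕ j) (pow (toℕ l) v) i))
        ≈⟨ sum-cong-≋ (λ l → *-congˡ {u j} (*-congˡ {w l} (reflexive (≡.cong (λ z → z i) (pow-+ (toℕ j) (toℕ l) v))))) ⟩
      sum (λ l → u j * (w l * pow (toℕ j ℕ.+ toℕ l) v i)) ∎

    -- Multiplications by u and by w are polynomials in the same operator X. Applied to `one`, this
    -- gives commutativity of the product, and associativity follows from the two together.
    mul-commute : ∀ u w v → mul u (mul w v) ≋ⱽ mul w (mul u v)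
    mul-commute u w v i = begin
      mul u (mul w v) i ≈⟨ mul-mul u w v i ⟩
      sum (λ j → sum (λ l → u j * (w l * pow (toℕ j ℕ.+ toℕ l) v i)))
        ≈⟨ ∑-comm (λ j l → u j * (w l * pow (toℕ j ℕ.+ toℕ l) v i)) ⟩
      sum (λ l → sum (λ j → u j * (w l * pow (toℕ j ℕ.+ toℕ l) v i)))
        ≈⟨ sum-cong-≋ (λ l → sum-cong-≋ (λ j → trans
             (solve 3 (λ a b c → a :* (b :* c) := b :* (a :* c)) refl (u j) (w l) (pow (toℕ j ℕ.+ toℕ l) v i))
             (*-congˡ {w l} (*-congˡ {u j} (reflexive (≡.cong (λ m → pow m v i) (ℕₚ.+-comm (toℕ j) (toℕ l)))))))) ⟩
      sum (λ l → sum (λ j → w l * (u j * pow (toℕ l ℕ.+ toℕ j) v i))) ≈⟨ mul-mul w u v i ⟨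
      mul w (mul u v) i ∎

    mul-identityʳ : ∀ u → mul u one ≋ⱽ u
    mul-identityʳ u i = trans (sum-cong-≋ (λ j → *-congˡ {u j} (pow-one j i))) (sum-*-unit u i)

    mul-cong : ∀ {u u′ v v′} → u ≋ⱽ u′ → v ≋ⱽ v′ → mul u v ≋ⱽ mul u′ v′
    mul-cong e e′ i = sum-cong-≋ λ j → *-cong (e j) (pow-cong (toℕ j) e′ i)

    mul-comm : ∀ u v → mul u v ≋ⱽ mul v u
    mul-comm u v i = begin
      mul u v i  ≈⟨ mul-cong {u} (λ _ → refl) (mul-identityʳ v) i ⟨
      mul u (mul v one) i   ≈⟨ mul-commute u v one i ⟩
      mul v (mul u one) i   ≈⟨ mul-cong {v} (λ _ → refl) (mul-identityʳ u) i ⟩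
      mul v u i             ∎

    mul-assoc : ∀ u v t → mul (mul u v) t ≋ⱽ mul u (mul v t)
    mul-assoc u v t i = begin
      mul (mul u v) t i ≈⟨ mul-comm (mul u v) t i ⟩
      mul t (mul u v) i ≈⟨ mul-commute t u v i ⟩
      mul u (mul t v) i ≈⟨ mul-cong {u} (λ _ → refl) (mul-comm t v) i ⟩
      mul u (mul v t) i ∎

    mul-distribʳ : ∀ t u v → mul (λ i → u i + v i) t ≋ⱽ λ i → mul u t i + mul v t i
    mul-distribʳ t u v i = trans (sum-cong-≋ λ j → distribʳ (pow (toℕ j) t i) (u j) (v j))
      (∑-distrib-+ (λ j → u j * pow (toℕ j) t i) (λ j → v j * pow (toℕ j) t i))

    cyclicRing : CommutativeRing c ℓ
    cyclicRing = record
      { Carrier = V ; _≈_ = _≋ⱽ_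
      ; _+_ = λ u v i → u i + v i ; _*_ = mul ; -_ = λ u i → - u i
      ; 0# = λ _ → 0# ; 1# = one
      ; isCommutativeRing = record
        { isRing = record
          { +-isAbelianGroup = record
            { isGroup = record
              { isMonoid = record
                { isSemigroup = record
                  { isMagma = record
                    { isEquivalence = record
                      { refl = λ _ → refl ; sym = λ e i → sym (e i) ; trans = λ e e′ i → trans (e i) (e′ i) }
                    ; ∙-cong = λ e e′ i → +-cong (e i) (e′ i) }
                  ; assoc = λ _ _ _ _ → +-assoc _ _ _ }
                ; identity = (λ _ _ → +-identityˡ _) , (λ _ _ → +-identityʳ _) }
              ; inverse = (λ _ _ → -‿inverseˡ _) , (λ _ _ → -‿inverseʳ _)
              ; ⁻¹-cong = λ e i → -‿cong (e i) }
            ; comm = λ _ _ _ → +-comm _ _ }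
          ; *-cong = λ {u} {u′} {v} {v′} → mul-cong {u} {u′} {v} {v′}
          ; *-assoc = mul-assoc
          ; *-identity = (λ u i → trans (mul-comm one u i) (mul-identityʳ u i)) , mul-identityʳ
          ; distrib = (λ t u v i → trans (mul-comm t (λ i → u i + v i) i)
                         (trans (mul-distribʳ t u v i) (+-cong (mul-comm u t i) (mul-comm v t i))))
                    , mul-distribʳ
          }
        ; *-comm = mul-comm
        }
      }

    private module R = CommutativeRing cyclicRing
    open Exp R.semiring using () renaming (_^_ to _^ᴿ_)

    x : V
    x = X one

    x*v≈Xv : ∀ v → mul x v ≋ⱽ X v
    x*v≈Xv v i = begin
      mul x v i  ≈⟨ mul-comm x v i ⟩
      sum (λ j → v j * pow (toℕ j) (X one) i)  ≈⟨ sum-cong-≋ (λ j → *-congˡ {v j} (reflexive (≡.cong (λ z → z i)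
        (≡.trans (pow-+ (toℕ j) 1 one) (≡.cong (λ m → pow m one) (ℕₚ.+-comm (toℕ j) 1)))))) ⟩
      sum (λ j → v j * X (pow (toℕ j) one) i)  ≈⟨ X-sum v (λ j → pow (toℕ j) one) i ⟨
      X (mul v one) i  ≈⟨ X-cong (mul-identityʳ v) i ⟩
      X v i                                    ∎

    x^j≈pow : ∀ j → x ^ᴿ j ≋ⱽ pow j one
    x^j≈pow zero    i = refl
    x^j≈pow (suc j) i = trans (x*v≈Xv (x ^ᴿ j) i) (X-cong (x^j≈pow j) i)

    scale : ∀ a v → mul (λ i → a * one i) v ≋ⱽ λ i → a * v i
    scale a v i = begin
      mul (λ i → a * one i) v i  ≈⟨ mul-comm (λ i → a * one i) v i ⟩
      mul v (λ i → a * one i) i  ≈⟨ sum-cong-≋ (λ j → *-congˡ {v j} (pow-* (toℕ j) one i)) ⟩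
      sum (λ j → v j * (a * pow (toℕ j) one i))
        ≈⟨ sum-cong-≋ (λ j → solve 3 (λ a b c → a :* (b :* c) := b :* (a :* c)) refl (v j) a (pow (toℕ j) one i)) ⟩
      sum (λ j → a * (v j * pow (toℕ j) one i)) ≈⟨ *-distribˡ-sum a (λ j → v j * pow (toℕ j) one i) ⟨
      a * mul v one i ≈⟨ *-congˡ (mul-identityʳ v i) ⟩
      a * v i ∎
      where
      pow-* : ∀ j v → pow j (λ i → a * v i) ≋ⱽ λ i → a * pow j v i
      pow-* zero    v i = refl
      pow-* (suc j) v i = trans (X-cong (pow-* j v) i) (X-* a (pow j v) i)

    ι : Hom K cyclicRing
    ι = record
      { ⟦_⟧ = λ a i → a * one i
      ; ⟦⟧-cong = λ e i → *-congʳ e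
      ; +-homo = λ a b i → distribʳ _ _ _
      ; *-homo = λ a b i → trans (*-assoc a b (one i)) (sym (scale a (λ i → b * one i) i))
      ; 1-homo = λ i → *-identityˡ _
      }

    private
      sumᴿ-app : ∀ {m} (f : Fin m → V) i → Sum.sum R.semiring f i ≈ sum (λ j → f j i)
      sumᴿ-app {zero}  f i = refl
      sumᴿ-app {suc m} f i = +-congˡ (sumᴿ-app (f ∘ suc) i)

    expand : ∀ u → u R.≈ Sum.sum R.semiring (λ j → ⟦ ι ⟧ (u j) R.* x ^ᴿ toℕ j)
    expand u i = begin
      u i  ≈⟨ mul-identityʳ u i ⟨
      sum (λ j → u j * pow (toℕ j) one i)  ≈⟨ sum-cong-≋ (λ j → *-congˡ {u j} (x^j≈pow (toℕ j) i)) ⟨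
      sum (λ j → u j * (x ^ᴿ toℕ j) i)  ≈⟨ sum-cong-≋ (λ j → scale (u j) (x ^ᴿ toℕ j) i) ⟨
      sum (λ j → mul (⟦ ι ⟧ (u j)) (x ^ᴿ toℕ j) i)    ≈⟨ sumᴿ-app (λ j → mul (⟦ ι ⟧ (u j)) (x ^ᴿ toℕ j)) i ⟨
      Sum.sum R.semiring (λ j → ⟦ ι ⟧ (u j) R.* x ^ᴿ toℕ j) i ∎

    -- The universal property of the generator `x`. Products are built from powers of X, so
    -- evaluation at ξ is multiplicative as soon as it sends `one` to 1 and turns X into
    -- multiplication by ξ.
    module Extend (S : CommutativeRing c′ ℓ′) (τ : Hom K S) (ξ : CommutativeRing.Carrier S) where
      private module S = CommutativeRing S
      open Exp S.semiring using () renaming (_^_ to _^ˢ_)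
      private module Σˢ = Sum S.semiring
      private module ≈ˢ = SetoidReasoning S.setoid

      ev : V → S.Carrier
      ev u = Σˢ.sum (λ j → ⟦ τ ⟧ (u j) S.* ξ ^ˢ toℕ j)

      ev-cong : ∀ {u v} → u ≋ⱽ v → ev u S.≈ ev v
      ev-cong e = Σˢ.sum-cong-≋ λ j → S.*-congʳ {ξ ^ˢ toℕ j} (⟦⟧-cong τ (e j))

      ev-+ : ∀ u v → ev (λ i → u i + v i) S.≈ ev u S.+ ev v
      ev-+ u v = S.trans (Σˢ.sum-cong-≋ λ j → S.trans (S.*-congʳ {ξ ^ˢ toℕ j} (+-homo τ (u j) (v j))) (S.distribʳ _ _ _))
        (Σˢ.∑-distrib-+ (λ j → ⟦ τ ⟧ (u j) S.* ξ ^ˢ toℕ j) (λ j → ⟦ τ ⟧ (v j) S.* ξ ^ˢ toℕ j))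

      ev-* : ∀ a v → ev (λ i → a * v i) S.≈ ⟦ τ ⟧ a S.* ev v
      ev-* a v = S.trans (Σˢ.sum-cong-≋ λ j → S.trans (S.*-congʳ {ξ ^ˢ toℕ j} (*-homo τ a (v j))) (S.*-assoc _ _ _))
        (S.sym (Σˢ.*-distribˡ-sum (⟦ τ ⟧ a) (λ j → ⟦ τ ⟧ (v j) S.* ξ ^ˢ toℕ j)))

      ev-0 : ev (λ _ → 0#) S.≈ S.0#
      ev-0 = S.trans (ev-cong (λ _ → sym (zeroˡ 0#))) (S.trans (ev-* 0# (λ _ → 0#))
        (S.trans (S.*-congʳ (0-homo τ)) (S.zeroˡ _)))

      module _ (ev-one : ev one S.≈ S.1#) (ev-X : ∀ v → ev (X v) S.≈ ξ S.* ev v) where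

        ev-pow : ∀ j v → ev (pow j v) S.≈ ξ ^ˢ j S.* ev v
        ev-pow zero    v = S.sym (S.*-identityˡ _)
        ev-pow (suc j) v = S.trans (ev-X (pow j v)) (S.trans (S.*-congˡ (ev-pow j v)) (S.sym (S.*-assoc _ _ _)))

        ev-sum : ∀ {m} (a : Fin m → Carrier) (f : Fin m → V) →
          ev (λ i → sum (λ j → a j * f j i)) S.≈ Σˢ.sum (λ j → ⟦ τ ⟧ (a j) S.* ev (f j))
        ev-sum {zero}  a f = ev-0
        ev-sum {suc m} a f = S.trans
          (ev-+ (λ i → a zero * f zero i) (λ i → sum (λ j → a (suc j) * f (suc j) i)))
          (S.+-cong (ev-* _ _) (ev-sum (a ∘ suc) (f ∘ suc)))

        ev-mul : ∀ u v → ev (mul u v) S.≈ ev u S.* ev v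
        ev-mul u v = ≈ˢ.begin
          ev (mul u v) ≈ˢ.≈⟨ ev-sum u (λ j → pow (toℕ j) v) ⟩
          Σˢ.sum (λ j → ⟦ τ ⟧ (u j) S.* ev (pow (toℕ j) v))
            ≈ˢ.≈⟨ Σˢ.sum-cong-≋ (λ j → S.trans (S.*-congˡ {⟦ τ ⟧ (u j)} (ev-pow (toℕ j) v)) (S.sym (S.*-assoc _ _ _))) ⟩
          Σˢ.sum (λ j → ⟦ τ ⟧ (u j) S.* ξ ^ˢ toℕ j S.* ev v)
            ≈ˢ.≈⟨ Σˢ.*-distribʳ-sum (ev v) (λ j → ⟦ τ ⟧ (u j) S.* ξ ^ˢ toℕ j) ⟨
          ev u S.* ev v ≈ˢ.∎

        extend : Hom cyclicRing S
        extend = record { ⟦_⟧ = ev ; ⟦⟧-cong = ev-cong ; +-homo = ev-+ ; *-homo = ev-mul ; 1-homo = ev-one }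

        extend-ι : ∀ a → ev (⟦ ι ⟧ a) S.≈ ⟦ τ ⟧ a
        extend-ι a = S.trans (ev-* a one) (S.trans (S.*-congˡ ev-one) (S.*-identityʳ _))

        extend-x : ev x S.≈ ξ
        extend-x = S.trans (ev-X one) (S.trans (S.*-congˡ ev-one) (S.*-identityʳ _))

-- K[x] / (xⁿ − Σ_j w_j xʲ) for n = k + 1
module Companion (K : CommutativeRing c ℓ) (k : ℕ) (w : Fin (suc k) → CommutativeRing.Carrier K) where
  open CommutativeRing K hiding (zero)
  open ℤSolver K using (solve; _:=_; _:+_; _:*_)
  open Sum semiring
  open Kronecker K
  private n = suc k

  private
    last : (Fin n → Carrier) → Carrier
    last v = v (fromℕ k)

    -- The companion matrix, that is, multiplication by x in the basis 1, x, ..., xᵏ: coefficients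
    -- move up by one place and the one that leaves the range is spread out along `w`.
    X : (Fin n → Carrier) → (Fin n → Carrier)
    X v zero    = last v * w zero
    X v (suc i) = v (inject₁ i) + last v * w (suc i)

  open Cyclic K n X

  private
    X-cong : ∀ {u v} → u ≋ⱽ v → X u ≋ⱽ X v
    X-cong e zero    = *-congʳ (e _)
    X-cong e (suc i) = +-cong (e _) (*-congʳ (e _))

    X-+ : ∀ u v → X (λ i → u i + v i) ≋ⱽ λ i → X u i + X v i
    X-+ u v zero    = distribʳ _ _ _
    X-+ u v (suc i) = solve 5 (λ a b c d e → a :+ b :+ (c :+ d) :* e := a :+ c :* e :+ (b :+ d :* e)) refl _ _ _ _ _

    X-* : ∀ a v → X (λ i → a * v i) ≋ⱽ λ i → a * X v i
    X-* a v zero    = *-assoc _ _ _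
    X-* a v (suc i) = solve 4 (λ a b c d → a :* b :+ a :* c :* d := a :* (b :+ c :* d)) refl _ _ _ _

    unit-inject₁ : ∀ {m} (i j : Fin m) → unit (inject₁ i) (inject₁ j) ≡ unit i j
    unit-inject₁ zero    zero    = ≡.refl
    unit-inject₁ zero    (suc j) = ≡.refl
    unit-inject₁ (suc i) zero    = ≡.refl
    unit-inject₁ (suc i) (suc j) = unit-inject₁ i j

    X-unit : ∀ j → X (unit (inject₁ j)) ≋ⱽ unit (suc j)
    X-unit j zero    = trans (*-congʳ (reflexive (unit-≢ {i = inject₁ j} (Finₚ.fromℕ≢inject₁ ∘ ≡.sym)))) (zeroˡ _)
    X-unit j (suc i) = trans (+-cong (reflexive (unit-inject₁ j i))
      (trans (*-congʳ (reflexive (unit-≢ {i = inject₁ j} (Finₚ.fromℕ≢inject₁ ∘ ≡.sym)))) (zeroˡ _))) (+-identityʳ _)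

    pow-one : ∀ j → pow (toℕ j) (unit zero) ≋ⱽ unit j
    pow-one j = lem (toℕ j) j ≡.refl
      where
      lem : ∀ m j → toℕ j ≡ m → pow m (unit zero) ≋ⱽ unit j
      lem zero    zero    e i = refl
      lem (suc m) (suc j) e i = trans
        (X-cong (lem m (inject₁ j) (≡.trans (toℕ-inject₁ j) (ℕₚ.suc-injective e))) i) (X-unit j i)

    isCyclic : IsCyclic
    isCyclic = record { X-cong = X-cong ; X-+ = X-+ ; X-* = X-* ; one = unit zero ; pow-one = pow-one }

  open Multiplication isCyclic public using (ι; x; expand) renaming (cyclicRing to companionRing)
  open Multiplication isCyclic using (x^j≈pow; module Extend)

  private module R = CommutativeRing companionRing
  open Exp R.semiring using () renaming (_^_ to _^ᴿ_)

  x^n : x ^ᴿ n R.≈ Sum.sum R.semiring (λ j → ⟦ ι ⟧ (w j) R.* x ^ᴿ toℕ j)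
  x^n i = trans (x^j≈pow n i) (trans (trans (X-cong pow-last i) (X-last i)) (expand w i))
    where
    pow-last : pow k (unit zero) ≋ⱽ unit (fromℕ k)
    pow-last i = trans (reflexive (≡.cong (λ m → pow m (unit zero) i) (≡.sym (toℕ-fromℕ k)))) (pow-one (fromℕ k) i)
    X-last : X (unit (fromℕ k)) ≋ⱽ w
    X-last zero    = trans (*-congʳ (reflexive (unit-≡ (fromℕ k)))) (*-identityˡ _)
    X-last (suc i) = trans (+-cong (reflexive (unit-≢ {i = fromℕ k} Finₚ.fromℕ≢inject₁))
      (trans (*-congʳ (reflexive (unit-≡ (fromℕ k)))) (*-identityˡ _))) (+-identityˡ _)

  module _ (S : CommutativeRing c′ ℓ′) (τ : Hom K S) (ξ : CommutativeRing.Carrier S) where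
    private module S = CommutativeRing S
    open Exp S.semiring using () renaming (_^_ to _^ˢ_)
    private module Σˢ = Sum S.semiring
    open Extend S τ ξ using (ev; ev-cong; ev-+; ev-*)
    open ℤSolver S using () renaming (solve to solveˢ; _:=_ to _:=ˢ_; _:+_ to _:+ˢ_; _:*_ to _:*ˢ_)
    open SetoidReasoning S.setoid

    module _ (ξ^n : ξ ^ˢ n S.≈ Σˢ.sum (λ j → ⟦ τ ⟧ (w j) S.* ξ ^ˢ toℕ j)) where

      private
        ev-X : ∀ v → ev (X v) S.≈ ξ S.* ev v
        ev-X v = begin
          ev (X v) ≈⟨ ev-cong split ⟩
          ev (λ i → shift i + last v * w i) ≈⟨ ev-+ shift (λ i → last v * w i) ⟩
          ev shift S.+ ev (λ i → last v * w i) ≈⟨ S.+-cong ev-shift (S.trans (ev-* (last v) w) (S.*-congˡ (S.sym ξ^n))) ⟩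
          ξ S.* Σˢ.sum (λ j → term (inject₁ j)) S.+ ⟦ τ ⟧ (last v) S.* (ξ S.* ξ ^ˢ k)
            ≈⟨ solveˢ 4 (λ a b c d → a :*ˢ b :+ˢ c :*ˢ (a :*ˢ d) :=ˢ a :*ˢ (b :+ˢ c :*ˢ d)) S.refl
                 ξ (Σˢ.sum (λ j → term (inject₁ j))) (⟦ τ ⟧ (last v)) (ξ ^ˢ k) ⟩
          ξ S.* (Σˢ.sum (λ j → term (inject₁ j)) S.+ ⟦ τ ⟧ (last v) S.* ξ ^ˢ k)
            ≡⟨ ≡.cong (λ m → ξ S.* (Σˢ.sum (λ j → term (inject₁ j)) S.+ ⟦ τ ⟧ (last v) S.* ξ ^ˢ m)) (≡.sym (toℕ-fromℕ k)) ⟩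
          ξ S.* (Σˢ.sum (λ j → term (inject₁ j)) S.+ term (fromℕ k)) ≈⟨ S.*-congˡ (Σˢ.sum-init-last term) ⟨
          ξ S.* ev v ∎
          where
          term : Fin n → S.Carrier
          term j = ⟦ τ ⟧ (v j) S.* ξ ^ˢ toℕ j
          shift : Fin n → Carrier
          shift zero    = 0#
          shift (suc i) = v (inject₁ i)
          split : X v ≋ⱽ λ i → shift i + last v * w i
          split zero    = sym (+-identityˡ _)
          split (suc i) = refl
          ev-shift : ev shift S.≈ ξ S.* Σˢ.sum (λ j → term (inject₁ j))
          ev-shift = begin
            ⟦ τ ⟧ 0# S.* S.1# S.+ Σˢ.sum {k} (λ j → ⟦ τ ⟧ (v (inject₁ j)) S.* (ξ S.* ξ ^ˢ toℕ j))
              ≈⟨ S.+-congʳ (S.trans (S.*-congʳ (0-homo τ)) (S.zeroˡ _)) ⟩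
            S.0# S.+ Σˢ.sum {k} (λ j → ⟦ τ ⟧ (v (inject₁ j)) S.* (ξ S.* ξ ^ˢ toℕ j)) ≈⟨ S.+-identityˡ _ ⟩
            Σˢ.sum {k} (λ j → ⟦ τ ⟧ (v (inject₁ j)) S.* (ξ S.* ξ ^ˢ toℕ j))
              ≈⟨ Σˢ.sum-cong-≋ {k} (λ j → S.trans (solveˢ 3 (λ a b c → a :*ˢ (b :*ˢ c) :=ˢ b :*ˢ (a :*ˢ c)) S.refl
                    (⟦ τ ⟧ (v (inject₁ j))) ξ (ξ ^ˢ toℕ j))
                   (S.*-congˡ {ξ} (S.*-congˡ {⟦ τ ⟧ (v (inject₁ j))} (S.reflexive (≡.cong (ξ ^ˢ_) (≡.sym (toℕ-inject₁ j))))))) ⟩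
            Σˢ.sum {k} (λ j → ξ S.* term (inject₁ j)) ≈⟨ Σˢ.*-distribˡ-sum {k} ξ (λ j → term (inject₁ j)) ⟨
            ξ S.* Σˢ.sum (λ j → term (inject₁ j)) ∎

        ev-one : ev (unit zero) S.≈ S.1#
        ev-one = begin
          ⟦ τ ⟧ 1# S.* S.1# S.+ Σˢ.sum {k} (λ j → ⟦ τ ⟧ 0# S.* (ξ S.* ξ ^ˢ toℕ j))
            ≈⟨ S.+-cong (S.trans (S.*-identityʳ _) (1-homo τ))
                 (Kronecker.sum-zero S {k} _ λ j → S.trans (S.*-congʳ (0-homo τ)) (S.zeroˡ _)) ⟩
          S.1# S.+ S.0# ≈⟨ S.+-identityʳ _ ⟩
          S.1# ∎

      extend : Hom companionRing S
      extend = Extend.extend S τ ξ ev-one ev-X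

      extend-ι : ∀ a → ⟦ extend ⟧ (⟦ ι ⟧ a) S.≈ ⟦ τ ⟧ a
      extend-ι = Extend.extend-ι S τ ξ ev-one ev-X

      extend-x : ⟦ extend ⟧ x S.≈ ξ
      extend-x = Extend.extend-x S τ ξ ev-one ev-X

-- Artin–Schreier extensions

_^ʰ_ : ∀ {R : CommutativeRing c ℓ} → Hom R R → ℕ → Hom R R
σ ^ʰ zero  = idʰ
σ ^ʰ suc i = σ ∘ʰ (σ ^ʰ i)

module Difference {R : CommutativeRing c ℓ} (σ : Hom R R) where
  open CommutativeRing R hiding (zero)
  open Endomorphisms R
  open ℤSolver R using (solve; _:=_; _:+_; _:*_; :-_)
  open SetoidReasoning setoid

  Δ : End
  Δ = record
    { app = λ u → ⟦ σ ⟧ u + - u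
    ; app-cong = λ e → +-cong (⟦⟧-cong σ e) (-‿cong e)
    ; app-+ = λ u v → trans (+-congʳ (+-homo σ u v))
        (solve 4 (λ a b c d → a :+ b :+ :- (c :+ d) := a :+ :- c :+ (b :+ :- d)) refl _ _ _ _)
    }

  σ≈1+Δ : ∀ u → ⟦ σ ⟧ u ≈ app Δ u + u
  σ≈1+Δ u = solve 2 (λ a b → a := a :+ :- b :+ b) refl _ _

  -- The Leibniz rule twisted by σ in the first term. Since σ = 1 + Δ preserves every ker Δˢ, the
  -- twist does no harm in degree estimates.
  Δ-* : ∀ u v → app Δ (u * v) ≈ ⟦ σ ⟧ u * app Δ v + app Δ u * v
  Δ-* u v = trans (+-congʳ (*-homo σ u v))
    (solve 4 (λ a b c d → a :* b :+ :- (c :* d) := a :* (b :+ :- d) :+ (a :+ :- c) :* d) refl _ _ _ _)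

  fixed-Δ : ∀ {u} → ⟦ σ ⟧ u ≈ u → app Δ u ≈ 0#
  fixed-Δ {u} e = trans (+-congʳ e) (-‿inverseʳ u)

  Δ-fixed : ∀ {u} → app Δ u ≈ 0# → ⟦ σ ⟧ u ≈ u
  Δ-fixed {u} e = trans (σ≈1+Δ u) (trans (+-congʳ e) (+-identityˡ u))

  Δ-scale : ∀ {u} → ⟦ σ ⟧ u ≈ u → ∀ v → app Δ (u * v) ≈ u * app Δ v
  Δ-scale {u} e v = trans (Δ-* u v) (trans (+-cong (*-congʳ e) (trans (*-congʳ (fixed-Δ e)) (zeroˡ _))) (+-identityʳ _))

  Δ↑-scale : ∀ {u} → ⟦ σ ⟧ u ≈ u → ∀ n v → app (Δ ↑ n) (u * v) ≈ u * app (Δ ↑ n) v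
  Δ↑-scale e zero    v = refl
  Δ↑-scale e (suc n) v = trans (app-cong Δ (Δ↑-scale e n v)) (Δ-scale e _)

  -- By the Leibniz rule the flag ker Δˢ behaves like polynomials of degree < s under multiplication.
  Δ↑-mul : ∀ s a b → a ℕ.+ b ≡ s → ∀ {u v} → app (Δ ↑ suc a) u ≈ 0# → app (Δ ↑ suc b) v ≈ 0# →
    app (Δ ↑ suc s) (u * v) ≈ 0#
  Δ↑-mul s a b e {u} {v} eu ev = begin
    app (Δ ↑ suc s) (u * v)  ≈⟨ ↑-suc-comm Δ s (u * v) ⟨
    app (Δ ↑ s) (app Δ (u * v))        ≈⟨ app-cong (Δ ↑ s) (Δ-* u v) ⟩
    app (Δ ↑ s) (⟦ σ ⟧ u * app Δ v + app Δ u * v) ≈⟨ app-+ (Δ ↑ s) _ _ ⟩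
    app (Δ ↑ s) (⟦ σ ⟧ u * app Δ v) + app (Δ ↑ s) (app Δ u * v) ≈⟨ +-cong (first s b e ev) (second s a e eu) ⟩
    0# + 0# ≈⟨ +-identityˡ 0# ⟩
    0# ∎
    where
    -- The twist in the Leibniz rule: as σ = 1 + Δ, the factor `⟦ σ ⟧ u` satisfies the same
    -- hypothesis as u, and the induction applies to it with the same a.
    σu : app (Δ ↑ suc a) (⟦ σ ⟧ u) ≈ 0#
    σu = begin
      app (Δ ↑ suc a) (⟦ σ ⟧ u)        ≈⟨ app-cong (Δ ↑ suc a) (σ≈1+Δ u) ⟩
      app (Δ ↑ suc a) (app Δ u + u)    ≈⟨ app-+ (Δ ↑ suc a) _ _ ⟩
      app (Δ ↑ suc a) (app Δ u) + app (Δ ↑ suc a) u ≈⟨ +-cong (trans (↑-suc-comm Δ (suc a) u) (trans (app-cong Δ eu) (app-0 Δ))) eu ⟩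
      0# + 0#  ≈⟨ +-identityˡ 0# ⟩
      0#                               ∎
    first : ∀ s b → a ℕ.+ b ≡ s → app (Δ ↑ suc b) v ≈ 0# → app (Δ ↑ s) (⟦ σ ⟧ u * app Δ v) ≈ 0#
    first s zero    _ ev = trans (app-cong (Δ ↑ s) (trans (*-congˡ ev) (zeroʳ _))) (app-0 (Δ ↑ s))
    first zero (suc b) e _ with () ← ≡.trans (≡.sym (ℕₚ.+-suc a b)) e
    first (suc s) (suc b) e ev = Δ↑-mul s a b (ℕₚ.suc-injective (≡.trans (≡.sym (ℕₚ.+-suc a b)) e)) σu
      (trans (↑-suc-comm Δ (suc b) v) ev)
    second : ∀ s a → a ℕ.+ b ≡ s → app (Δ ↑ suc a) u ≈ 0# → app (Δ ↑ s) (app Δ u * v) ≈ 0#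
    second s zero    _ eu = trans (app-cong (Δ ↑ s) (trans (*-congʳ eu) (zeroˡ _))) (app-0 (Δ ↑ s))
    second zero (suc a) () _
    second (suc s) (suc a) e eu = Δ↑-mul s a b (ℕₚ.suc-injective e) (trans (↑-suc-comm Δ (suc a) u) eu) ev

  module Chain (n : ℕ) (e : ℕ → Carrier) (e-zero : e 0 ≈ 1#) (Δ-e : ∀ {i} → suc i < n → app Δ (e (suc i)) ≈ e i) where

    Δ↑-e : ∀ s {i} → s ℕ.+ i < n → app (Δ ↑ s) (e (s ℕ.+ i)) ≈ e i
    Δ↑-e zero    _     = refl
    Δ↑-e (suc s) s+i<n = trans (sym (↑-suc-comm Δ s _))
      (trans (app-cong (Δ ↑ s) (Δ-e s+i<n)) (Δ↑-e s (ℕₚ.<-trans (ℕₚ.n<1+n _) s+i<n)))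

    Δ↑-e-same : ∀ {s} → s < n → app (Δ ↑ s) (e s) ≈ 1#
    Δ↑-e-same {s} s<n = trans (reflexive (≡.cong (λ i → app (Δ ↑ s) (e i)) (≡.sym (ℕₚ.+-identityʳ s))))
      (trans (Δ↑-e s (≡.subst (_< n) (≡.sym (ℕₚ.+-identityʳ s)) s<n)) e-zero)

    Δ↑-e-0 : ∀ {s i} → i < s → i < n → app (Δ ↑ s) (e i) ≈ 0#
    Δ↑-e-0 {s}     {zero}  0<s _ = trans (app-cong (Δ ↑ s) e-zero) (↑-zero Δ (fixed-Δ (1-homo σ)) 0<s)
    Δ↑-e-0 {suc s} {suc i} (s≤s i<s) i<n = trans (sym (↑-suc-comm Δ s _))
      (trans (app-cong (Δ ↑ s) (Δ-e i<n)) (Δ↑-e-0 i<s (ℕₚ.<-trans (ℕₚ.n<1+n i) i<n)))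

module Frobenius (R : CommutativeRing c ℓ) {p} (pp : Prime p) (p·1≈0 : AnnihilatesOne R p) where
  open CommutativeRing R hiding (zero)
  open Endomorphisms R
  open Exp semiring
  open GroupProperties +-group using (inverseʳ-unique)

  frob-+ : ∀ u v → (u + v) ^ p ≈ u ^ p + v ^ p
  frob-+ u v = Freshman.freshman semiring pp p·1≈0 (*-comm u v)

  frob-0 : 0# ^ p ≈ 0#
  frob-0 = 0^n≈0 p (ℕₚ.<⇒≤ (prime⇒1< pp))
    where
    0^n≈0 : ∀ n → 0 < n → 0# ^ n ≈ 0#
    0^n≈0 (suc n) _ = zeroˡ _

  frob-neg : ∀ u → (- u) ^ p ≈ - (u ^ p)
  frob-neg u = inverseʳ-unique (u ^ p) ((- u) ^ p)
    (trans (sym (frob-+ u (- u))) (trans (^-congˡ p (-‿inverseʳ u)) frob-0))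

  frob-* : ∀ u v → (u * v) ^ p ≈ u ^ p * v ^ p
  frob-* u v = CommutativeExp.^-distrib-* commutativeSemiring u v p

  module _ (σ : Hom R R) where
    open Difference σ

    Δ-frob : ∀ u → app Δ u ^ p ≈ app Δ (u ^ p)
    Δ-frob u = trans (frob-+ (⟦ σ ⟧ u) (- u)) (+-cong (sym (^-homo σ u p)) (frob-neg u))

    Δ↑-frob : ∀ n u → app (Δ ↑ n) u ^ p ≈ app (Δ ↑ n) (u ^ p)
    Δ↑-frob zero    u = refl
    Δ↑-frob (suc n) u = trans (Δ-frob _) (app-cong Δ (Δ↑-frob n u))

module Filtration (K : DecField c ℓ) (R : CommutativeRing c ℓ) (ι : Hom (DecField.commutativeRing K) R)
  (x : CommutativeRing.Carrier R) where
  private module K = DecField K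
  open CommutativeRing R hiding (zero)
  open ℤSolver R using (solve; _:=_; _:+_; _:*_; :-_)
  open Exp semiring
  open SetoidReasoning setoid

  -- A polynomial of degree less than j in x that represents u. Uniqueness of the representation is
  -- not built in; independence of the powers of x is proved later by means of Δ.
  data Below : ℕ → Carrier → Set (c ⊔ ℓ) where
    zero : ∀ {u} → u ≈ 0# → Below 0 u
    suc  : ∀ {j u} a u′ → Below j u′ → u ≈ ⟦ ι ⟧ a * x ^ j + u′ → Below (suc j) u

  -- The leading coefficient may vanish, so that sums need no case distinction; `classify` finds the
  -- true degree when it matters.
  record Lead (j : ℕ) (a : K.Carrier) (u : Carrier) : Set (c ⊔ ℓ) where
    constructor lead
    field
      rest  : Carrier
      below : Below j rest
      u≈    : u ≈ ⟦ ι ⟧ a * x ^ j + rest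

  lead-below : ∀ {j a u} → Lead j a u → Below (suc j) u
  lead-below {a = a} (lead u′ b e) = suc a u′ b e

  below-cong : ∀ {j u v} → u ≈ v → Below j u → Below j v
  below-cong e (zero e′)       = zero (trans (sym e) e′)
  below-cong e (suc a u′ b e′) = suc a u′ b (trans (sym e) e′)

  lead-cong : ∀ {j a b u v} → a K.≈ b → u ≈ v → Lead j a u → Lead j b v
  lead-cong a≈b e (lead u′ b e′) = lead u′ b (trans (sym e) (trans e′ (+-congʳ (*-congʳ (⟦⟧-cong ι a≈b)))))

  below-weaken : ∀ {j u} → Below j u → Below (suc j) u
  below-weaken {u = u} b = suc K.0# u b (sym (trans (+-congʳ (trans (*-congʳ (0-homo ι)) (zeroˡ _))) (+-identityˡ u)))

  below-0 : ∀ j → Below j 0#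
  below-0 zero    = zero refl
  below-0 (suc j) = below-weaken (below-0 j)

  below-+ : ∀ {j u v} → Below j u → Below j v → Below j (u + v)
  below-+ (zero e) (zero e′) = zero (trans (+-cong e e′) (+-identityˡ 0#))
  below-+ (suc a u′ b e) (suc a₁ u₁ b₁ e₁) = suc (a K.+ a₁) (u′ + u₁) (below-+ b b₁) (begin
    _ ≈⟨ +-cong e e₁ ⟩
    _ ≈⟨ solve 5 (λ a x u b v → a :* x :+ u :+ (b :* x :+ v) := (a :+ b) :* x :+ (u :+ v)) refl _ _ _ _ _ ⟩
    _ ≈⟨ +-congʳ (*-congʳ (+-homo ι a a₁)) ⟨
    _ ∎)

  below-scale : ∀ {j u} d → Below j u → Below j (⟦ ι ⟧ d * u)
  below-scale d (zero e) = zero (trans (*-congˡ e) (zeroʳ _))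
  below-scale d (suc a u′ b e) = suc (d K.* a) (⟦ ι ⟧ d * u′) (below-scale d b) (begin
    _ ≈⟨ *-congˡ e ⟩
    _ ≈⟨ solve 4 (λ d a x u → d :* (a :* x :+ u) := d :* a :* x :+ d :* u) refl _ _ _ _ ⟩
    _ ≈⟨ +-congʳ (*-congʳ (*-homo ι d a)) ⟨
    _ ∎)

  below-neg : ∀ {j u} → Below j u → Below j (- u)
  below-neg {u = u} b = below-cong (begin
    ⟦ ι ⟧ (K.- K.1#) * u ≈⟨ *-congʳ (trans (neg-homo ι K.1#) (-‿cong (1-homo ι))) ⟩
    - 1# * u  ≈⟨ solve 2 (λ o u → :- o :* u := :- (o :* u)) refl 1# u ⟩
    - (1# * u)           ≈⟨ -‿cong (*-identityˡ u) ⟩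
    - u ∎) (below-scale (K.- K.1#) b)

  below-x : ∀ {j u} → Below j u → Below (suc j) (x * u)
  below-x (zero e) = below-weaken (zero (trans (*-congˡ e) (zeroʳ _)))
  below-x (suc a u′ b e) = suc a (x * u′) (below-x b) (trans (*-congˡ e)
    (solve 4 (λ x a y u → x :* (a :* y :+ u) := a :* (x :* y) :+ x :* u) refl _ _ _ _))

  below-x^ : ∀ t {j u} → Below j u → Below (t ℕ.+ j) (x ^ t * u)
  below-x^ zero    b = below-cong (sym (*-identityˡ _)) b
  below-x^ (suc t) b = below-cong (sym (*-assoc _ _ _)) (below-x (below-x^ t b))

  lead-x^ : ∀ t → Lead t K.1# (x ^ t)
  lead-x^ t = lead 0# (below-0 t) (sym (trans (+-identityʳ _) (trans (*-congʳ (1-homo ι)) (*-identityˡ _))))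

  lead-+-below : ∀ {j a u v} → Lead j a u → Below j v → Lead j a (u + v)
  lead-+-below (lead u′ b e) b′ = lead (u′ + _) (below-+ b b′) (trans (+-congʳ e) (+-assoc _ _ _))

  lead-+ : ∀ {j a b u v} → Lead j a u → Lead j b v → Lead j (a K.+ b) (u + v)
  lead-+ {j} {a} {b} (lead u′ B e) (lead v′ B′ e′) = lead (u′ + v′) (below-+ B B′) (begin
    _ ≈⟨ +-cong e e′ ⟩
    _ ≈⟨ solve 5 (λ a x u b v → a :* x :+ u :+ (b :* x :+ v) := (a :+ b) :* x :+ (u :+ v)) refl _ _ _ _ _ ⟩
    _ ≈⟨ +-congʳ (*-congʳ (+-homo ι a b)) ⟨
    _ ∎)

  lead-scale : ∀ {j a u} d → Lead j a u → Lead j (d K.* a) (⟦ ι ⟧ d * u)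
  lead-scale {a = a} d (lead u′ b e) = lead (⟦ ι ⟧ d * u′) (below-scale d b) (begin
    _ ≈⟨ *-congˡ e ⟩
    _ ≈⟨ solve 4 (λ d a x u → d :* (a :* x :+ u) := d :* a :* x :+ d :* u) refl _ _ _ _ ⟩
    _ ≈⟨ +-congʳ (*-congʳ (*-homo ι d a)) ⟨
    _ ∎)

  lead-x : ∀ {j a u} → Lead j a u → Lead (suc j) a (x * u)
  lead-x (lead u′ b e) = lead (x * u′) (below-x b) (trans (*-congˡ e)
    (solve 4 (λ x a y u → x :* (a :* y :+ u) := a :* (x :* y) :+ x :* u) refl _ _ _ _))

  classify : ∀ {j u} → Below j u → (u ≈ 0#) ⊎ (∃[ r ] ∃[ a ] r < j × (¬ a K.≈ K.0#) × Lead r a u)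
  classify (zero e) = inj₁ e
  classify {suc j} (suc a u′ b e) with a K.≟ K.0#
  ... | no  a≉0 = inj₂ (j , a , ℕₚ.n<1+n j , a≉0 , lead u′ b e)
  ... | yes a≈0 with classify (below-cong {j} (sym (trans e (trans (+-congʳ
                       (trans (*-congʳ (trans (⟦⟧-cong ι a≈0) (0-homo ι))) (zeroˡ _))) (+-identityˡ _)))) b)
  ...   | inj₁ u≈0 = inj₁ u≈0
  ...   | inj₂ (r , a , r<j , a≉0 , l) = inj₂ (r , a , ℕₚ.m<n⇒m<1+n r<j , a≉0 , l)

-- `R` is to be shown a field. What makes this possible is σ x = x + 1: on polynomials of degree
-- less than p in x, Δ = σ - 1 behaves like differentiation.
module ArtinSchreier (K : DecField c ℓ) {p} (pp : Prime p)
  (p·1≈0 : AnnihilatesOne (DecField.commutativeRing K) p)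
  (i·1≉0 : ∀ {i} → 0 < i → i < p → ¬ AnnihilatesOne (DecField.commutativeRing K) i)
  (R : CommutativeRing c ℓ) (ι : Hom (DecField.commutativeRing K) R)
  (1≉0 : ¬ CommutativeRing._≈_ R (CommutativeRing.1# R) (CommutativeRing.0# R))
  (x : CommutativeRing.Carrier R)
  (spanned : ∀ u → Filtration.Below K R ι x p u)
  (σ : Hom R R)
  (σι : ∀ a → CommutativeRing._≈_ R (⟦ σ ⟧ (⟦ ι ⟧ a)) (⟦ ι ⟧ a))
  (σx : CommutativeRing._≈_ R (⟦ σ ⟧ x) (CommutativeRing._+_ R x (CommutativeRing.1# R)))
  where
  private module K = DecField K
  open CommutativeRing R hiding (zero)
  open ℤSolver R using (solve; _:=_; _:+_; _:*_; :-_)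
  open Exp semiring
  private
    module Kˣ = Exp K.semiring
    module K· = Mult K.semiring
  open K· using () renaming (_×_ to _·ᴷ_)
  open Endomorphisms R
  open Filtration K R ι x
  open Difference σ public
  open SetoidReasoning setoid

  ·-≉0 : ∀ {i a} → 0 < i → i < p → ¬ a K.≈ K.0# → ¬ i ·ᴷ a K.≈ K.0#
  ·-≉0 {i} {a} 0<i i<p a≉0 ia≈0 = a≉0 (K.cancel-≉0 (i·1≉0 0<i i<p)
    (K.trans (K·.×-assoc-* i K.1# a) (K.trans (K·.×-congʳ i (K.*-identityˡ a)) ia≈0)))

  Δ-x : app Δ x ≈ 1#
  Δ-x = trans (+-congʳ σx) (solve 2 (λ x o → x :+ o :+ :- x := o) refl x 1#)

  -- As in (x + 1)^(r+1) - x^(r+1), whose leading term is (r + 1) xʳ. The factor r + 1 is nonzero in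
  -- K as long as r + 1 < p.
  Δ-x^ : ∀ r → Lead r (suc r ·ᴷ K.1#) (app Δ (x ^ suc r))
  Δ-x^ zero = lead-cong (K.sym (K.+-identityʳ K.1#))
    (sym (trans (app-cong Δ (*-identityʳ x)) Δ-x)) (lead-x^ 0)
  Δ-x^ (suc r) = lead-cong (K.+-comm _ _) (sym (begin
      app Δ (x * y)  ≈⟨ Δ-* x y ⟩
      ⟦ σ ⟧ x * app Δ y + app Δ x * y ≈⟨ +-cong (*-congʳ σx) (*-congʳ Δ-x) ⟩
      (x + 1#) * app Δ y + 1# * y     ≈⟨ solve 4 (λ x o d y → (x :+ o) :* d :+ o :* y := x :* d :+ o :* y :+ o :* d) refl x 1# (app Δ y) y ⟩
      x * app Δ y + 1# * y + 1# * app Δ y ≈⟨ +-cong (+-congˡ (*-identityˡ _)) (*-identityˡ _) ⟩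
      x * app Δ y + y + app Δ y       ∎))
    (lead-+-below (lead-+ (lead-x (Δ-x^ r)) (lead-x^ (suc r))) (lead-below (Δ-x^ r)))
    where y = x ^ suc r

  Δ-below : ∀ {j u} → Below (suc j) u → Below j (app Δ u)
  Δ-lead  : ∀ {r a u} → Lead (suc r) a u → Lead r (suc r ·ᴷ a) (app Δ u)

  Δ-below {zero} (suc a u′ (zero u′≈0) e) = zero (fixed-Δ (trans (⟦⟧-cong σ e′) (trans (σι a) (sym e′))))
    where
    e′ = trans e (trans (+-cong (*-identityʳ _) u′≈0) (+-identityʳ _))
  Δ-below {suc j} (suc a u′ b e) = lead-below (Δ-lead (lead u′ b e))

  Δ-lead {r} {a} {u} (lead u′ b e) = lead-cong
    (K.trans (K·.×-comm-* (suc r) a K.1#) (K·.×-congʳ (suc r) (K.*-identityʳ a)))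
    (sym (trans (app-cong Δ e) (trans (app-+ Δ _ _) (+-congʳ (Δ-scale (σι a) _)))))
    (lead-+-below (lead-scale a (Δ-x^ r)) (Δ-below b))

  Δ↑-below : ∀ j {u} → Below j u → app (Δ ↑ j) u ≈ 0#
  Δ↑-below zero    (zero e) = e
  Δ↑-below (suc j) b        = trans (sym (↑-suc-comm Δ j _)) (Δ↑-below j (Δ-below b))

  Δ-nilpotent : ∀ u → app (Δ ↑ p) u ≈ 0#
  Δ-nilpotent u = Δ↑-below p (spanned u)

  lead-0 : ∀ {a u} → Lead 0 a u → u ≈ ⟦ ι ⟧ a
  lead-0 (lead u′ (zero u′≈0) e) = trans e (trans (+-cong (*-identityʳ _) u′≈0) (+-identityʳ _))

  -- Each Δ multiplies the leading coefficient by the current degree, a nonzero element of K below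
  -- p. After r steps r! a is left.
  Δ↑-lead : ∀ r {a u} → Lead r a u → ¬ a K.≈ K.0# → r < p → ∃[ b ] (¬ b K.≈ K.0#) × app (Δ ↑ r) u ≈ ⟦ ι ⟧ b
  Δ↑-lead zero    {a} l a≉0 r<p = a , a≉0 , lead-0 l
  Δ↑-lead (suc r) l a≉0 r<p =
    let b , b≉0 , e = Δ↑-lead r (Δ-lead l) (·-≉0 (s≤s z≤n) r<p a≉0) (ℕₚ.<-trans (ℕₚ.n<1+n r) r<p)
    in b , b≉0 , trans (sym (↑-suc-comm Δ r _)) e

  -- This is the linear independence of 1, x, ..., x^(p-1) over K: r applications of Δ turn u into a
  -- nonzero constant.
  lead-≉0 : ∀ {r a u} → Lead r a u → ¬ a K.≈ K.0# → r < p → ¬ u ≈ 0#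
  lead-≉0 {r} l a≉0 r<p u≈0 =
    let b , b≉0 , e = Δ↑-lead r l a≉0 r<p in b≉0 (Hom-injective K R 1≉0 ι (trans (sym e) (trans (app-cong (Δ ↑ r) u≈0) (app-0 (Δ ↑ r)))))

  -- An element of positive degree less than p keeps a nonzero leading coefficient under Δ, so only
  -- constants are killed.
  Δ-kernel : ∀ {u} → app Δ u ≈ 0# → ∃[ a ] u ≈ ⟦ ι ⟧ a
  Δ-kernel {u} Δu≈0 with classify (spanned u)
  ... | inj₁ u≈0 = K.0# , trans u≈0 (sym (0-homo ι))
  ... | inj₂ (zero  , a , r<p , a≉0 , l) = a , lead-0 l
  ... | inj₂ (suc r , a , r<p , a≉0 , l) = ⊥-elim
    (lead-≉0 (Δ-lead l) (·-≉0 (s≤s z≤n) r<p a≉0) (ℕₚ.<-trans (ℕₚ.n<1+n r) r<p) Δu≈0)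

  Δ-top : ∃[ t ] app (Δ ↑ (p ∸ 1)) t ≈ 1#
  -- Δ^(p-1) takes x^(p-1) to the constant b = (p - 1)!, which the scalar b⁻¹ normalises.
  Δ-top = ⟦ ι ⟧ b⁻¹ * x ^ (p ∸ 1) , (begin
    app (Δ ↑ (p ∸ 1)) (⟦ ι ⟧ b⁻¹ * x ^ (p ∸ 1)) ≈⟨ Δ↑-scale (σι b⁻¹) (p ∸ 1) _ ⟩
    ⟦ ι ⟧ b⁻¹ * app (Δ ↑ (p ∸ 1)) (x ^ (p ∸ 1)) ≈⟨ *-congˡ (proj₂ (proj₂ leading)) ⟩
    ⟦ ι ⟧ b⁻¹ * ⟦ ι ⟧ b   ≈⟨ *-homo ι b⁻¹ b ⟨
    ⟦ ι ⟧ (b⁻¹ K.* b)     ≈⟨ ⟦⟧-cong ι (K.trans (K.*-comm b⁻¹ b) (proj₂ (K.inverse b b≉0))) ⟩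
    ⟦ ι ⟧ K.1#  ≈⟨ 1-homo ι ⟩
    1#                    ∎)
    where
    leading = Δ↑-lead (p ∸ 1) (lead-x^ (p ∸ 1)) K.1≉0 (ℕₚ.∸-monoʳ-< {o = 0} (s≤s z≤n) (ℕₚ.<⇒≤ (prime⇒1< pp)))
    b = proj₁ leading
    b≉0 = proj₁ (proj₂ leading)
    b⁻¹ = proj₁ (K.inverse b b≉0)

  private
    p·1≈0ᴿ : AnnihilatesOne R p
    p·1≈0ᴿ = ·1≈0-homo ι p p·1≈0

    1<p : 1 < p
    1<p = prime⇒1< pp

  open Frobenius R pp p·1≈0ᴿ
  private module FK = Frobenius K.commutativeRing pp p·1≈0

  -- Δ commutes with the p-th power. If u ≠ 0 has degree r, then Δʳ u is a nonzero constant whose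
  -- p-th power is Δʳ (uᵖ) = 0, impossible in the field K.
  reduced : ∀ {u} → u ^ p ≈ 0# → u ≈ 0#
  reduced {u} u^p≈0 with classify (spanned u)
  ... | inj₁ u≈0 = u≈0
  ... | inj₂ (r , a , r<p , a≉0 , l) = let b , b≉0 , e = Δ↑-lead r l a≉0 r<p in ⊥-elim (b≉0 (K.x^n≈0⇒x≈0 p (Hom-injective K R 1≉0 ι (begin
    ⟦ ι ⟧ (b Kˣ.^ p)      ≈⟨ ^-homo ι b p ⟩
    ⟦ ι ⟧ b ^ p           ≈⟨ ^-congˡ p e ⟨
    app (Δ ↑ r) u ^ p     ≈⟨ Δ↑-frob σ r u ⟩
    app (Δ ↑ r) (u ^ p)   ≈⟨ app-cong (Δ ↑ r) u^p≈0 ⟩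
    app (Δ ↑ r) 0#        ≈⟨ app-0 (Δ ↑ r) ⟩
    0# ∎))))

  σ^-lead : ∀ i {r a u} → Lead r a u → Lead r a (⟦ σ ^ʰ i ⟧ u)
  σ^-lead zero    l = l
  σ^-lead (suc i) l = lead-cong K.refl (trans (+-comm _ _) (sym (σ≈1+Δ _)))
    (lead-+-below (σ^-lead i l) (Δ-below (lead-below (σ^-lead i l))))

  -- The difference telescopes into the i terms Δ (σˡ u) with l < i. Each σˡ u has the leading term
  -- of u, so all contribute the same leading coefficient.
  σ^-difference : ∀ i {r a u} → Lead (suc r) a u → Lead r (i ·ᴷ (suc r ·ᴷ a)) (⟦ σ ^ʰ i ⟧ u + - u)
  σ^-difference zero    {r} {u = u} l = lead 0# (below-0 r) (trans (-‿inverseʳ u)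
    (sym (trans (+-identityʳ _) (trans (*-congʳ (0-homo ι)) (zeroˡ _)))))
  σ^-difference (suc i) l = lead-cong K.refl
    (solve 3 (λ a b c → a :+ :- b :+ (b :+ :- c) := a :+ :- c) refl _ _ _)
    (lead-+ (Δ-lead (σ^-lead i l)) (σ^-difference i l))

  module _ (a₀ : K.Carrier) (x^p : x ^ p ≈ x + ⟦ ι ⟧ a₀) (no-root : ∀ z → ¬ z Kˣ.^ p K.+ a₀ K.≈ z) where

    -- With t also Δ t is fixed by the p-th power. In degree at least 2, induction makes Δ t
    -- constant, although its degree is positive. In degree 1, t = a x + d forces aᵖ = a and a a₀ +
    -- dᵖ = d, and then d / a is a root excluded by `no-root`.
    frob-fixed : ∀ {t} → t ^ p ≈ t → ∃[ d ] t ≈ ⟦ ι ⟧ d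
    frob-fixed {t} t^p≈t with classify (spanned t)
    ... | inj₁ t≈0 = K.0# , trans t≈0 (sym (0-homo ι))
    ... | inj₂ (r , a , r<p , a≉0 , l) = lem r l r<p a≉0 t^p≈t
      where
      lem : ∀ r {a t} → Lead r a t → r < p → ¬ a K.≈ K.0# → t ^ p ≈ t → ∃[ d ] t ≈ ⟦ ι ⟧ d
      lem zero {a} l _ _ _ = a , lead-0 l
      lem (suc (suc r)) {t = t} l r<p a≉0 e =
        let d , e′ = lem (suc r) (Δ-lead l) (ℕₚ.<-trans (ℕₚ.n<1+n _) r<p) (·-≉0 (s≤s z≤n) r<p a≉0) (trans (Δ-frob σ t) (app-cong Δ e))
        in ⊥-elim (lead-≉0 (Δ-lead (Δ-lead l))
        (·-≉0 (s≤s z≤n) (ℕₚ.<-trans (ℕₚ.n<1+n _) r<p) (·-≉0 (s≤s z≤n) r<p a≉0))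
        (ℕₚ.<-trans (ℕₚ.n<1+n r) (ℕₚ.<-trans (ℕₚ.n<1+n _) r<p))
        (fixed-Δ (trans (⟦⟧-cong σ e′) (trans (σι d) (sym e′)))))
      lem (suc zero) {a} {t} (lead u′ b@(suc d _ (zero z≈0) ez) et) r<p a≉0 e = ⊥-elim (no-root (e₁ K.* d) root)
        where
        t≈ : t ≈ ⟦ ι ⟧ a * x + ⟦ ι ⟧ d
        t≈ = trans et (+-cong (*-congˡ (*-identityʳ x)) (trans ez (trans (+-cong (*-identityʳ _) z≈0) (+-identityʳ _))))
        t^p≈ : t ^ p ≈ ⟦ ι ⟧ (a Kˣ.^ p) * (x + ⟦ ι ⟧ a₀) + ⟦ ι ⟧ (d Kˣ.^ p)
        t^p≈ = begin
          t ^ p  ≈⟨ ^-congˡ p t≈ ⟩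
          (⟦ ι ⟧ a * x + ⟦ ι ⟧ d) ^ p  ≈⟨ frob-+ _ _ ⟩
          (⟦ ι ⟧ a * x) ^ p + ⟦ ι ⟧ d ^ p          ≈⟨ +-congʳ (frob-* _ _) ⟩
          ⟦ ι ⟧ a ^ p * x ^ p + ⟦ ι ⟧ d ^ p        ≈⟨ +-cong (*-cong (sym (^-homo ι a p)) x^p) (sym (^-homo ι d p)) ⟩
          ⟦ ι ⟧ (a Kˣ.^ p) * (x + ⟦ ι ⟧ a₀) + ⟦ ι ⟧ (d Kˣ.^ p) ∎
        -- The equation tᵖ - t = 0 sorted by powers of x. By independence of 1 and x both
        -- coefficients vanish.
        difference≈0 : ⟦ ι ⟧ (a Kˣ.^ p K.+ K.- a) * x + ⟦ ι ⟧ (a Kˣ.^ p K.* a₀ K.+ d Kˣ.^ p K.+ K.- d) ≈ 0#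
        difference≈0 = begin
          ⟦ ι ⟧ (a Kˣ.^ p K.+ K.- a) * x + ⟦ ι ⟧ (a Kˣ.^ p K.* a₀ K.+ d Kˣ.^ p K.+ K.- d)
            ≈⟨ +-cong (*-congʳ (trans (+-homo ι _ _) (+-congˡ (neg-homo ι _))))
                 (trans (+-homo ι _ _) (+-cong (trans (+-homo ι _ _) (+-congʳ (*-homo ι _ _))) (neg-homo ι _))) ⟩
          (⟦ ι ⟧ (a Kˣ.^ p) + - ⟦ ι ⟧ a) * x + (⟦ ι ⟧ (a Kˣ.^ p) * ⟦ ι ⟧ a₀ + ⟦ ι ⟧ (d Kˣ.^ p) + - ⟦ ι ⟧ d)
            ≈⟨ solve 6 (λ A a x z D d → (A :+ :- a) :* x :+ (A :* z :+ D :+ :- d) := A :* (x :+ z) :+ D :+ :- (a :* x :+ d)) refl _ _ _ _ _ _ ⟩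
          ⟦ ι ⟧ (a Kˣ.^ p) * (x + ⟦ ι ⟧ a₀) + ⟦ ι ⟧ (d Kˣ.^ p) + - (⟦ ι ⟧ a * x + ⟦ ι ⟧ d)
            ≈⟨ +-cong t^p≈ (-‿cong t≈) ⟨
          t ^ p + - t ≈⟨ +-congʳ e ⟩
          t + - t ≈⟨ -‿inverseʳ t ⟩
          0# ∎
        difference-lead : Lead 1 (a Kˣ.^ p K.+ K.- a) (⟦ ι ⟧ (a Kˣ.^ p K.+ K.- a) * x + ⟦ ι ⟧ (a Kˣ.^ p K.* a₀ K.+ d Kˣ.^ p K.+ K.- d))
        difference-lead = lead _ (suc _ 0# (zero refl) (sym (trans (+-identityʳ _) (*-identityʳ _))))
          (+-congʳ (*-congˡ (sym (*-identityʳ x))))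
        module Kg = GroupProperties K.+-group
        a^p≈a : a Kˣ.^ p K.≈ a
        a^p≈a with a Kˣ.^ p K.+ K.- a K.≟ K.0#
        ... | yes e₀ = Kg.x∙y⁻¹≈ε⇒x≈y _ _ e₀
        ... | no e≉0 = ⊥-elim (lead-≉0 difference-lead e≉0 r<p difference≈0)
        ad-relation : a K.* a₀ K.+ d Kˣ.^ p K.≈ d
        ad-relation = Kg.x∙y⁻¹≈ε⇒x≈y _ _ (Hom-injective K R 1≉0 ι (begin
          ⟦ ι ⟧ (a K.* a₀ K.+ d Kˣ.^ p K.+ K.- d) ≈⟨ ⟦⟧-cong ι (K.+-congʳ (K.+-congʳ (K.*-congʳ a^p≈a))) ⟨
          ⟦ ι ⟧ (a Kˣ.^ p K.* a₀ K.+ d Kˣ.^ p K.+ K.- d) ≈⟨ +-identityˡ _ ⟨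
          0# + _ ≈⟨ +-congʳ (trans (*-congʳ (trans (⟦⟧-cong ι (K.trans (K.+-congʳ a^p≈a) (K.-‿inverseʳ a))) (0-homo ι))) (zeroˡ _)) ⟨
          _ + _ ≈⟨ difference≈0 ⟩
          0# ∎))
        e₁ = proj₁ (K.inverse a a≉0)
        ae≈1 = proj₂ (K.inverse a a≉0)
        open ℤSolver K.commutativeRing using () renaming (solve to solveᴷ; _:=_ to _:=ᴷ_; _:*_ to _:*ᴷ_; _:+_ to _:+ᴷ_)
        module KR = SetoidReasoning K.setoid
        e₁^p≈e₁ : e₁ Kˣ.^ p K.≈ e₁
        e₁^p≈e₁ = KR.begin
          e₁ Kˣ.^ p                       KR.≈⟨ K.*-identityʳ _ ⟨
          e₁ Kˣ.^ p K.* K.1#              KR.≈⟨ K.*-congˡ ae≈1 ⟨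
          e₁ Kˣ.^ p K.* (a K.* e₁)        KR.≈⟨ K.*-congˡ (K.*-congʳ a^p≈a) ⟨
          e₁ Kˣ.^ p K.* (a Kˣ.^ p K.* e₁) KR.≈⟨ solveᴷ 3 (λ e a f → e :*ᴷ (a :*ᴷ f) :=ᴷ (a :*ᴷ e) :*ᴷ f) K.refl _ _ _ ⟩
          (a Kˣ.^ p K.* e₁ Kˣ.^ p) K.* e₁ KR.≈⟨ K.*-congʳ (FK.frob-* a e₁) ⟨
          (a K.* e₁) Kˣ.^ p K.* e₁        KR.≈⟨ K.*-congʳ (Kˣ.^-congˡ p ae≈1) ⟩
          K.1# Kˣ.^ p K.* e₁              KR.≈⟨ K.*-congʳ (Freshman.1^n≈1 K.semiring p) ⟩
          K.1# K.* e₁                     KR.≈⟨ K.*-identityˡ e₁ ⟩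
          e₁                              KR.∎
        root : (e₁ K.* d) Kˣ.^ p K.+ a₀ K.≈ e₁ K.* d
        root = KR.begin
          (e₁ K.* d) Kˣ.^ p K.+ a₀           KR.≈⟨ K.+-cong (K.trans (FK.frob-* e₁ d) (K.*-congʳ e₁^p≈e₁)) (K.sym (K.trans (K.*-congʳ ae≈1) (K.*-identityˡ a₀))) ⟩
          e₁ K.* d Kˣ.^ p K.+ a K.* e₁ K.* a₀ KR.≈⟨ solveᴷ 4 (λ e D a z → e :*ᴷ D :+ᴷ a :*ᴷ e :*ᴷ z :=ᴷ e :*ᴷ (a :*ᴷ z :+ᴷ D)) K.refl _ _ _ _ ⟩
          e₁ K.* (a K.* a₀ K.+ d Kˣ.^ p)     KR.≈⟨ K.*-congˡ ad-relation ⟩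
          e₁ K.* d                           KR.∎

    -- Long division of z by u, possible because the leading coefficient of u is invertible; t
    -- bounds the degree of the quotient h.
    divide : ∀ {r a u} → Lead r a u → ¬ a K.≈ K.0# → ∀ t z → Below (t ℕ.+ r) z →
      ∃[ h ] Below t h × Below r (z + - (u * h))
    divide {u = u} l a≉0 zero z b = 0# , zero refl , below-cong
      (sym (trans (+-congˡ (trans (-‿cong (zeroʳ u)) -0≈0)) (+-identityʳ z))) b
      where
      -0≈0 : - 0# ≈ 0#
      -0≈0 = GroupProperties.ε⁻¹≈ε +-group
    divide {r} {a} {u} l@(lead u′ b′ u≈) a≉0 (suc t) z (suc d z′ b z≈) =
      let h₁ , bh , bz = divide l a≉0 t (z + - (u * h₀)) (below-cong (sym z-uh₀)
                           (below-+ b (below-neg (below-scale (d K.* a⁻¹) (below-x^ t b′)))))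
      in h₀ + h₁ , suc (d K.* a⁻¹) h₁ bh refl , below-cong
        (solve 4 (λ z u g h → z :+ :- (u :* g) :+ :- (u :* h) := z :+ :- (u :* (g :+ h))) refl z u h₀ h₁) bz
      where
      a⁻¹ = proj₁ (K.inverse a a≉0)
      aa⁻¹≈1 = proj₂ (K.inverse a a≉0)
      q = ⟦ ι ⟧ (d K.* a⁻¹)
      h₀ = q * x ^ t
      qa≈d : q * ⟦ ι ⟧ a ≈ ⟦ ι ⟧ d
      qa≈d = trans (sym (*-homo ι _ _)) (⟦⟧-cong ι (K.trans (K.*-assoc d a⁻¹ a)
        (K.trans (K.*-congˡ (K.trans (K.*-comm a⁻¹ a) aa⁻¹≈1)) (K.*-identityʳ d))))
      z-uh₀ : z + - (u * h₀) ≈ z′ + - (q * (x ^ t * u′))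
      z-uh₀ = begin
        z + - (u * h₀) ≈⟨ +-cong (trans z≈ (+-congʳ (*-cong (sym qa≈d) (^-homo-* x t r)))) (-‿cong (*-congʳ u≈)) ⟩
        q * ⟦ ι ⟧ a * (x ^ t * x ^ r) + z′ + - ((⟦ ι ⟧ a * x ^ r + u′) * (q * x ^ t))
          ≈⟨ solve 6 (λ q a xt xr z u → q :* a :* (xt :* xr) :+ z :+ :- ((a :* xr :+ u) :* (q :* xt)) := z :+ :- (q :* (xt :* u))) refl q (⟦ ι ⟧ a) (x ^ t) (x ^ r) z′ u′ ⟩
        z′ + - (q * (x ^ t * u′)) ∎

    -- A monic h with u h = 0 is excluded: for r = 1 it gives a root of zᵖ + a₀ = z in K, and for r ≥ 2
    -- the conjugates of h annihilate h, so that h is nilpotent.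
    no-annihilator₁ : ∀ {a u h t} → Lead 1 a u → ¬ a K.≈ K.0# → Lead t K.1# h → t < p → ¬ u * h ≈ 0#
    no-annihilator₁ {a} {u} {h} (lead u′ (suc d _ (zero z≈0) ez) u≈) a≉0 lh t<p uh≈0 = lead-≉0 lh K.1≉0 t<p h≈0
      where
      a⁻¹ = proj₁ (K.inverse a a≉0)
      aa⁻¹≈1 = proj₂ (K.inverse a a≉0)
      β = a⁻¹ K.* d
      x+β : x + ⟦ ι ⟧ β ≈ ⟦ ι ⟧ a⁻¹ * u
      x+β = begin
        x + ⟦ ι ⟧ β ≈⟨ +-cong (sym (trans (*-congʳ (trans (⟦⟧-cong ι (K.trans (K.*-comm a⁻¹ a) aa⁻¹≈1)) (1-homo ι))) (*-identityˡ x))) (*-homo ι a⁻¹ d) ⟩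
        ⟦ ι ⟧ (a⁻¹ K.* a) * x + ⟦ ι ⟧ a⁻¹ * ⟦ ι ⟧ d ≈⟨ +-congʳ (*-congʳ (*-homo ι a⁻¹ a)) ⟩
        ⟦ ι ⟧ a⁻¹ * ⟦ ι ⟧ a * x + ⟦ ι ⟧ a⁻¹ * ⟦ ι ⟧ d ≈⟨ solve 4 (λ b a x d → b :* a :* x :+ b :* d := b :* (a :* x :+ d)) refl _ _ _ _ ⟩
        ⟦ ι ⟧ a⁻¹ * (⟦ ι ⟧ a * x + ⟦ ι ⟧ d) ≈⟨ *-congˡ (trans u≈ (+-cong (*-congˡ (*-identityʳ x)) (trans ez (trans (+-cong (*-identityʳ _) z≈0) (+-identityʳ _))))) ⟨
        ⟦ ι ⟧ a⁻¹ * u ∎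
      h[x+β]≈0 : h * (x + ⟦ ι ⟧ β) ≈ 0#
      h[x+β]≈0 = trans (*-congˡ x+β) (trans (solve 3 (λ h b u → h :* (b :* u) := b :* (u :* h)) refl h (⟦ ι ⟧ a⁻¹) u)
        (trans (*-congˡ uh≈0) (zeroʳ _)))
      h[x+β]^n≈0 : ∀ n → 0 < n → h * (x + ⟦ ι ⟧ β) ^ n ≈ 0#
      h[x+β]^n≈0 (suc n) _ = trans (sym (*-assoc _ _ _)) (trans (*-congʳ h[x+β]≈0) (zeroˡ _))
      -- κ is the constant (x + β)ᵖ - (x + β), by xᵖ = x + a₀. Since h is killed by x + β, it is
      -- killed by κ.
      κ = β Kˣ.^ p K.+ a₀ K.+ K.- β
      κ≉0 : ¬ κ K.≈ K.0#
      κ≉0 κ≈0 = no-root β (GroupProperties.x∙y⁻¹≈ε⇒x≈y K.+-group _ _ κ≈0)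
      κh≈0 : ⟦ ι ⟧ κ * h ≈ 0#
      κh≈0 = begin
        ⟦ ι ⟧ κ * h ≈⟨ *-congʳ (trans (+-homo ι _ _) (+-cong (trans (+-homo ι _ _) (+-congʳ (^-homo ι β p))) (neg-homo ι β))) ⟩
        (⟦ ι ⟧ β ^ p + ⟦ ι ⟧ a₀ + - ⟦ ι ⟧ β) * h
          ≈⟨ solve 5 (λ B z b h x → (B :+ z :+ :- b) :* h := h :* ((x :+ z) :+ B) :+ :- (h :* (x :+ b))) refl _ _ _ _ x ⟩
        h * ((x + ⟦ ι ⟧ a₀) + ⟦ ι ⟧ β ^ p) + - (h * (x + ⟦ ι ⟧ β)) ≈⟨ +-cong (*-congˡ (trans (frob-+ _ _) (+-congʳ x^p))) refl ⟨
        h * (x + ⟦ ι ⟧ β) ^ p + - (h * (x + ⟦ ι ⟧ β)) ≈⟨ +-cong (h[x+β]^n≈0 p (ℕₚ.<-trans (s≤s z≤n) 1<p)) (-‿cong h[x+β]≈0) ⟩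
        0# + - 0# ≈⟨ -‿inverseʳ 0# ⟩
        0# ∎
      h≈0 : h ≈ 0#
      h≈0 = let κ⁻¹ , e = K.inverse κ κ≉0 in begin
        h ≈⟨ trans (*-congʳ (trans (⟦⟧-cong ι (K.trans (K.*-comm κ⁻¹ κ) e)) (1-homo ι))) (*-identityˡ h) ⟨
        ⟦ ι ⟧ (κ⁻¹ K.* κ) * h ≈⟨ trans (*-congʳ (*-homo ι κ⁻¹ κ)) (*-assoc _ _ _) ⟩
        ⟦ ι ⟧ κ⁻¹ * (⟦ ι ⟧ κ * h) ≈⟨ trans (*-congˡ κh≈0) (zeroʳ _) ⟩
        0# ∎

    no-annihilator₂ : ∀ {r a u h t} → Lead (suc (suc r)) a u → ¬ a K.≈ K.0# → suc (suc r) < p →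
      (∀ {b v} → ¬ b K.≈ K.0# → Lead (suc r) b v → ∃[ w ] v * w ≈ 1#) →
      Lead t K.1# h → suc t < p → ¬ u * h ≈ 0#
    no-annihilator₂ {r} {a} {u} {h} {t} l a≉0 r<p invert lh t<p uh≈0 =
      lead-≉0 lh K.1≉0 (ℕₚ.<-trans (ℕₚ.n<1+n t) t<p) (reduced (h^n≈0 p 1<p))
      where
      -- From u h = 0 and its conjugate, (σⁱ u - u) · h · σⁱ h = 0. The first factor has degree one
      -- less than u, hence is invertible by `invert`.
      orthogonal : ∀ i → 0 < i → i < p → h * ⟦ σ ^ʰ i ⟧ h ≈ 0#
      orthogonal i 0<i i<p = begin
        h * hᵢ  ≈⟨ *-identityʳ _ ⟨
        h * hᵢ * 1#  ≈⟨ *-congˡ Dw≈1 ⟨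
        h * hᵢ * ((uᵢ + - u) * w)  ≈⟨ solve 5 (λ h k v u w → h :* k :* ((v :+ :- u) :* w) := h :* w :* (v :* k) :+ :- (k :* w :* (u :* h))) refl h hᵢ uᵢ u w ⟩
        h * w * (uᵢ * hᵢ) + - (hᵢ * w * (u * h)) ≈⟨ +-cong (trans (*-congˡ uᵢhᵢ≈0) (zeroʳ _)) (-‿cong (trans (*-congˡ uh≈0) (zeroʳ _))) ⟩
        0# + - 0#  ≈⟨ -‿inverseʳ 0# ⟩
        0# ∎
        where
        hᵢ = ⟦ σ ^ʰ i ⟧ h
        uᵢ = ⟦ σ ^ʰ i ⟧ u
        inverse = invert (·-≉0 0<i i<p (·-≉0 (s≤s z≤n) r<p a≉0)) (σ^-difference i l)
        w = proj₁ inverse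
        Dw≈1 = proj₂ inverse
        uᵢhᵢ≈0 : uᵢ * hᵢ ≈ 0#
        uᵢhᵢ≈0 = trans (sym (*-homo (σ ^ʰ i) u h)) (trans (⟦⟧-cong (σ ^ʰ i) uh≈0) (0-homo (σ ^ʰ i)))
      σ^-Δ : ∀ i v → ⟦ σ ^ʰ i ⟧ (app Δ v) ≈ ⟦ σ ^ʰ suc i ⟧ v + - ⟦ σ ^ʰ i ⟧ v
      σ^-Δ i v = trans (+-homo (σ ^ʰ i) _ _) (+-cong (σσ^ i) (neg-homo (σ ^ʰ i) v))
        where
        σσ^ : ∀ i → ⟦ σ ^ʰ i ⟧ (⟦ σ ⟧ v) ≈ ⟦ σ ⟧ (⟦ σ ^ʰ i ⟧ v)
        σσ^ zero    = refl
        σσ^ (suc i) = ⟦⟧-cong σ (σσ^ i)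
      -- Δʲ h is a combination of h, σ h, ..., σʲ h. After σⁱ with i > 0 and i + j < p, only
      -- conjugates orthogonal to h occur.
      orthogonal-Δ : ∀ j i → 0 < i → i ℕ.+ j < p → h * ⟦ σ ^ʰ i ⟧ (app (Δ ↑ j) h) ≈ 0#
      orthogonal-Δ zero    i 0<i i<p = orthogonal i 0<i (≡.subst (_< p) (ℕₚ.+-identityʳ i) i<p)
      orthogonal-Δ (suc j) i 0<i i<p = begin
        h * ⟦ σ ^ʰ i ⟧ (app Δ v) ≈⟨ *-congˡ (σ^-Δ i v) ⟩
        h * (⟦ σ ^ʰ suc i ⟧ v + - ⟦ σ ^ʰ i ⟧ v) ≈⟨ solve 3 (λ h a b → h :* (a :+ :- b) := h :* a :+ :- (h :* b)) refl _ _ _ ⟩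
        h * ⟦ σ ^ʰ suc i ⟧ v + - (h * ⟦ σ ^ʰ i ⟧ v)
          ≈⟨ +-cong (orthogonal-Δ j (suc i) (s≤s z≤n) i+j<p) (-‿cong (orthogonal-Δ j i 0<i (ℕₚ.<-trans (ℕₚ.n<1+n _) i+j<p))) ⟩
        0# + - 0# ≈⟨ -‿inverseʳ 0# ⟩
        0# ∎
        where
        v = app (Δ ↑ j) h
        i+j<p : suc (i ℕ.+ j) < p
        i+j<p = ≡.subst (_< p) (ℕₚ.+-suc i j) i<p
      -- With v = Δʲ h, h v = h σ v - h Δ v and h σ v = 0, so vanishing descends from Δ^(j+1) h to
      -- Δʲ h. It starts from Δ^(t+1) h = 0, as h has degree t, and ends at h h = 0.
      h²-from : ∀ j → j < p → h * app (Δ ↑ j) h ≈ 0# → h * h ≈ 0#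
      h²-from zero    _ e = e
      h²-from (suc j) j<p e = h²-from j (ℕₚ.<-trans (ℕₚ.n<1+n j) j<p) (begin
        h * v ≈⟨ solve 3 (λ h s v → h :* v := h :* s :+ :- (h :* (s :+ :- v))) refl h (⟦ σ ⟧ v) v ⟩
        h * ⟦ σ ⟧ v + - (h * app Δ v) ≈⟨ +-cong (orthogonal-Δ j 1 (s≤s z≤n) j<p) (-‿cong e) ⟩
        0# + - 0# ≈⟨ -‿inverseʳ 0# ⟩
        0# ∎)
        where v = app (Δ ↑ j) h
      h²≈0 : h * h ≈ 0#
      h²≈0 = h²-from (suc t) t<p (trans (*-congˡ (Δ↑-below (suc t) (lead-below lh))) (zeroʳ h))
      h^n≈0 : ∀ n → 1 < n → h ^ n ≈ 0#
      h^n≈0 (suc (suc n)) _ = trans (sym (*-assoc _ _ _)) (trans (*-congʳ h²≈0) (zeroˡ _))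
      h^n≈0 (suc zero) (s≤s ())

    -- Euclid's algorithm, with n as induction bound on the degree. For t = p - deg u, the element u
    -- xᵗ has a representative of degree less than p; dividing it by u gives a monic h of degree t
    -- such that u h has smaller degree than u. Either u h is invertible by induction, and so is u,
    -- or u h = 0, which the two preceding lemmas exclude.
    lead-invertible : ∀ n r → r < n → r < p → ∀ {a u} → ¬ a K.≈ K.0# → Lead r a u → ∃[ v ] u * v ≈ 1#
    lead-invertible (suc n) zero _ _ {a} {u} a≉0 l = let a⁻¹ , e = K.inverse a a≉0 in
      ⟦ ι ⟧ a⁻¹ , trans (*-congʳ (lead-0 l)) (trans (sym (*-homo ι a a⁻¹)) (trans (⟦⟧-cong ι e) (1-homo ι)))
    lead-invertible (suc n) (suc r) (s≤s r<n) r<p {a} {u} a≉0 l = conclude (classify b)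
      where
      t = p ∸ suc r
      t+r≡p : t ℕ.+ suc r ≡ p
      t+r≡p = ℕₚ.m∸n+n≡m (ℕₚ.<⇒≤ r<p)
      t<p : t < p
      t<p = ℕₚ.∸-monoʳ-< {o = 0} (s≤s z≤n) (ℕₚ.<⇒≤ r<p)
      division = divide l a≉0 t (u * x ^ t) (≡.subst (λ i → Below i (u * x ^ t)) (≡.sym t+r≡p) (spanned _))
      h′ = proj₁ division
      h = x ^ t + - h′
      lh : Lead t K.1# h
      lh = lead-+-below (lead-x^ t) (below-neg (proj₁ (proj₂ division)))
      b : Below (suc r) (u * h)
      b = below-cong (solve 3 (λ u x h → u :* x :+ :- (u :* h) := u :* (x :+ :- h)) refl u (x ^ t) h′) (proj₂ (proj₂ division))
      contradict : ∀ r → Lead (suc r) a u → suc r < p → r < n → t ℕ.+ suc r ≡ p → ¬ u * h ≈ 0#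
      contradict zero    l _ _ _ = no-annihilator₁ l a≉0 lh t<p
      contradict (suc r) l r<p r<n e = no-annihilator₂ l a≉0 r<p
        (λ b≉0 l′ → lead-invertible n (suc r) r<n (ℕₚ.<-trans (ℕₚ.n<1+n _) r<p) b≉0 l′) lh
        (≡.subst (suc t <_) e (≡.subst₂ _<_ (ℕₚ.+-comm t 1) ≡.refl (ℕₚ.+-monoʳ-< t (s≤s (s≤s z≤n)))))
      conclude : (u * h ≈ 0#) ⊎ (∃[ r′ ] ∃[ b ] r′ < suc r × (¬ b K.≈ K.0#) × Lead r′ b (u * h)) → ∃[ v ] u * v ≈ 1#
      conclude (inj₁ uh≈0) = ⊥-elim (contradict r l r<p r<n t+r≡p uh≈0)
      conclude (inj₂ (r′ , b , r′<r , b≉0 , l′)) =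
        let w , e = lead-invertible n r′ (ℕₚ.<-≤-trans r′<r r<n) (ℕₚ.<-trans r′<r r<p) b≉0 l′ in h * w , trans (sym (*-assoc u h w)) e

    R-inverse : ∀ u → ¬ u ≈ 0# → ∃[ v ] u * v ≈ 1#
    R-inverse u u≉0 = conclude (classify (spanned u))
      where
      conclude : (u ≈ 0#) ⊎ (∃[ r ] ∃[ a ] r < p × (¬ a K.≈ K.0#) × Lead r a u) → ∃[ v ] u * v ≈ 1#
      conclude (inj₁ u≈0) = ⊥-elim (u≉0 u≈0)
      conclude (inj₂ (r , a , r<p , a≉0 , l)) = lead-invertible p r r<p r<p a≉0 l

Hom-injective₂ : (K : DecField c ℓ) (S : CommutativeRing c′ ℓ′) →
  ¬ CommutativeRing._≈_ S (CommutativeRing.1# S) (CommutativeRing.0# S) →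
  (f : Hom (DecField.commutativeRing K) S) → ∀ {x y} →
  CommutativeRing._≈_ S (⟦ f ⟧ x) (⟦ f ⟧ y) → DecField._≈_ K x y
Hom-injective₂ K S 1≉0 f {x} {y} e = GroupProperties.x∙y⁻¹≈ε⇒x≈y (DecField.+-group K) x y
  (Hom-injective K S 1≉0 f (trans (+-homo f x _) (trans (+-cong e (neg-homo f y)) (-‿inverseʳ _))))
  where open CommutativeRing S

module _ {R : CommutativeRing c ℓ} (σ : Hom R R) where
  open CommutativeRing R hiding (zero)
  open Endomorphisms R
  open Difference

  ^ʰ-End : ∀ i u → ⟦ σ ^ʰ i ⟧ u ≈ app ((Δ σ ⊕ 1ᴱ) ↑ i) u
  ^ʰ-End zero    u = refl
  ^ʰ-End (suc i) u = trans (⟦⟧-cong σ (^ʰ-End i u)) (σ≈1+Δ σ _)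

  -- For q a power of p, (1 + Δ)^q = 1 + Δ^q. Hence Δ^q is again the difference operator of a ring
  -- homomorphism, and whatever holds for such operators holds for it.
  Δ-^ʰ : ∀ {p} → Prime p → AnnihilatesOne R p → ∀ k u →
    app (Δ (σ ^ʰ (p ℕ.^ k))) u ≈ app (Δ σ ↑ (p ℕ.^ k)) u
  Δ-^ʰ {p} pp p·1≈0 k u = begin
    ⟦ σ ^ʰ N ⟧ u + - u  ≈⟨ +-congʳ (^ʰ-End N u) ⟩
    app ((Δ σ ⊕ 1ᴱ) ↑ N) u + - u        ≈⟨ +-congʳ (freshmanᴱ pp p·1≈0 (Δ σ) k u) ⟩
    app (Δ σ ↑ N) u + u + - u           ≈⟨ +-assoc _ _ _ ⟩
    app (Δ σ ↑ N) u + (u + - u)         ≈⟨ +-congˡ (-‿inverseʳ u) ⟩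
    app (Δ σ ↑ N) u + 0#  ≈⟨ +-identityʳ _ ⟩
    app (Δ σ ↑ N) u                     ∎
    where
    open SetoidReasoning setoid
    N = p ℕ.^ k

-- The interface of K[x] / (xᵖ - x - a), hiding the coefficient vectors behind it. `lift` is the
-- part of the universal property by which θ is extended.
record ArtinSchreierRing (K : DecField c ℓ) (p : ℕ) (a : DecField.Carrier K) : Set (Level.suc (c ⊔ ℓ)) where
  private module K = DecField K
  field
    ring′ : CommutativeRing c ℓ
  open CommutativeRing ring′
  open Exp semiring
  field
    _≟′_    : ∀ u v → Dec (u ≈ v)
    1≉0     : ¬ 1# ≈ 0#
    ι       : Hom K.commutativeRing ring′
    x       : Carrier
    spanned : ∀ u → Filtration.Below K ring′ ι x p u
    x^p     : x ^ p ≈ x + ⟦ ι ⟧ a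
    lift    : (τ : Hom K.commutativeRing ring′) (ξ : Carrier) → ξ ^ p ≈ ξ + ⟦ τ ⟧ a →
              Σ (Hom ring′ ring′) λ f → (∀ d → ⟦ f ⟧ (⟦ ι ⟧ d) ≈ ⟦ τ ⟧ d) × ⟦ f ⟧ x ≈ ξ

artinSchreierRing : ∀ (K : DecField c ℓ) p → 1 < p → ∀ a → ArtinSchreierRing K p a
artinSchreierRing K (suc zero) (s≤s ()) a
artinSchreierRing {c} {ℓ} K (suc (suc q)) _ a = record
  { ring′ = companionRing
  ; _≟′_ = λ u v → Finₚ.all? λ i → u i K.≟ v i
  ; 1≉0 = λ e → K.1≉0 (e zero)
  ; ι = ι
  ; x = x
  ; spanned = λ u → below-cong (R.sym (expand u)) (below-sum u)
  ; x^p = R.trans x^n (sum-w ι x)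
  ; lift = λ τ ξ e → extend companionRing τ ξ (R.trans e (R.sym (sum-w τ ξ)))
      , extend-ι companionRing τ ξ (R.trans e (R.sym (sum-w τ ξ)))
      , extend-x companionRing τ ξ (R.trans e (R.sym (sum-w τ ξ)))
  }
  where
  module K = DecField K
  -- The relation is xᵖ = a + x; since p ≥ 2, the exponents 0 and 1 are both below p.
  w : Fin (suc (suc q)) → K.Carrier
  w zero          = a
  w (suc zero)    = K.1#
  w (suc (suc _)) = K.0#
  open Companion K.commutativeRing (suc q) w
  module R = CommutativeRing companionRing
  open Filtration K companionRing ι x
  open Exp R.semiring
  open Sum R.semiring

  below-sum : ∀ {n} (u : Fin n → K.Carrier) → Below n (sum (λ j → ⟦ ι ⟧ (u j) R.* x ^ toℕ j))
  below-sum {zero}  u = zero R.refl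
  below-sum {suc n} u = suc (u (fromℕ n)) _ (below-sum (u ∘ inject₁)) (R.trans
    (sum-init-last (λ j → ⟦ ι ⟧ (u j) R.* x ^ toℕ j))
    (R.trans (R.+-comm _ _) (R.+-cong
      (R.*-congˡ {⟦ ι ⟧ (u (fromℕ n))} (R.reflexive (≡.cong (x ^_) (toℕ-fromℕ n))))
      (sum-cong-≋ λ j → R.*-congˡ {⟦ ι ⟧ (u (inject₁ j))} (R.reflexive (≡.cong (x ^_) (toℕ-inject₁ j)))))))

  sum-w : (τ : Hom K.commutativeRing companionRing) (ξ : R.Carrier) →
    sum (λ j → ⟦ τ ⟧ (w j) R.* ξ ^ toℕ j) R.≈ ξ R.+ ⟦ τ ⟧ a
  sum-w τ ξ = R.trans (R.+-cong (R.*-identityʳ _) (R.+-cong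
    (R.trans (R.*-congʳ (1-homo τ)) (R.trans (R.*-identityˡ (ξ R.* R.1#)) (R.*-identityʳ ξ)))
    (Kronecker.sum-zero companionRing {q} _ λ j → R.trans (R.*-congʳ {ξ ^ suc (suc (toℕ j))} (0-homo τ)) (R.zeroˡ (ξ ^ suc (suc (toℕ j)))))))
    (R.trans (R.+-congˡ {⟦ τ ⟧ a} (R.+-identityʳ ξ)) (R.+-comm _ _))

-- The tower of cyclic extensions of degree pᵏ

module Tower (F : DecField c ℓ) {p} (pp : Prime p)
  (p·1≈0 : AnnihilatesOne (DecField.commutativeRing F) p)
  (i·1≉0 : ∀ {i} → 0 < i → i < p → ¬ AnnihilatesOne (DecField.commutativeRing F) i)
  where
  private module F = DecField F

  -- A cyclic extension of F of degree N = pᵏ, with θ a generator of the Galois group and Δ = θ − 1.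
  record Extension (k : ℕ) : Set (Level.suc (c ⊔ ℓ)) where
    field
      K : DecField c ℓ
    open DecField K
    open Exp semiring
    open Endomorphisms commutativeRing
    open Mult semiring renaming (_×_ to _·_)
    field
      ι  : Hom F.commutativeRing commutativeRing
      θ  : Hom commutativeRing commutativeRing
      θι : ∀ a → ⟦ θ ⟧ (⟦ ι ⟧ a) ≈ ⟦ ι ⟧ a
    open Difference θ
    N : ℕ
    N = p ℕ.^ k
    field
      Δ-kernel    : ∀ {u} → app Δ u ≈ 0# → ∃[ a ] u ≈ ⟦ ι ⟧ a
      Δ-nilpotent : ∀ u → app (Δ ↑ N) u ≈ 0#
      -- An element of trace 1: in characteristic p the trace 1 + θ + ... + θ^(N-1) equals (θ -
      -- 1)^(N-1).
      y           : Carrier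
      Δ-top       : app (Δ ↑ (N ∸ 1)) y ≈ 1#
      -- Carried along as an invariant because it is what excludes roots of the next Artin-Schreier
      -- polynomial.
      frob-fixed  : ∀ {t} → t ^ p ≈ t → app Δ t ≈ 0#

    0<N : 0 < N
    0<N = ℕₚ.m^n>0 p {{prime⇒nonZero pp}} k

    N≡1+[N-1] : N ≡ suc (N ∸ 1)
    N≡1+[N-1] = ≡.sym (ℕₚ.suc-pred N {{ℕ.>-nonZero 0<N}})

    ι-injective : ∀ {a b} → ⟦ ι ⟧ a ≈ ⟦ ι ⟧ b → a F.≈ b
    ι-injective = Hom-injective₂ F commutativeRing 1≉0 ι

    p·1≈0ᴷ : AnnihilatesOne commutativeRing p
    p·1≈0ᴷ = ·1≈0-homo ι p p·1≈0

    i·1≉0ᴷ : ∀ {i} → 0 < i → i < p → ¬ AnnihilatesOne commutativeRing i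
    i·1≉0ᴷ {i} 0<i i<p e = i·1≉0 0<i i<p (ι-injective (trans (·-homo ι i F.1#)
      (trans (×-congʳ i (1-homo ι)) (trans e (sym (0-homo ι))))))

  base : Extension 0
  base = record
    { K = F ; ι = idʰ ; θ = idʰ ; θι = λ _ → F.refl
    ; Δ-kernel = λ {u} _ → u , F.refl
    ; Δ-nilpotent = λ u → F.-‿inverseʳ u
    ; y = F.1# ; Δ-top = F.refl
    ; frob-fixed = λ {t} _ → F.-‿inverseʳ t
    }

  module Step {k} (E : Extension k) where
    open Extension E
    private module K = DecField K
    open Exp K.semiring using () renaming (_^_ to _^ᴷ_)
    private module EK = Endomorphisms K.commutativeRing
    private module D = Difference θ
    open EK using () renaming (app to appᴷ; _↑_ to _↑ᴷ_)

    -- θ is to be extended by x ↦ x + y. As (x + y)ᵖ = x + a + yᵖ, the relation xᵖ = x + a is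
    -- respected exactly when θ a = a + yᵖ - y, which is `Δa`.
    module _ (a : K.Carrier) (Δa : appᴷ D.Δ a K.≈ y ^ᴷ p K.+ K.- y) (no-root : ∀ z → ¬ z ^ᴷ p K.+ a K.≈ z) where
      private
        1<p : 1 < p
        1<p = prime⇒1< pp
        module AS = ArtinSchreierRing (artinSchreierRing K p 1<p a)
      open AS using (ring′; x) renaming (ι to j)
      open CommutativeRing ring′ hiding (zero)
      open Exp semiring
      open Endomorphisms ring′
      open ℤSolver ring′ using (solve; _:=_; _:+_; _:*_; :-_)
      open SetoidReasoning setoid

      private
        p·1≈0ᴿ : AnnihilatesOne ring′ p
        p·1≈0ᴿ = ·1≈0-homo j p p·1≈0ᴷ

        ξ^p : (x + ⟦ j ⟧ y) ^ p ≈ (x + ⟦ j ⟧ y) + ⟦ j ⟧ (⟦ θ ⟧ a)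
        ξ^p = begin
          (x + ⟦ j ⟧ y) ^ p           ≈⟨ Frobenius.frob-+ ring′ pp p·1≈0ᴿ x (⟦ j ⟧ y) ⟩
          x ^ p + ⟦ j ⟧ y ^ p         ≈⟨ +-cong AS.x^p (sym (^-homo j y p)) ⟩
          x + ⟦ j ⟧ a + ⟦ j ⟧ (y ^ᴷ p) ≈⟨ solve 4 (λ x a b y → x :+ a :+ b := (x :+ y) :+ ((b :+ :- y) :+ a)) refl _ _ _ (⟦ j ⟧ y) ⟩
          (x + ⟦ j ⟧ y) + ((⟦ j ⟧ (y ^ᴷ p) + - ⟦ j ⟧ y) + ⟦ j ⟧ a)
            ≈⟨ +-congˡ (+-congʳ (trans (⟦⟧-cong j Δa) (trans (+-homo j _ _) (+-congˡ (neg-homo j y))))) ⟨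
          (x + ⟦ j ⟧ y) + (⟦ j ⟧ (appᴷ D.Δ a) + ⟦ j ⟧ a) ≈⟨ +-congˡ (trans (⟦⟧-cong j (D.σ≈1+Δ a)) (+-homo j _ _)) ⟨
          (x + ⟦ j ⟧ y) + ⟦ j ⟧ (⟦ θ ⟧ a) ∎

        lifted = AS.lift (j ∘ʰ θ) (x + ⟦ j ⟧ y) ξ^p

        θ′ : Hom ring′ ring′
        θ′ = proj₁ lifted

        θ′j : ∀ d → ⟦ θ′ ⟧ (⟦ j ⟧ d) ≈ ⟦ j ⟧ (⟦ θ ⟧ d)
        θ′j = proj₁ (proj₂ lifted)

        -- θ′ᴺ generates the top step: it fixes K because Δᴺ = 0 there, and it moves x by Δ′ᴺ x =
        -- Δ^(N-1) y = 1. This is the automorphism x ↦ x + 1 to which `ArtinSchreier` applies.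
        σ : Hom ring′ ring′
        σ = θ′ ^ʰ N

        module D′ = Difference θ′

        Δ′j : ∀ u → app D′.Δ (⟦ j ⟧ u) ≈ ⟦ j ⟧ (appᴷ D.Δ u)
        Δ′j u = trans (+-cong (θ′j u) (sym (neg-homo j u))) (sym (+-homo j _ _))

        Δ′↑j : ∀ i u → app (D′.Δ ↑ i) (⟦ j ⟧ u) ≈ ⟦ j ⟧ (appᴷ (D.Δ ↑ᴷ i) u)
        Δ′↑j zero    u = refl
        Δ′↑j (suc i) u = trans (app-cong D′.Δ (Δ′↑j i u)) (Δ′j _)

        Δσ≈ : ∀ u → app (Difference.Δ σ) u ≈ app (D′.Δ ↑ N) u
        Δσ≈ = Δ-^ʰ θ′ pp p·1≈0ᴿ k

        σj : ∀ u → ⟦ σ ⟧ (⟦ j ⟧ u) ≈ ⟦ j ⟧ u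
        σj u = Difference.Δ-fixed σ (trans (Δσ≈ _) (trans (Δ′↑j N u) (trans (⟦⟧-cong j (Δ-nilpotent u)) (0-homo j))))

        Δ′↑Nx : app (D′.Δ ↑ N) x ≈ 1#
        Δ′↑Nx = begin
          app (D′.Δ ↑ N) x  ≡⟨ ≡.cong (λ i → app (D′.Δ ↑ i) x) N≡1+[N-1] ⟩
          app (D′.Δ ↑ suc (N ∸ 1)) x  ≈⟨ ↑-suc-comm D′.Δ (N ∸ 1) x ⟨
          app (D′.Δ ↑ (N ∸ 1)) (app D′.Δ x)      ≈⟨ app-cong (D′.Δ ↑ (N ∸ 1)) (trans (+-congʳ (proj₂ (proj₂ lifted)))
            (solve 2 (λ x y → x :+ y :+ :- x := y) refl _ _)) ⟩
          app (D′.Δ ↑ (N ∸ 1)) (⟦ j ⟧ y)         ≈⟨ Δ′↑j (N ∸ 1) y ⟩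
          ⟦ j ⟧ (appᴷ (D.Δ ↑ᴷ (N ∸ 1)) y)        ≈⟨ ⟦⟧-cong j Δ-top ⟩
          ⟦ j ⟧ K.1#  ≈⟨ 1-homo j ⟩
          1#                                     ∎

        σx : ⟦ σ ⟧ x ≈ x + 1#
        σx = trans (Difference.σ≈1+Δ σ x) (trans (+-congʳ (trans (Δσ≈ x) Δ′↑Nx)) (+-comm _ _))

        module A = ArtinSchreier K pp p·1≈0ᴷ i·1≉0ᴷ ring′ j AS.1≉0 x AS.spanned σ σj σx

        j-injective : ∀ {u v} → ⟦ j ⟧ u ≈ ⟦ j ⟧ v → u K.≈ v
        j-injective = Hom-injective₂ K ring′ AS.1≉0 j

        -- Two descents: Δ′ u = 0 gives Δ′ᴺ u = 0, so u lies in K by the kernel of σ - 1, and there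
        -- Δ u = 0 places it in F.
        Δ′-kernel : ∀ {u} → app D′.Δ u ≈ 0# → ∃[ b ] u ≈ ⟦ j ⟧ (⟦ ι ⟧ b)
        Δ′-kernel {u} e =
          let d , u≈ = A.Δ-kernel (trans (Δσ≈ u) (↑-zero D′.Δ e 0<N))
              b , d≈ = Δ-kernel (j-injective (trans (sym (Δ′j d)) (trans (app-cong D′.Δ (sym u≈)) (trans e (sym (0-homo j))))))
          in b , trans u≈ (⟦⟧-cong j d≈)

        Δσ↑≈ : ∀ i u → app (D′.Δ ↑ (i ℕ.* N)) u ≈ app (Difference.Δ σ ↑ i) u
        Δσ↑≈ i u = begin
          app (D′.Δ ↑ (i ℕ.* N)) u        ≡⟨ ≡.cong (λ m → app (D′.Δ ↑ m) u) (ℕₚ.*-comm i N) ⟩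
          app (D′.Δ ↑ (N ℕ.* i)) u        ≈⟨ ↑-assocʳ D′.Δ N i u ⟨
          app ((D′.Δ ↑ N) ↑ i) u          ≈⟨ ↑-congˡ i {D′.Δ ↑ N} {Difference.Δ σ} (λ v → sym (Δσ≈ v)) u ⟩
          app (Difference.Δ σ ↑ i) u      ∎

        exponent : p ℕ.* N ∸ 1 ≡ (N ∸ 1) ℕ.+ (p ∸ 1) ℕ.* N
        exponent = lem p N 1<p 0<N
          where
          lem : ∀ p N → 1 < p → 0 < N → p ℕ.* N ∸ 1 ≡ (N ∸ 1) ℕ.+ (p ∸ 1) ℕ.* N
          lem (suc p) (suc N) _ _ = ≡.refl

        Δσ-top : ∀ t → app (Difference.Δ σ ↑ (p ∸ 1)) t ≈ 1# → app (D′.Δ ↑ ((p ∸ 1) ℕ.* N)) (⟦ j ⟧ y * t) ≈ ⟦ j ⟧ y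
        Δσ-top t e = begin
          app (D′.Δ ↑ ((p ∸ 1) ℕ.* N)) (⟦ j ⟧ y * t)      ≈⟨ Δσ↑≈ (p ∸ 1) (⟦ j ⟧ y * t) ⟩
          app (Difference.Δ σ ↑ (p ∸ 1)) (⟦ j ⟧ y * t)    ≈⟨ Difference.Δ↑-scale σ {⟦ j ⟧ y} (σj y) (p ∸ 1) t ⟩
          ⟦ j ⟧ y * app (Difference.Δ σ ↑ (p ∸ 1)) t      ≈⟨ *-congˡ e ⟩
          ⟦ j ⟧ y * 1#  ≈⟨ *-identityʳ _ ⟩
          ⟦ j ⟧ y                                         ∎

        -- The exponent pN - 1 splits as (N - 1) + (p - 1) N. The second part is (σ - 1)^(p-1),
        -- which is K-linear and turns y t into y; the first turns y into 1.
        Δ′-top : ∀ t → app (Difference.Δ σ ↑ (p ∸ 1)) t ≈ 1# → app (D′.Δ ↑ (p ℕ.* N ∸ 1)) (⟦ j ⟧ y * t) ≈ 1#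
        Δ′-top t e = begin
          app (D′.Δ ↑ (p ℕ.* N ∸ 1)) y′  ≡⟨ ≡.cong (λ i → app (D′.Δ ↑ i) y′) exponent ⟩
          app (D′.Δ ↑ ((N ∸ 1) ℕ.+ (p ∸ 1) ℕ.* N)) y′  ≈⟨ ↑-+ D′.Δ (N ∸ 1) ((p ∸ 1) ℕ.* N) y′ ⟩
          app (D′.Δ ↑ (N ∸ 1)) (app (D′.Δ ↑ ((p ∸ 1) ℕ.* N)) y′) ≈⟨ app-cong (D′.Δ ↑ (N ∸ 1)) (Δσ-top t e) ⟩
          app (D′.Δ ↑ (N ∸ 1)) (⟦ j ⟧ y)  ≈⟨ Δ′↑j (N ∸ 1) y ⟩
          ⟦ j ⟧ (appᴷ (D.Δ ↑ᴷ (N ∸ 1)) y)  ≈⟨ ⟦⟧-cong j Δ-top ⟩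
          ⟦ j ⟧ K.1#  ≈⟨ 1-homo j ⟩
          1#                                                     ∎
          where y′ = ⟦ j ⟧ y * t

        frob-fixed′ : ∀ {t} → t ^ p ≈ t → app D′.Δ t ≈ 0#
        frob-fixed′ {t} e =
          let d , t≈ = A.frob-fixed a AS.x^p no-root e
          in trans (app-cong D′.Δ t≈) (trans (Δ′j d) (trans (⟦⟧-cong j (frob-fixed (j-injective
               (trans (^-homo j d p) (trans (^-congˡ p (sym t≈)) (trans e t≈)))))) (0-homo j)))

        fromTop : ∃[ t ] app (Difference.Δ σ ↑ (p ∸ 1)) t ≈ 1# → Extension (suc k)
        fromTop (t , e) = record
          { K = record { commutativeRing = ring′ ; _≟_ = AS._≟′_ ; 1≉0 = AS.1≉0 ; inverse = A.R-inverse a AS.x^p no-root }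
          ; ι = j ∘ʰ ι
          ; θ = θ′
          ; θι = λ b → trans (θ′j _) (⟦⟧-cong j (θι b))
          ; Δ-kernel = Δ′-kernel
          ; Δ-nilpotent = λ u → trans (Δσ↑≈ p u) (A.Δ-nilpotent u)
          ; y = ⟦ j ⟧ y * t
          ; Δ-top = Δ′-top t e
          ; frob-fixed = frob-fixed′
          }

      step : Extension (suc k)
      step = fromTop A.Δ-top

  module _ {k} (E : Extension k) where
    open Extension E
    open DecField K
    open Exp semiring
    open Endomorphisms commutativeRing
    open Difference θ
    open ℤSolver commutativeRing using (solve; _:=_; _:+_; _:*_; :-_)
    open SetoidReasoning setoid

    Δ-preimage : ∀ j u → j < N → app (Δ ↑ j) u ≈ 0# → ∃[ w ] app Δ w ≈ u
    Δ-preimage zero    u _   e = 0# , trans (app-0 Δ) (sym e)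
    Δ-preimage (suc j) u j<N e =
      let w , Δw≈ = Δ-preimage j (u + - (⟦ ι ⟧ α * z)) (ℕₚ.<-trans (ℕₚ.n<1+n j) j<N) reduced
      in w + ⟦ ι ⟧ α * v , (begin
        app Δ (w + ⟦ ι ⟧ α * v)  ≈⟨ app-+ Δ _ _ ⟩
        app Δ w + app Δ (⟦ ι ⟧ α * v)        ≈⟨ +-cong Δw≈ (Δ-scale (θι α) v) ⟩
        u + - (⟦ ι ⟧ α * z) + ⟦ ι ⟧ α * z    ≈⟨ solve 2 (λ u a → u :+ :- a :+ a := u) refl u (⟦ ι ⟧ α * z) ⟩
        u                                    ∎)
      where
      m = N ∸ 1 ∸ suc j
      v = app (Δ ↑ m) y
      z = app (Δ ↑ suc m) y
      α = proj₁ (Δ-kernel e)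
      j+1+m : j ℕ.+ suc m ≡ N ∸ 1
      j+1+m = ≡.trans (ℕₚ.+-suc j m) (ℕₚ.m+[n∸m]≡n (ℕₚ.∸-monoˡ-≤ 1 j<N))
      Δʲz≈1 : app (Δ ↑ j) z ≈ 1#
      Δʲz≈1 = trans (sym (↑-+ Δ j (suc m) y)) (trans (reflexive (≡.cong (λ i → app (Δ ↑ i) y) j+1+m)) Δ-top)
      reduced : app (Δ ↑ j) (u + - (⟦ ι ⟧ α * z)) ≈ 0#
      reduced = begin
        app (Δ ↑ j) (u + - (⟦ ι ⟧ α * z))    ≈⟨ app-sub (Δ ↑ j) _ _ ⟩
        app (Δ ↑ j) u + - app (Δ ↑ j) (⟦ ι ⟧ α * z)
          ≈⟨ +-cong (proj₂ (Δ-kernel e)) (-‿cong (trans (Δ↑-scale (θι α) j z) (trans (*-congˡ Δʲz≈1) (*-identityʳ _)))) ⟩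
        ⟦ ι ⟧ α + - ⟦ ι ⟧ α  ≈⟨ -‿inverseʳ _ ⟩
        0#                                   ∎

    private module Φ = Frobenius commutativeRing pp p·1≈0ᴷ

    -- From level 1 on the next Artin–Schreier constant comes from Δ a = yᵖ − y: a root z would make
    -- Δ z + y fixed by Frobenius, hence by θ.
    artinSchreierConstant : 1 < N → ∃[ a ] (app Δ a ≈ y ^ p + - y) × (∀ z → ¬ z ^ p + a ≈ z)
    artinSchreierConstant 1<N = a , Δa≈ , no-root
      where
      -- The trace of yᵖ - y is 1ᵖ - 1 = 0, because the trace commutes with the p-th power.
      [yᵖ-y]-killed : app (Δ ↑ (N ∸ 1)) (y ^ p + - y) ≈ 0#
      [yᵖ-y]-killed = begin
        app (Δ ↑ (N ∸ 1)) (y ^ p + - y)       ≈⟨ app-sub (Δ ↑ (N ∸ 1)) _ _ ⟩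
        app (Δ ↑ (N ∸ 1)) (y ^ p) + - app (Δ ↑ (N ∸ 1)) y ≈⟨ +-cong (trans (sym (Φ.Δ↑-frob θ (N ∸ 1) y)) (^-congˡ p Δ-top)) (-‿cong Δ-top) ⟩
        1# ^ p + - 1#  ≈⟨ +-congʳ (Freshman.1^n≈1 semiring p) ⟩
        1# + - 1#  ≈⟨ -‿inverseʳ 1# ⟩
        0#                                    ∎
      preimage = Δ-preimage (N ∸ 1) (y ^ p + - y) (ℕₚ.≤-reflexive (≡.sym N≡1+[N-1])) [yᵖ-y]-killed
      a = proj₁ preimage
      Δa≈ = proj₂ preimage
      no-root : ∀ z → ¬ z ^ p + a ≈ z
      no-root z e = 1≉0 (trans (sym Δt≈1) Δt≈0)
        where
        -- Applying Δ to zᵖ + a = z gives Δ z = (Δ z)ᵖ + yᵖ - y, which says exactly that this sum is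
        -- its own p-th power.
        t = app Δ z + y
        t^p≈t : t ^ p ≈ t
        t^p≈t = begin
          t ^ p ≈⟨ Φ.frob-+ _ _ ⟩
          app Δ z ^ p + y ^ p ≈⟨ +-congʳ (Φ.Δ-frob θ z) ⟩
          app Δ (z ^ p) + y ^ p ≈⟨ solve 3 (λ d b y → d :+ b := d :+ (b :+ :- y) :+ y) refl _ _ y ⟩
          app Δ (z ^ p) + (y ^ p + - y) + y ≈⟨ +-congʳ (+-congˡ Δa≈) ⟨
          app Δ (z ^ p) + app Δ a + y ≈⟨ +-congʳ (trans (sym (app-+ Δ _ _)) (app-cong Δ e)) ⟩
          t ∎
        -- Here 1 < N enters: Δ t = 0 kills Δ^(N-1) t only if the exponent is positive.
        Δt≈0 : app (Δ ↑ (N ∸ 1)) t ≈ 0#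
        Δt≈0 = ↑-zero Δ (frob-fixed t^p≈t) (ℕₚ.m<n⇒0<n∸m 1<N)
        Δt≈1 : app (Δ ↑ (N ∸ 1)) t ≈ 1#
        Δt≈1 = begin
          app (Δ ↑ (N ∸ 1)) t ≈⟨ app-+ (Δ ↑ (N ∸ 1)) _ _ ⟩
          app (Δ ↑ (N ∸ 1)) (app Δ z) + app (Δ ↑ (N ∸ 1)) y
            ≈⟨ +-cong (trans (↑-suc-comm Δ (N ∸ 1) z) (trans (reflexive (≡.cong (λ i → app (Δ ↑ i) z) (≡.sym N≡1+[N-1]))) (Δ-nilpotent z))) Δ-top ⟩
          0# + 1# ≈⟨ +-identityˡ 1# ⟩
          1# ∎

  module _ (a₀ : F.Carrier) (no-root : ∀ z → ¬ Exp._^_ F.semiring z p F.+ a₀ F.≈ z) where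

    tower : ∀ k → Extension k
    tower zero          = base
    -- On F itself θ is the identity and y = 1, so Δ a = yᵖ - y reads 0 = 0 for every a, and any
    -- root-free constant will do.
    tower (suc zero)    = Step.step base a₀
      (F.trans (F.-‿inverseʳ a₀) (F.sym (F.trans (F.+-congʳ (Freshman.1^n≈1 F.semiring p)) (F.-‿inverseʳ F.1#)))) no-root
    tower (suc (suc k)) =
      let a , Δa , no-root′ = artinSchreierConstant (tower (suc k)) 1<p^[1+k]
      in Step.step (tower (suc k)) a Δa no-root′
      where
      1<p^[1+k] : 1 < p ℕ.^ suc k
      1<p^[1+k] = ℕₚ.<-≤-trans (prime⇒1< pp)
        (ℕₚ.m≤m*n p (p ℕ.^ k) {{ℕₚ.m^n≢0 p k {{prime⇒nonZero pp}}}})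

-- The flag ker Δˢ and operators of bounded degree in Δ

module Combinations (F K : DecField c ℓ) (ι : Hom (DecField.commutativeRing F) (DecField.commutativeRing K))
  (e : ℕ → DecField.Carrier K) (n : ℕ) where
  private
    module F = DecField F
    module UF = Kronecker F.commutativeRing
  open DecField K
  open Sum semiring using (sum; sum-cong-≋; ∑-distrib-+; *-distribˡ-sum)
  open Kronecker commutativeRing using (sum-single)
  open ℤSolver commutativeRing using (solve; _:=_; _:+_; _:*_; :-_)
  open RingProperties F.ring using (-‿distribˡ-*)
  open SetoidReasoning setoid

  rep : (Fin n → F.Carrier) → Carrier
  rep α = sum (λ i → ⟦ ι ⟧ (α i) * e (toℕ i))

  rep-+ : ∀ α β → rep (λ i → α i F.+ β i) ≈ rep α + rep β
  rep-+ α β = trans (sum-cong-≋ λ i → trans (*-congʳ {e (toℕ i)} (+-homo ι (α i) (β i))) (distribʳ (e (toℕ i)) _ _))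
    (∑-distrib-+ (λ i → ⟦ ι ⟧ (α i) * e (toℕ i)) (λ i → ⟦ ι ⟧ (β i) * e (toℕ i)))

  rep-* : ∀ a α → rep (λ i → a F.* α i) ≈ ⟦ ι ⟧ a * rep α
  rep-* a α = trans (sum-cong-≋ λ i → trans (*-congʳ {e (toℕ i)} (*-homo ι a (α i))) (*-assoc _ _ _))
    (sym (*-distribˡ-sum (⟦ ι ⟧ a) (λ i → ⟦ ι ⟧ (α i) * e (toℕ i))))

  rep-unit : ∀ i → rep (UF.unit i) ≈ e (toℕ i)
  rep-unit i = trans (sum-single (λ j → ⟦ ι ⟧ (UF.unit i j) * e (toℕ j)) i λ j j≢i →
      trans (*-congʳ (trans (⟦⟧-cong ι (F.reflexive (UF.unit-≢ {i = i} {j} (j≢i ∘ ≡.sym)))) (0-homo ι))) (zeroˡ _))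
    (trans (*-congʳ (trans (⟦⟧-cong ι (F.reflexive (UF.unit-≡ i))) (1-homo ι))) (*-identityˡ _))

  rep-injective : (∀ α → rep α ≈ 0# → ∀ i → α i F.≈ F.0#) → ∀ {α β} → rep α ≈ rep β → ∀ i → α i F.≈ β i
  rep-injective independent {α} {β} eq i = GroupProperties.x∙y⁻¹≈ε⇒x≈y F.+-group _ _ (F.trans
    (F.+-congˡ (F.trans (F.-‿cong (F.sym (F.*-identityˡ (β i)))) (-‿distribˡ-* F.1# (β i))))
    (independent (λ i → α i F.+ F.- F.1# F.* β i) (begin
      rep (λ i → α i F.+ F.- F.1# F.* β i) ≈⟨ rep-+ α (λ i → F.- F.1# F.* β i) ⟩
      rep α + rep (λ i → F.- F.1# F.* β i) ≈⟨ +-cong eq (trans (rep-* (F.- F.1#) β) (*-congʳ (trans (neg-homo ι F.1#) (-‿cong (1-homo ι))))) ⟩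
      rep β + - 1# * rep β ≈⟨ solve 2 (λ b o → b :+ :- o :* b := b :+ :- (o :* b)) refl (rep β) 1# ⟩
      rep β + - (1# * rep β) ≈⟨ +-congˡ (-‿cong (*-identityˡ _)) ⟩
      rep β + - rep β ≈⟨ -‿inverseʳ _ ⟩
      0# ∎) i))

-- The data of a cyclic extension K / F of degree n that the codes use: a basis e on which Δ = θ − 1
-- acts as a nilpotent shift, and the multiplicativity of the flag ker Δˢ in steps of powers of p.
record ShiftModel (F : DecField c ℓ) (p n : ℕ) : Set (Level.suc (c ⊔ ℓ)) where
  private module F = DecField F
  field
    K : DecField c ℓ
  open DecField K
  open Sum semiring using (sum)
  open Endomorphisms commutativeRing
  field
    ι  : Hom F.commutativeRing commutativeRing
    θ  : Hom commutativeRing commutativeRing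
    θι : ∀ a → ⟦ θ ⟧ (⟦ ι ⟧ a) ≈ ⟦ ι ⟧ a
  open Difference θ
  field
    Δ-nilpotent : ∀ u → app (Δ ↑ n) u ≈ 0#
    e           : ℕ → Carrier
    e-zero      : e 0 ≈ 1#
    Δ-e         : ∀ {i} → suc i < n → app Δ (e (suc i)) ≈ e i
    coord       : Carrier → Fin n → F.Carrier
    expand      : ∀ u → u ≈ sum (λ i → ⟦ ι ⟧ (coord u i) * e (toℕ i))
    independent : ∀ (α : Fin n → F.Carrier) → sum (λ i → ⟦ ι ⟧ (α i) * e (toℕ i)) ≈ 0# → ∀ i → α i F.≈ F.0#
    coord-below : ∀ {s u} → app (Δ ↑ s) u ≈ 0# → ∀ i → s ≤ toℕ i → coord u i F.≈ F.0#
    block-mul   : ∀ h a b {u v} → app (Δ ↑ (p ℕ.^ h ℕ.* suc a)) u ≈ 0# → app (Δ ↑ (p ℕ.^ h ℕ.* suc b)) v ≈ 0# →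
                  app (Δ ↑ (p ℕ.^ h ℕ.* suc (a ℕ.+ b))) (u * v) ≈ 0#

module _ (F : DecField c ℓ) {p} (pp : Prime p)
  (p·1≈0 : AnnihilatesOne (DecField.commutativeRing F) p)
  (i·1≉0 : ∀ {i} → 0 < i → i < p → ¬ AnnihilatesOne (DecField.commutativeRing F) i)
  where
  private module F = DecField F
  open Tower F pp p·1≈0 i·1≉0

  module ToShiftModel {k} (E : Extension k) where
    open Extension E
    open DecField K
    open Sum semiring using (sum; sum-cong-≋)
    open Endomorphisms commutativeRing
    open Difference θ
    open Kronecker commutativeRing
    module UF = Kronecker F.commutativeRing
    open SetoidReasoning setoid
    open ℤSolver commutativeRing using (solve; _:=_; _:+_; :-_)

    -- The chain y, Δ y, ..., Δ^(N-1) y = 1 read backwards, so that index 0 carries 1 and Δ lowers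
    -- the index.
    e : ℕ → Carrier
    e i = app (Δ ↑ (N ∸ 1 ∸ i)) y

    e-zero : e 0 ≈ 1#
    e-zero = Δ-top

    Δ-e : ∀ {i} → suc i < N → app Δ (e (suc i)) ≈ e i
    Δ-e {i} i+1<N = reflexive (≡.cong (λ j → app (Δ ↑ j) y) (lem N i i+1<N))
      where
      lem : ∀ N i → suc i < N → suc (N ∸ 1 ∸ suc i) ≡ N ∸ 1 ∸ i
      lem (suc N) i (s≤s i<N) = ≡.sym (ℕₚ.+-∸-assoc 1 i<N)

    open Chain N e e-zero Δ-e
    open Combinations F K ι e N

    Δ↑-rep : ∀ s α → app (Δ ↑ s) (rep α) ≈ sum (λ i → ⟦ ι ⟧ (α i) * app (Δ ↑ s) (e (toℕ i)))
    Δ↑-rep s α = trans (app-sum (Δ ↑ s) (λ i → ⟦ ι ⟧ (α i) * e (toℕ i)))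
      (sum-cong-≋ λ i → Δ↑-scale (θι (α i)) s (e (toℕ i)))

    -- Coefficients vanish from the top index downwards: Δˢ kills the terms below s, those above s
    -- are already zero, and eₛ becomes 1.
    independent : ∀ α → rep α ≈ 0# → ∀ i → α i F.≈ F.0#
    independent α rep≈0 i = lem N 0 (ℕₚ.+-identityʳ N) i z≤n
      where
      lem : ∀ m s → m ℕ.+ s ≡ N → ∀ i → s ≤ toℕ i → α i F.≈ F.0#
      lem zero    s s≡N  i s≤i = ⊥-elim (ℕₚ.<⇒≱ (toℕ<n i) (≡.subst (_≤ toℕ i) s≡N s≤i))
      lem (suc m) s ms≡N i s≤i = go (ℕₚ.<-cmp s (toℕ i))
        where
        above : ∀ i → suc s ≤ toℕ i → α i F.≈ F.0#
        above = lem m (suc s) (≡.trans (ℕₚ.+-suc m s) ms≡N)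
        s<N : s < N
        s<N = ≡.subst (s <_) ms≡N (s≤s (ℕₚ.m≤n+m s m))
        iₛ = fromℕ< s<N
        αₛ≈0 : α iₛ F.≈ F.0#
        αₛ≈0 = ι-injective (begin
          ⟦ ι ⟧ (α iₛ) ≈⟨ *-identityʳ _ ⟨
          ⟦ ι ⟧ (α iₛ) * 1# ≈⟨ *-congˡ (Δ↑-e-same s<N) ⟨
          ⟦ ι ⟧ (α iₛ) * app (Δ ↑ s) (e s) ≡⟨ ≡.cong (λ j → ⟦ ι ⟧ (α iₛ) * app (Δ ↑ s) (e j)) (toℕ-fromℕ< s<N) ⟨
          ⟦ ι ⟧ (α iₛ) * app (Δ ↑ s) (e (toℕ iₛ)) ≈⟨ sum-single (λ i → ⟦ ι ⟧ (α i) * app (Δ ↑ s) (e (toℕ i))) iₛ other ⟨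
          sum (λ i → ⟦ ι ⟧ (α i) * app (Δ ↑ s) (e (toℕ i))) ≈⟨ Δ↑-rep s α ⟨
          app (Δ ↑ s) (rep α) ≈⟨ trans (app-cong (Δ ↑ s) rep≈0) (app-0 (Δ ↑ s)) ⟩
          0# ≈⟨ 0-homo ι ⟨
          ⟦ ι ⟧ F.0# ∎)
          where
          other : ∀ j → ¬ j ≡ iₛ → ⟦ ι ⟧ (α j) * app (Δ ↑ s) (e (toℕ j)) ≈ 0#
          other j j≢ = go (ℕₚ.<-cmp (toℕ j) s)
            where
            go : _ → _
            go (tri< j<s _ _) = trans (*-congˡ (Δ↑-e-0 j<s (toℕ<n j))) (zeroʳ _)
            go (tri≈ _ j≡s _) = ⊥-elim (j≢ (toℕ-injective (≡.trans j≡s (≡.sym (toℕ-fromℕ< s<N)))))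
            go (tri> _ _ j>s) = trans (*-congʳ (trans (⟦⟧-cong ι (above j j>s)) (0-homo ι))) (zeroˡ _)
        go : _ → α i F.≈ F.0#
        go (tri< s<i _ _) = above i s<i
        go (tri≈ _ s≡i _) = ≡.subst (λ j → α j F.≈ F.0#) (toℕ-injective (≡.trans (toℕ-fromℕ< s<N) s≡i)) αₛ≈0
        go (tri> _ _ s>i) = ⊥-elim (ℕₚ.<⇒≱ s>i s≤i)

    -- If Δ^(s+1) u = 0, then Δˢ u is a constant β, and u - β eₛ lies one step lower in the flag.
    -- Recording which coefficients vanish identifies ker Δˢ with the span of e₀, ..., e_(s-1).
    spanning : ∀ s → s ≤ N → ∀ u → app (Δ ↑ s) u ≈ 0# →
      Σ (Fin N → F.Carrier) λ α → u ≈ rep α × (∀ i → s ≤ toℕ i → α i F.≈ F.0#)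
    spanning zero    _   u u≈0 = (λ _ → F.0#)
      , trans u≈0 (sym (sum-zero {N} _ λ i → trans (*-congʳ {e (toℕ i)} (0-homo ι)) (zeroˡ _)))
      , λ _ _ → F.refl
    spanning (suc s) s<N u e₀ =
      let α , u≈ , α-0 = spanning s (ℕₚ.<⇒≤ s<N) (u + - (⟦ ι ⟧ β * e s)) reduced
      in (λ i → α i F.+ β F.* UF.unit iₛ i)
        , (begin
            u ≈⟨ solve 2 (λ u a → u := u :+ :- a :+ a) refl u (⟦ ι ⟧ β * e s) ⟩
            u + - (⟦ ι ⟧ β * e s) + ⟦ ι ⟧ β * e s ≈⟨ +-cong u≈ βe ⟩
            rep α + rep (λ i → β F.* UF.unit iₛ i) ≈⟨ rep-+ α (λ i → β F.* UF.unit iₛ i) ⟨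
            rep (λ i → α i F.+ β F.* UF.unit iₛ i) ∎)
        , λ i s<i → F.trans (F.+-cong (α-0 i (ℕₚ.<⇒≤ s<i)) (F.trans (F.*-congˡ (F.reflexive (UF.unit-≢ {i = iₛ} {i}
              λ iₛ≡i → ℕₚ.<-irrefl (≡.trans (≡.sym (toℕ-fromℕ< s<N)) (≡.cong toℕ iₛ≡i)) s<i))) (F.zeroʳ β))) (F.+-identityˡ _)
      where
      iₛ = fromℕ< s<N
      β = proj₁ (Δ-kernel e₀)
      reduced : app (Δ ↑ s) (u + - (⟦ ι ⟧ β * e s)) ≈ 0#
      reduced = begin
        app (Δ ↑ s) (u + - (⟦ ι ⟧ β * e s)) ≈⟨ app-sub (Δ ↑ s) _ _ ⟩
        app (Δ ↑ s) u + - app (Δ ↑ s) (⟦ ι ⟧ β * e s)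
          ≈⟨ +-cong (proj₂ (Δ-kernel e₀)) (-‿cong (trans (Δ↑-scale (θι β) s (e s)) (trans (*-congˡ (Δ↑-e-same s<N)) (*-identityʳ _)))) ⟩
        ⟦ ι ⟧ β + - ⟦ ι ⟧ β ≈⟨ -‿inverseʳ _ ⟩
        0# ∎
      βe : ⟦ ι ⟧ β * e s ≈ rep (λ i → β F.* UF.unit iₛ i)
      βe = trans (*-congˡ (trans (reflexive (≡.cong e (≡.sym (toℕ-fromℕ< s<N)))) (sym (rep-unit iₛ))))
        (sym (rep-* β (UF.unit iₛ)))

    coord : Carrier → Fin N → F.Carrier
    coord u = proj₁ (spanning N ℕₚ.≤-refl u (Δ-nilpotent u))

    expand : ∀ u → u ≈ rep (coord u)
    expand u = proj₁ (proj₂ (spanning N ℕₚ.≤-refl u (Δ-nilpotent u)))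

    coord-below : ∀ {s u} → app (Δ ↑ s) u ≈ 0# → ∀ i → s ≤ toℕ i → coord u i F.≈ F.0#
    coord-below {s} {u} e₀ i s≤i =
      let α , u≈ , α-0 = spanning s (ℕₚ.≤-trans s≤i (ℕₚ.<⇒≤ (toℕ<n i))) u e₀
      in F.trans (rep-injective independent {coord u} {α} (trans (sym (expand u)) u≈) i) (α-0 i s≤i)

    block-mul : ∀ h a b {u v} → app (Δ ↑ (p ℕ.^ h ℕ.* suc a)) u ≈ 0# → app (Δ ↑ (p ℕ.^ h ℕ.* suc b)) v ≈ 0# →
      app (Δ ↑ (p ℕ.^ h ℕ.* suc (a ℕ.+ b))) (u * v) ≈ 0#
    block-mul h a b eu ev = trans (block (suc (a ℕ.+ b)) _)
      (Difference.Δ↑-mul σ (a ℕ.+ b) a b ≡.refl (trans (sym (block (suc a) _)) eu) (trans (sym (block (suc b) _)) ev))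
      where
      q = p ℕ.^ h
      σ = θ ^ʰ q
      block : ∀ i u → app (Δ ↑ (q ℕ.* i)) u ≈ app (Difference.Δ σ ↑ i) u
      block i u = trans (sym (↑-assocʳ Δ q i u)) (↑-congˡ i {Δ ↑ q} {Difference.Δ σ} (λ v → sym (Δ-^ʰ θ pp p·1≈0ᴷ h v)) u)

    shiftModel : ShiftModel F p N
    shiftModel = record
      { K = K ; ι = ι ; θ = θ ; θι = θι ; Δ-nilpotent = Δ-nilpotent ; e = e ; e-zero = e-zero ; Δ-e = Δ-e
      ; coord = coord ; expand = expand ; independent = independent ; coord-below = coord-below ; block-mul = block-mul }

-- Homogeneous linear systems with more unknowns than equations

module LinearSystem (F : DecField c ℓ) where
  open DecField F
  open Sum semiring using (sum; sum-cong-≋; ∑-distrib-+; *-distribˡ-sum)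
  open Kronecker commutativeRing
  open ℤSolver commutativeRing using (solve; _:=_; _:+_; _:*_; :-_)
  open SetoidReasoning setoid

  -- Gaussian elimination. With a pivot in the first column, the other rows are freed of the first
  -- unknown and the pivot row then determines it; if the first column is zero, the first unit
  -- vector is a solution.
  underdetermined : ∀ r n (M : Fin r → Fin n → Carrier) → r < n →
    Σ (Fin n → Carrier) λ v → (∃[ j ] ¬ v j ≈ 0#) × (∀ i → sum (λ j → M i j * v j) ≈ 0#)
  underdetermined zero (suc n) M _ = unit zero , (zero , 1≉0) , λ ()
  underdetermined (suc r) (suc n) M (s≤s r<n) with Finₚ.any? (λ i → ¬? (M i zero ≟ 0#))
  ... | no  none = unit zero , (zero , 1≉0) , λ i → trans
        (sum-single (λ j → M i j * unit zero j) zero (λ { zero 0≢0 → ⊥-elim (0≢0 ≡.refl) ; (suc j) _ → zeroʳ _ }))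
        (trans (*-congʳ (decidable-stable (M i zero ≟ 0#) λ Mi≉0 → none (i , Mi≉0))) (zeroˡ _))
  ... | yes (i₀ , m≉0) = v , (suc (proj₁ v′≉0) , proj₂ v′≉0) , λ i → solves i
    where
    m = M i₀ zero
    m⁻¹ = proj₁ (inverse m m≉0)
    mm⁻¹≈1 : m * m⁻¹ ≈ 1#
    mm⁻¹≈1 = proj₂ (inverse m m≉0)
    q : Fin r → Carrier
    q l = M (punchIn i₀ l) zero * m⁻¹
    M′ : Fin r → Fin n → Carrier
    M′ l j = M (punchIn i₀ l) (suc j) + - (q l * M i₀ (suc j))
    IH = underdetermined r n M′ r<n
    v′ = proj₁ IH
    v′≉0 = proj₁ (proj₂ IH)
    S = sum (λ j → M i₀ (suc j) * v′ j)
    v : Fin (suc n) → Carrier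
    v zero    = - (m⁻¹ * S)
    v (suc j) = v′ j
    eliminated : ∀ l → sum (λ j → M (punchIn i₀ l) (suc j) * v′ j) ≈ q l * S
    eliminated l = begin
      sum (λ j → M (punchIn i₀ l) (suc j) * v′ j)
        ≈⟨ sum-cong-≋ (λ j → solve 4 (λ a b c v → a :* v := (a :+ :- (b :* c)) :* v :+ b :* (c :* v)) refl
              (M (punchIn i₀ l) (suc j)) (q l) (M i₀ (suc j)) (v′ j)) ⟩
      sum (λ j → M′ l j * v′ j + q l * (M i₀ (suc j) * v′ j)) ≈⟨ ∑-distrib-+ (λ j → M′ l j * v′ j) (λ j → q l * (M i₀ (suc j) * v′ j)) ⟩
      sum (λ j → M′ l j * v′ j) + sum (λ j → q l * (M i₀ (suc j) * v′ j))
        ≈⟨ +-cong (proj₂ (proj₂ IH) l) (sym (*-distribˡ-sum (q l) (λ j → M i₀ (suc j) * v′ j))) ⟩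
      0# + q l * S ≈⟨ +-identityˡ _ ⟩
      q l * S ∎
    solves : ∀ i → M i zero * v zero + sum (λ j → M i (suc j) * v′ j) ≈ 0#
    solves i with i₀ Finₚ.≟ i
    ... | yes ≡.refl = begin
      m * - (m⁻¹ * S) + S ≈⟨ solve 3 (λ m w s → m :* :- (w :* s) :+ s := s :+ :- ((m :* w) :* s)) refl m m⁻¹ S ⟩
      S + - (m * m⁻¹ * S) ≈⟨ +-congˡ (-‿cong (trans (*-congʳ mm⁻¹≈1) (*-identityˡ S))) ⟩
      S + - S ≈⟨ -‿inverseʳ S ⟩
      0# ∎
    ... | no i₀≢i = ≡.subst (λ i → M i zero * v zero + sum (λ j → M i (suc j) * v′ j) ≈ 0#) (punchIn-punchOut i₀≢i) (begin
      M (punchIn i₀ l) zero * - (m⁻¹ * S) + sum (λ j → M (punchIn i₀ l) (suc j) * v′ j) ≈⟨ +-congˡ (eliminated l) ⟩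
      M (punchIn i₀ l) zero * - (m⁻¹ * S) + M (punchIn i₀ l) zero * m⁻¹ * S
        ≈⟨ solve 3 (λ a w s → a :* :- (w :* s) :+ a :* w :* s := a :* s :+ :- (a :* s)) refl _ m⁻¹ S ⟩
      _ ≈⟨ -‿inverseʳ _ ⟩
      0# ∎)
      where l = punchOut i₀≢i

module ShiftOperators {F : DecField c ℓ} {p n} (M : ShiftModel F p n) where
  private module F = DecField F
  private module UF = Kronecker F.commutativeRing
  private module ΣF = Sum F.semiring
  open ShiftModel M
  open DecField K
  open Sum semiring using (sum; sum-cong-≋; ∑-distrib-+; *-distribˡ-sum)
  open Endomorphisms commutativeRing
  open Difference θ
  open Kronecker commutativeRing
  open ℤSolver commutativeRing using (solve; _:=_; _:+_; _:*_)
  open SetoidReasoning setoid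

  open Combinations F K ι e n public
  open Chain n e e-zero Δ-e public

  coord-unique : ∀ {u α} → u ≈ rep α → ∀ i → coord u i F.≈ α i
  coord-unique {u} {α} e₀ = rep-injective independent {coord u} {α} (trans (sym (expand u)) e₀)

  coord-cong : ∀ {u v} → u ≈ v → ∀ i → coord u i F.≈ coord v i
  coord-cong {u} {v} e₀ = coord-unique (trans e₀ (expand v))

  coord-+ : ∀ u v i → coord (u + v) i F.≈ coord u i F.+ coord v i
  coord-+ u v = coord-unique (trans (+-cong (expand u) (expand v)) (sym (rep-+ (coord u) (coord v))))

  coord-* : ∀ a u i → coord (⟦ ι ⟧ a * u) i F.≈ a F.* coord u i
  coord-* a u = coord-unique (trans (*-congˡ (expand u)) (sym (rep-* a (coord u))))

  coord-e : ∀ i j → coord (e (toℕ i)) j F.≈ UF.unit i j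
  coord-e i = coord-unique (sym (rep-unit i))

  coord-0 : ∀ {u} → u ≈ 0# → ∀ i → coord u i F.≈ F.0#
  coord-0 u≈0 i = coord-below {zero} u≈0 i z≤n

  coord≈0⇒≈0 : ∀ {u} → (∀ i → coord u i F.≈ F.0#) → u ≈ 0#
  coord≈0⇒≈0 {u} e₀ = trans (expand u) (sum-zero _ λ i → trans (*-congʳ {e (toℕ i)} (trans (⟦⟧-cong ι (e₀ i)) (0-homo ι))) (zeroˡ _))

  Δ-1 : app Δ 1# ≈ 0#
  Δ-1 = fixed-Δ (1-homo θ)

  Δ↑-mono : ∀ {s t u} → s ≤ t → app (Δ ↑ s) u ≈ 0# → app (Δ ↑ t) u ≈ 0#
  Δ↑-mono {s} {t} {u} s≤t eq = begin
    app (Δ ↑ t) u  ≡⟨ ≡.cong (λ i → app (Δ ↑ i) u) (ℕₚ.m∸n+n≡m s≤t) ⟨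
    app (Δ ↑ (t ∸ s ℕ.+ s)) u           ≈⟨ ↑-+ Δ (t ∸ s) s u ⟩
    app (Δ ↑ (t ∸ s)) (app (Δ ↑ s) u)   ≈⟨ trans (app-cong (Δ ↑ (t ∸ s)) eq) (app-0 (Δ ↑ (t ∸ s))) ⟩
    0#                                  ∎

  Linear : End → Set _
  Linear f = ∀ a u → app f (⟦ ι ⟧ a * u) ≈ ⟦ ι ⟧ a * app f u

  linear-zero : ∀ f → Linear f → (∀ (j : Fin n) → app f (e (toℕ j)) ≈ 0#) → ∀ u → app f u ≈ 0#
  linear-zero f lin f-e u = begin
    app f u  ≈⟨ app-cong f (expand u) ⟩
    app f (rep (coord u)) ≈⟨ app-sum f (λ j → ⟦ ι ⟧ (coord u j) * e (toℕ j)) ⟩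
    sum (λ j → app f (⟦ ι ⟧ (coord u j) * e (toℕ j))) ≈⟨ sum-zero _ (λ j → trans (lin (coord u j) (e (toℕ j))) (trans (*-congˡ {⟦ ι ⟧ (coord u j)} (f-e j)) (zeroʳ _))) ⟩
    0# ∎

  -- An F-linear form on K. A subspace of codimension at most r is handled as the common zeros of r
  -- forms, so that no dimension of a kernel has to be computed.
  record Form : Set (c ⊔ ℓ) where
    field
      form      : Carrier → F.Carrier
      form-cong : ∀ {u v} → u ≈ v → form u F.≈ form v
      form-+    : ∀ u v → form (u + v) F.≈ form u F.+ form v
      form-*    : ∀ a u → form (⟦ ι ⟧ a * u) F.≈ a F.* form u

    form-0 : form 0# F.≈ F.0#
    form-0 = F.trans (form-cong (sym (trans (*-congʳ (0-homo ι)) (zeroˡ 0#)))) (F.trans (form-* F.0# 0#) (F.zeroˡ _))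

    form-sum : ∀ {m} (a : Fin m → F.Carrier) (u : Fin m → Carrier) →
      form (sum (λ j → ⟦ ι ⟧ (a j) * u j)) F.≈ ΣF.sum (λ j → a j F.* form (u j))
    form-sum {zero}  a u = form-0
    form-sum {suc m} a u = F.trans (form-+ _ _) (F.+-cong (form-* _ _) (form-sum (a ∘ suc) (u ∘ suc)))

  open Form

  coordForm : Fin n → Form
  coordForm i = record { form = λ u → coord u i ; form-cong = λ e₀ → coord-cong e₀ i ; form-+ = λ u v → coord-+ u v i ; form-* = λ a u → coord-* a u i }

  common-zero : ∀ {r} (φ : Fin r → Form) → r < n → ∃[ v ] (¬ v ≈ 0#) × (∀ t → form (φ t) v F.≈ F.0#)
  common-zero {r} φ r<n = rep α , (λ rep≈0 → proj₂ (proj₁ (proj₂ solution)) (independent α rep≈0 _)) , λ t →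
      F.trans (form-sum (φ t) α (λ j → e (toℕ j)))
        (F.trans (ΣF.sum-cong-≋ λ j → F.*-comm (α j) (form (φ t) (e (toℕ j)))) (proj₂ (proj₂ solution) t))
    where
    solution = LinearSystem.underdetermined F r n (λ t j → form (φ t) (e (toℕ j))) r<n
    α = proj₁ solution

  mulBy : Carrier → End
  mulBy v = record { app = v *_ ; app-cong = *-congˡ ; app-+ = distribˡ v }

  -- Operators Σ_{i<k} aᵢ Δⁱ with coefficients in K.
  data Op : ℕ → End → Set (c ⊔ ℓ) where
    zero : ∀ {f} → (∀ u → app f u ≈ 0#) → Op 0 f
    suc  : ∀ {k f} a g → Op k g → (∀ u → app f u ≈ a * u + app g (app Δ u)) → Op (suc k) f

  op-cong : ∀ {k f g} → (∀ u → app f u ≈ app g u) → Op k f → Op k g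
  op-cong e₀ (zero z)      = zero λ u → trans (sym (e₀ u)) (z u)
  op-cong e₀ (suc a h o e) = suc a h o λ u → trans (sym (e₀ u)) (e u)

  op-0 : ∀ k → Op k 0ᴱ
  op-0 zero    = zero λ _ → refl
  op-0 (suc k) = suc 0# 0ᴱ (op-0 k) λ u → sym (trans (+-identityʳ _) (zeroˡ u))

  op-weaken : ∀ {k f} → Op k f → Op (suc k) f
  op-weaken (zero z)      = suc 0# 0ᴱ (zero λ _ → refl) λ u → trans (z u) (sym (trans (+-identityʳ _) (zeroˡ u)))
  op-weaken (suc a g o e) = suc a g (op-weaken o) e

  op-≤ : ∀ {i j f} → i ≤ j → Op i f → Op j f
  op-≤ {j = zero}  z≤n o = o
  op-≤ {j = suc j} z≤n o = op-weaken (op-≤ z≤n o)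
  op-≤ (s≤s i≤j) (suc a g o e) = suc a g (op-≤ i≤j o) e

  op-+ : ∀ {k f g} → Op k f → Op k g → Op k (f ⊕ g)
  op-+ (zero z) (zero z′) = zero λ u → trans (+-cong (z u) (z′ u)) (+-identityˡ 0#)
  op-+ (suc a h o e) (suc a′ h′ o′ e′) = suc (a + a′) (h ⊕ h′) (op-+ o o′) λ u → trans (+-cong (e u) (e′ u))
    (solve 5 (λ a b c d u → a :* u :+ b :+ (c :* u :+ d) := (a :+ c) :* u :+ (b :+ d)) refl a (app h (app Δ u)) a′ (app h′ (app Δ u)) u)

  op-mulˡ : ∀ {k f} v → Op k f → Op k (mulBy v ⊚ f)
  op-mulˡ v (zero z)      = zero λ u → trans (*-congˡ (z u)) (zeroʳ v)
  op-mulˡ v (suc a g o e) = suc (v * a) (mulBy v ⊚ g) (op-mulˡ v o) λ u → trans (*-congˡ (e u))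
    (solve 4 (λ v a u g → v :* (a :* u :+ g) := v :* a :* u :+ v :* g) refl v a u (app g (app Δ u)))

  -- By the twisted Leibniz rule g (Δ (v u)) splits into g (θ v · Δ u), which still ends in Δ, and g
  -- (Δ v · u), which is shorter by one term. So the length does not grow.
  op-mulʳ : ∀ {k f} v → Op k f → Op k (f ⊚ mulBy v)
  op-mulʳ v (zero z) = zero λ u → z (v * u)
  op-mulʳ {f = f} v (suc a g o e) = op-cong {f = f₁ ⊕ f₂} (λ u → begin
      a * v * u + app g (⟦ θ ⟧ v * app Δ u) + app g (app Δ v * u)    ≈⟨ +-assoc _ _ _ ⟩
      a * v * u + (app g (⟦ θ ⟧ v * app Δ u) + app g (app Δ v * u))  ≈⟨ +-cong (*-assoc a v u) (sym (app-+ g _ _)) ⟩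
      a * (v * u) + app g (⟦ θ ⟧ v * app Δ u + app Δ v * u)          ≈⟨ +-congˡ (app-cong g (Δ-* v u)) ⟨
      a * (v * u) + app g (app Δ (v * u))  ≈⟨ e (v * u) ⟨
      app f (v * u) ∎)
    (op-+ (suc (a * v) (g ⊚ mulBy (⟦ θ ⟧ v)) (op-mulʳ (⟦ θ ⟧ v) o) λ u → refl) (op-weaken (op-mulʳ (app Δ v) o)))
    where
    f₁ = mulBy (a * v) ⊕ ((g ⊚ mulBy (⟦ θ ⟧ v)) ⊚ Δ)
    f₂ = g ⊚ mulBy (app Δ v)

  op-Δ↑ : ∀ i → Op (suc i) (Δ ↑ i)
  op-Δ↑ zero    = suc 1# 0ᴱ (op-0 0) λ u → sym (trans (+-identityʳ _) (*-identityˡ u))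
  op-Δ↑ (suc i) = suc 0# (Δ ↑ i) (op-Δ↑ i) λ u → trans (sym (↑-suc-comm Δ i u)) (sym (trans (+-congʳ (zeroˡ u)) (+-identityˡ _)))

  -- A right inverse of Δ on elements with zero coordinate at e_(n-1). The summand with e n falls
  -- outside the chain, but its coefficient vanishes in that case.
  raise : Carrier → Carrier
  raise w = sum (λ i → ⟦ ι ⟧ (coord w i) * e (suc (toℕ i)))

  raise-cong : ∀ {u v} → u ≈ v → raise u ≈ raise v
  raise-cong e₀ = sum-cong-≋ λ i → *-congʳ {e (suc (toℕ i))} (⟦⟧-cong ι (coord-cong e₀ i))

  raise-+ : ∀ u v → raise (u + v) ≈ raise u + raise v
  raise-+ u v = trans (sum-cong-≋ λ i → trans (*-congʳ {e (suc (toℕ i))} (trans (⟦⟧-cong ι (coord-+ u v i)) (+-homo ι (coord u i) (coord v i)))) (distribʳ (e (suc (toℕ i))) _ _))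
    (∑-distrib-+ (λ i → ⟦ ι ⟧ (coord u i) * e (suc (toℕ i))) (λ i → ⟦ ι ⟧ (coord v i) * e (suc (toℕ i))))

  raise-* : ∀ a u → raise (⟦ ι ⟧ a * u) ≈ ⟦ ι ⟧ a * raise u
  raise-* a u = trans (sum-cong-≋ λ i → trans (*-congʳ {e (suc (toℕ i))} (trans (⟦⟧-cong ι (coord-* a u i)) (*-homo ι a (coord u i)))) (*-assoc _ _ _))
    (sym (*-distribˡ-sum (⟦ ι ⟧ a) (λ i → ⟦ ι ⟧ (coord u i) * e (suc (toℕ i)))))

  Δ-raise : ∀ w → (∀ i → suc (toℕ i) ≡ n → coord w i F.≈ F.0#) → app Δ (raise w) ≈ w
  Δ-raise w last≈0 = begin
    app Δ (raise w) ≈⟨ app-sum Δ (λ i → ⟦ ι ⟧ (coord w i) * e (suc (toℕ i))) ⟩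
    sum (λ i → app Δ (⟦ ι ⟧ (coord w i) * e (suc (toℕ i)))) ≈⟨ sum-cong-≋ (λ i → trans (Δ-scale (θι (coord w i)) (e (suc (toℕ i)))) (term i)) ⟩
    rep (coord w) ≈⟨ expand w ⟨
    w ∎
    where
    term : ∀ i → ⟦ ι ⟧ (coord w i) * app Δ (e (suc (toℕ i))) ≈ ⟦ ι ⟧ (coord w i) * e (toℕ i)
    term i with ℕₚ.m≤n⇒m<n∨m≡n (toℕ<n i)
    ... | inj₁ i+1<n = *-congˡ (Δ-e i+1<n)
    ... | inj₂ i+1≡n = trans (*-congʳ ci≈0) (trans (zeroˡ _) (sym (trans (*-congʳ ci≈0) (zeroˡ _))))
      where
      ci≈0 : ⟦ ι ⟧ (coord w i) ≈ 0#
      ci≈0 = trans (⟦⟧-cong ι (last≈0 i i+1≡n)) (0-homo ι)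

  -- Gabidulin's bound.  For v ≠ 0 with φ v = 0 also f v = 0, so f (v u) = g (Δ u) with g shorter than f,
  -- and g vanishes where the last coordinate and φ (v · raise −) do.
  few-zeros : ∀ {k f} → Op k f → ∀ {r} (φ : Fin r → Form) → r ℕ.+ k ≤ n →
    (∀ u → (∀ t → form (φ t) u F.≈ F.0#) → app f u ≈ 0#) → ∀ u → app f u ≈ 0#
  few-zeros (zero z) φ _ _ = z
  few-zeros {suc k} {f} o@(suc _ _ _ _) {r} φ r+k≤n φ⇒f = from-shape (op-mulʳ v o)
    where
    r<n : r < n
    r<n = ℕₚ.<-≤-trans (ℕₚ.m<m+n r (s≤s z≤n)) r+k≤n
    zeros = common-zero φ r<n
    v = proj₁ zeros
    v≉0 = proj₁ (proj₂ zeros)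
    φv≈0 = proj₂ (proj₂ zeros)
    v⁻¹ = proj₁ (inverse v v≉0)
    n-1<n : n ∸ 1 < n
    n-1<n = ℕₚ.∸-monoʳ-< {o = 0} (s≤s z≤n) (ℕₚ.≤-trans (s≤s z≤n) r<n)
    ψ : Fin (suc r) → Form
    ψ zero    = coordForm (fromℕ< n-1<n)
    ψ (suc t) = record
      { form = λ w → form (φ t) (v * raise w)
      ; form-cong = λ e₀ → form-cong (φ t) (*-congˡ (raise-cong e₀))
      ; form-+ = λ u w → F.trans (form-cong (φ t) (trans (*-congˡ (raise-+ u w)) (distribˡ v _ _))) (form-+ (φ t) _ _)
      ; form-* = λ a u → F.trans (form-cong (φ t) (trans (*-congˡ (raise-* a u))
          (solve 3 (λ v a r → v :* (a :* r) := a :* (v :* r)) refl v (⟦ ι ⟧ a) (raise u)))) (form-* (φ t) a _)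
      }
    from-shape : Op (suc k) (f ⊚ mulBy v) → ∀ u → app f u ≈ 0#
    from-shape (suc a g og fv≈) u = begin
      app f u  ≈⟨ app-cong f (*-identityˡ u) ⟨
      app f (1# * u)  ≈⟨ app-cong f (*-congʳ (proj₂ (inverse v v≉0))) ⟨
      app f (v * v⁻¹ * u)  ≈⟨ app-cong f (*-assoc v v⁻¹ u) ⟩
      app f (v * (v⁻¹ * u))  ≈⟨ fv≈g _ ⟩
      app g (app Δ (v⁻¹ * u))  ≈⟨ few-zeros og ψ (≡.subst (_≤ n) (ℕₚ.+-suc r k) r+k≤n) ψ⇒g _ ⟩
      0#                                     ∎
      where
      -- Since Δ 1 = 0, evaluation at 1 isolates the constant term, and its value is f v = 0.
      a≈0 : a ≈ 0#
      a≈0 = begin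
        a ≈⟨ trans (+-identityʳ _) (*-identityʳ a) ⟨
        a * 1# + 0# ≈⟨ +-congˡ (trans (app-cong g Δ-1) (app-0 g)) ⟨
        a * 1# + app g (app Δ 1#) ≈⟨ fv≈ 1# ⟨
        app f (v * 1#) ≈⟨ app-cong f (*-identityʳ v) ⟩
        app f v ≈⟨ φ⇒f v φv≈0 ⟩
        0# ∎
      fv≈g : ∀ u → app f (v * u) ≈ app g (app Δ u)
      fv≈g u = trans (fv≈ u) (trans (+-congʳ (trans (*-congʳ a≈0) (zeroˡ u))) (+-identityˡ _))
      ψ⇒g : ∀ w → (∀ t → form (ψ t) w F.≈ F.0#) → app g w ≈ 0#
      ψ⇒g w ψw≈0 = trans (app-cong g (sym (Δ-raise w last≈0))) (trans (sym (fv≈g (raise w)))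
        (φ⇒f (v * raise w) (λ t → ψw≈0 (suc t))))
        where
        last≈0 : ∀ i → suc (toℕ i) ≡ n → coord w i F.≈ F.0#
        last≈0 i i+1≡n = ≡.subst (λ i → coord w i F.≈ F.0#)
          (toℕ-injective (≡.trans (toℕ-fromℕ< n-1<n) (≡.cong (_∸ 1) (≡.sym i+1≡n)))) (ψw≈0 zero)

-- Finite fields and codes

module FiniteField (H : HeytingField c ℓ₁ ℓ₂) (finite : IsFinite H) {p} (pp : Prime p) (char : HasCharacteristic H p) where
  open HeytingField H using (heytingCommutativeRing; tight; #⇒invertible)
  open HeytingCommutativeRing heytingCommutativeRing using (commutativeRing)
  open CommutativeRing commutativeRing hiding (zero)
  open Exp semiring using (_^_; ^-congˡ)
  open ℤSolver commutativeRing using (solve; _:=_; _:+_; :-_)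

  private
    q = proj₁ finite
    module I = Inverse (proj₂ finite)

    to-injective : ∀ {x y} → I.to x ≡ I.to y → x ≈ y
    to-injective {x} {y} e = trans (sym (I.strictlyInverseʳ x)) (trans (reflexive (≡.cong I.from e)) (I.strictlyInverseʳ y))

    _≟_ : ∀ x y → Dec (x ≈ y)
    x ≟ y = map′ to-injective I.to-cong (I.to x Finₚ.≟ I.to y)

    x-0≈x : ∀ x → x + - 0# ≈ x
    x-0≈x x = trans (+-congˡ (GroupProperties.ε⁻¹≈ε +-group)) (+-identityʳ x)

  p·1≈0 : AnnihilatesOne commutativeRing p
  p·1≈0 = Equivalence.from (char p) ∣-refl

  i·1≉0 : ∀ {i} → 0 < i → i < p → ¬ AnnihilatesOne commutativeRing i
  i·1≉0 {suc i} _ i<p e = ℕₚ.<⇒≱ i<p (∣⇒≤ (Equivalence.to (char (suc i)) e))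

  private
    1≉0 : ¬ 1# ≈ 0#
    1≉0 e = i·1≉0 (s≤s z≤n) (prime⇒1< pp) (trans (+-identityʳ 1#) e)

    inverse : ∀ x → ¬ x ≈ 0# → ∃[ y ] x * y ≈ 1#
    inverse x x≉0 with Finₚ.any? (λ i → (x * I.from i) ≟ 1#)
    ... | yes (i , e) = I.from i , e
    -- If the search fails, x cannot be apart from 0, as apartness would supply an inverse;
    -- tightness then gives x = 0.
    ... | no  none = ⊥-elim (x≉0 (proj₁ (tight x 0#) λ x#0 →
      let y , _ , xy≈1 = #⇒invertible x#0
      in none (I.to y , trans (*-congˡ (I.strictlyInverseʳ y)) (trans (*-congʳ (sym (x-0≈x x))) xy≈1))))

  decField : DecField c ℓ₁
  decField = record { commutativeRing = commutativeRing ; _≟_ = _≟_ ; 1≉0 = 1≉0 ; inverse = inverse }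

  -- z ↦ z − zᵖ identifies 0 and 1, hence is not onto.
  artinSchreierNonRoot : ∃[ a ] (∀ z → ¬ z ^ p + a ≈ z)
  artinSchreierNonRoot = nonsurjective q ≡.refl
    where
    g : Carrier → Carrier
    g z = z + - z ^ p
    g-cong : ∀ {x y} → x ≈ y → g x ≈ g y
    g-cong e = +-cong e (-‿cong (^-congˡ p e))
    g1≈g0 : g 1# ≈ g 0#
    g1≈g0 = trans (trans (+-congˡ (-‿cong (Freshman.1^n≈1 semiring p))) (-‿inverseʳ 1#))
      (sym (trans (+-congˡ (-‿cong (Frobenius.frob-0 commutativeRing pp p·1≈0))) (-‿inverseʳ 0#)))

    nonsurjective : ∀ q′ → q ≡ q′ → ∃[ a ] (∀ z → ¬ z ^ p + a ≈ z)
    nonsurjective zero     q≡0 with () ← ≡.subst Fin q≡0 (I.to 0#)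
    nonsurjective (suc q′) ≡.refl = conclude (Finₚ.all? hit?)
      where
      one : Fin (suc q′)
      one = I.to 1#
      -- Values of g at the elements other than 1. Because g 1 = g 0 these are all its values, and
      -- q′ arguments cannot reach all q′ + 1 elements.
      Hit : Fin (suc q′) → Set
      Hit i = ∃[ l ] I.to (g (I.from (punchIn one l))) ≡ i
      hit? : ∀ i → Dec (Hit i)
      hit? i = Finₚ.any? λ l → I.to (g (I.from (punchIn one l))) Finₚ.≟ i
      g-hit : ∀ z → Hit (I.to (g z))
      g-hit z with one Finₚ.≟ I.to z
      ... | no one≢z = punchOut one≢z , ≡.trans (≡.cong (λ i → I.to (g (I.from i))) (punchIn-punchOut one≢z))
              (I.to-cong (g-cong (I.strictlyInverseʳ z)))
      ... | yes one≡z = punchOut one≢0 , ≡.trans (≡.cong (λ i → I.to (g (I.from i))) (punchIn-punchOut one≢0))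
              (I.to-cong (trans (g-cong (I.strictlyInverseʳ 0#)) (trans (sym g1≈g0) (g-cong (to-injective one≡z)))))
        where
        one≢0 : ¬ one ≡ I.to 0#
        one≢0 e = 1≉0 (to-injective e)
      conclude : Dec (∀ i → Hit i) → ∃[ a ] (∀ z → ¬ z ^ p + a ≈ z)
      conclude (yes all) with Finₚ.pigeonhole (ℕₚ.n<1+n q′) (λ i → proj₁ (all i))
      ... | i , j , i<j , li≡lj = ⊥-elim (Finₚ.<⇒≢ i<j (≡.trans (≡.sym (proj₂ (all i)))
              (≡.trans (≡.cong (λ l → I.to (g (I.from (punchIn one l)))) li≡lj) (proj₂ (all j)))))
      conclude (no ¬all) with Finₚ.¬∀⟶∃¬ _ _ hit? ¬all
      ... | i , ¬hit = I.from i , λ z e → ¬hit (≡.subst Hit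
              (≡.trans (I.to-cong (trans (+-congʳ (sym e)) (solve 2 (λ w a → w :+ a :+ :- w := a) refl (z ^ p) (I.from i))))
                (I.strictlyInverseˡ i)) (g-hit z))

-- From operators to rank-metric codes

module Assembly (H : HeytingField c ℓ₁ ℓ₂) (finite : IsFinite H) {p} (pp : Prime p) (char : HasCharacteristic H p)
  {n} (M : ShiftModel (FiniteField.decField H finite pp char) p n) where
  private
    F = FiniteField.decField H finite pp char
    module F = DecField F
  open ShiftModel M
  open DecField K
  open Endomorphisms commutativeRing
  open Difference θ
  open ShiftOperators M
  open Sum semiring using (sum; sum-cong-≋)
  private
    module UF = Kronecker F.commutativeRing
    module ΣF = Sum F.semiring
  open Form

  matrix : End → Matrix H n
  matrix f (i , j) = coord (app f (e (toℕ j))) i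

  matrix-zero : ∀ f → Linear f → (∀ ij → matrix f ij F.≈ F.0#) → ∀ u → app f u ≈ 0#
  matrix-zero f lin f≈0 = linear-zero f lin λ j → coord≈0⇒≈0 λ i → f≈0 (i , j)

  coord-matrix : ∀ f → Linear f → ∀ u i → coord (app f u) i F.≈ ΣF.sum (λ j → coord u j F.* matrix f (i , j))
  coord-matrix f lin u i = F.trans (coord-cong f-expand i) (form-sum (coordForm i) (coord u) (λ j → app f (e (toℕ j))))
    where
    f-expand : app f u ≈ sum (λ j → ⟦ ι ⟧ (coord u j) * app f (e (toℕ j)))
    f-expand = trans (app-cong f (expand u)) (trans (app-sum f (λ j → ⟦ ι ⟧ (coord u j) * e (toℕ j)))
      (sum-cong-≋ λ j → lin (coord u j) (e (toℕ j))))

  -- If the columns of A are combinations of r vectors with coefficients α j t, then f u = 0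
  -- wherever the r forms u ↦ Σⱼ uⱼ α j t vanish. For r < d that is too few conditions for a nonzero
  -- operator with n - d + 1 terms.
  rank-bound : ∀ {d} → 1 ≤ d → d ≤ n → ∀ f → Linear f → Op (suc (n ∸ d)) f →
    ∀ A → (∀ ij → A ij F.≈ matrix f ij) → (¬ ∀ ij → A ij F.≈ F.0#) → ∀ r → HasRank H A r → d ≤ r
  rank-bound {d} 1≤d d≤n f lin short A A≈f A≉0 r (b , isBasis) = ℕₚ.≮⇒≥ λ r<d →
    A≉0 λ (i , j) → F.trans (A≈f (i , j)) (coord-0 (few-zeros short φ (bound r<d) φ⇒f (e (toℕ j))) i)
    where
    bound : r < d → r ℕ.+ suc (n ∸ d) ≤ n
    bound r<d = ≡.subst₂ _≤_ (≡.sym (ℕₚ.+-suc r (n ∸ d))) (ℕₚ.m+[n∸m]≡n d≤n) (ℕₚ.+-monoˡ-≤ (n ∸ d) r<d)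
    column : ∀ j → Member (columnSpace H A) (λ i → A (i , j))
    column j = UF.unit j , λ i → F.sym (UF.sum-unit-* (λ j′ → A (i , j′)) j)
    α : Fin n → Fin r → F.Carrier
    α j = proj₁ (IsBasis.spanning isBasis (column j))
    A≈αb : ∀ i j → A (i , j) F.≈ ΣF.sum (λ t → α j t F.* b t i)
    A≈αb i j = proj₂ (IsBasis.spanning isBasis (column j)) i
    φ : Fin r → Form
    φ t = record
      { form = λ u → ΣF.sum (λ j → coord u j F.* α j t)
      ; form-cong = λ e₀ → ΣF.sum-cong-≋ λ j → F.*-congʳ {α j t} (coord-cong e₀ j)
      ; form-+ = λ u v → F.trans (ΣF.sum-cong-≋ λ j → F.trans (F.*-congʳ {α j t} (coord-+ u v j)) (F.distribʳ (α j t) (coord u j) (coord v j)))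
          (ΣF.∑-distrib-+ (λ j → coord u j F.* α j t) (λ j → coord v j F.* α j t))
      ; form-* = λ a u → F.trans (ΣF.sum-cong-≋ λ j → F.trans (F.*-congʳ {α j t} (coord-* a u j)) (F.*-assoc a (coord u j) (α j t)))
          (F.sym (ΣF.*-distribˡ-sum a (λ j → coord u j F.* α j t)))
      }
    φ⇒f : ∀ u → (∀ t → form (φ t) u F.≈ F.0#) → app f u ≈ 0#
    φ⇒f u φu≈0 = coord≈0⇒≈0 λ i → begin
      coord (app f u) i ≈⟨ coord-matrix f lin u i ⟩
      ΣF.sum (λ j → coord u j F.* matrix f (i , j))
        ≈⟨ ΣF.sum-cong-≋ (λ j → F.*-congˡ {coord u j} (F.trans (F.sym (A≈f (i , j))) (A≈αb i j))) ⟩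
      ΣF.sum (λ j → coord u j F.* ΣF.sum (λ t → α j t F.* b t i))
        ≈⟨ ΣF.sum-cong-≋ (λ j → F.trans (ΣF.*-distribˡ-sum (coord u j) (λ t → α j t F.* b t i))
             (ΣF.sum-cong-≋ λ t → F.sym (F.*-assoc (coord u j) (α j t) (b t i)))) ⟩
      ΣF.sum (λ j → ΣF.sum (λ t → coord u j F.* α j t F.* b t i)) ≈⟨ ΣF.∑-comm (λ j t → coord u j F.* α j t F.* b t i) ⟩
      ΣF.sum (λ t → ΣF.sum (λ j → coord u j F.* α j t F.* b t i))
        ≈⟨ UF.sum-zero _ (λ t → F.trans (F.sym (ΣF.*-distribʳ-sum (b t i) (λ j → coord u j F.* α j t)))
             (F.trans (F.*-congʳ {b t i} (φu≈0 t)) (F.zeroˡ (b t i)))) ⟩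
      F.0# ∎
      where open SetoidReasoning F.setoid

  -- The matrix of Δⁿ⁻ᵈ is the shift by n − d columns; its columns span the first d coordinates.
  shift-rank : ∀ {d} → d ≤ n → ∀ A → (∀ ij → A ij F.≈ matrix (Δ ↑ (n ∸ d)) ij) → HasRank H A d
  shift-rank {d} d≤n A A≈ = b , record { inside = inside ; independent = independent′ ; spanning = spanning }
    where
    open SetoidReasoning F.setoid
    s = n ∸ d
    b : Fin d → Fin n → F.Carrier
    b t = UF.unit (inject≤ t d≤n)
    s+t<n : ∀ (t : Fin d) → s ℕ.+ toℕ t < n
    s+t<n t = ≡.subst (s ℕ.+ toℕ t <_) (ℕₚ.m∸n+n≡m d≤n) (ℕₚ.+-monoʳ-< s (toℕ<n t))
    j₀ : Fin d → Fin n
    j₀ t = fromℕ< (s+t<n t)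
    column : ∀ t i → A (i , j₀ t) F.≈ b t i
    column t i = begin
      A (i , j₀ t)  ≈⟨ A≈ (i , j₀ t) ⟩
      coord (app (Δ ↑ s) (e (toℕ (j₀ t)))) i   ≈⟨ coord-cong (trans (reflexive (≡.cong (λ j → app (Δ ↑ s) (e j)) (toℕ-fromℕ< (s+t<n t))))
        (trans (Δ↑-e s (s+t<n t)) (reflexive (≡.cong e (≡.sym (toℕ-inject≤ t d≤n)))))) i ⟩
      coord (e (toℕ (inject≤ t d≤n))) i        ≈⟨ coord-e (inject≤ t d≤n) i ⟩
      b t i                                    ∎
    inside : ∀ t → Member (columnSpace H A) (b t)
    inside t = UF.unit (j₀ t) , λ i → F.trans (F.sym (column t i)) (F.sym (UF.sum-unit-* (λ j → A (i , j)) (j₀ t)))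
    sum-b : ∀ (a : Fin d → F.Carrier) t → ΣF.sum (λ t′ → a t′ F.* b t′ (inject≤ t d≤n)) F.≈ a t
    sum-b a t = F.trans (UF.sum-single _ t λ t′ t′≢t → F.trans (F.*-congˡ {a t′} (F.reflexive (UF.unit-≢ {i = inject≤ t′ d≤n}
        (t′≢t ∘ Finₚ.inject≤-injective d≤n d≤n t′ t)))) (F.zeroʳ (a t′)))
      (F.trans (F.*-congˡ {a t} (F.reflexive (UF.unit-≡ (inject≤ t d≤n)))) (F.*-identityʳ (a t)))
    independent′ : LinearlyIndependent H b
    independent′ a ab≈0 t = F.trans (F.sym (sum-b a t)) (ab≈0 (inject≤ t d≤n))
    spanning : ∀ {v} → Member (columnSpace H A) v → Member (span H b) v
    spanning {v} (β , v≈) = (λ t → v (inject≤ t d≤n)) , v≈b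
      where
      v-high : ∀ i → d ≤ toℕ i → v i F.≈ F.0#
      v-high i d≤i = F.trans (v≈ i) (UF.sum-zero _ λ j → F.trans (F.*-congˡ {β j} (F.trans (A≈ (i , j))
        (coord-below {d} (trans (sym (↑-+ Δ d s (e (toℕ j)))) (trans (reflexive (≡.cong (λ m → app (Δ ↑ m) (e (toℕ j))) (ℕₚ.m+[n∸m]≡n d≤n)))
          (Δ-nilpotent _))) i d≤i))) (F.zeroʳ (β j)))
      v≈b : ∀ i → v i F.≈ ΣF.sum (λ t → v (inject≤ t d≤n) F.* b t i)
      v≈b i with toℕ i ℕₚ.<? d
      ... | yes i<d = ≡.subst (λ i → v i F.≈ ΣF.sum (λ t → v (inject≤ t d≤n) F.* b t i))
              (toℕ-injective (≡.trans (toℕ-inject≤ (fromℕ< i<d) d≤n) (toℕ-fromℕ< i<d)))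
              (F.sym (sum-b (λ t → v (inject≤ t d≤n)) (fromℕ< i<d)))
      ... | no i≮d = F.trans (v-high i (ℕₚ.≮⇒≥ i≮d)) (F.sym (UF.sum-zero _ λ t →
              F.trans (F.*-congˡ {v (inject≤ t d≤n)} (F.reflexive (UF.unit-≢ {i = inject≤ t d≤n} λ t≡i → i≮d
                (≡.subst (_< d) (≡.trans (≡.sym (toℕ-inject≤ t d≤n)) (≡.cong toℕ t≡i)) (toℕ<n t))))) (F.zeroʳ _)))

  -- `short` bounds the rank of every nonzero combination from below by d, and `shift` provides an
  -- element whose rank is exactly d, so that the minimum is attained. `supported` says that column
  -- j of each matrix stays within its height.
  record Generators (D : FerrersDiagram n) (d k : ℕ) : Set (c ⊔ ℓ₁) where
    field
      op        : Fin k → End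
      linear    : ∀ t → Linear (op t)
      short     : ∀ t → Op (suc (n ∸ d)) (op t)
      free      : ∀ (α : Fin k → F.Carrier) → (∀ u → sum (λ t → ⟦ ι ⟧ (α t) * app (op t) u) ≈ 0#) → ∀ t → α t F.≈ F.0#
      supported : ∀ t (j : Fin n) → app (Δ ↑ height D j) (app (op t) (e (toℕ j))) ≈ 0#
      shift     : 0 < k → ∃[ t ] ∀ u → app (op t) u ≈ app (Δ ↑ (n ∸ d)) u

  module _ {D : FerrersDiagram n} {d k} (1≤d : 1 ≤ d) (d≤n : d ≤ n) (G : Generators D d k) where
    open Generators G

    private
      b : Fin k → Matrix H n
      b t = matrix (op t)

      combination : ∀ {m} → (Fin m → F.Carrier) → (Fin m → End) → End
      combination {zero}  α f = 0ᴱ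
      combination {suc m} α f = (mulBy (⟦ ι ⟧ (α zero)) ⊚ f zero) ⊕ combination (α ∘ suc) (f ∘ suc)

      combination-app : ∀ {m} (α : Fin m → F.Carrier) (f : Fin m → End) u →
        app (combination α f) u ≈ sum (λ t → ⟦ ι ⟧ (α t) * app (f t) u)
      combination-app {zero}  α f u = refl
      combination-app {suc m} α f u = +-congˡ (combination-app (α ∘ suc) (f ∘ suc) u)

      combination-op : ∀ {m i} (α : Fin m → F.Carrier) {f : Fin m → End} → (∀ t → Op i (f t)) → Op i (combination α f)
      combination-op {zero}  {i} α o = op-0 i
      combination-op {suc m} α o = op-+ (op-mulˡ (⟦ ι ⟧ (α zero)) (o zero)) (combination-op (α ∘ suc) (o ∘ suc))

      combination-linear : ∀ {m} (α : Fin m → F.Carrier) (f : Fin m → End) → (∀ t → Linear (f t)) → Linear (combination α f)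
      combination-linear {zero}  α f lin a u = sym (zeroʳ _)
      combination-linear {suc m} α f lin a u = trans (+-cong (trans (*-congˡ (lin zero a u)) (swap (⟦ ι ⟧ (α zero)) (⟦ ι ⟧ a) _))
        (combination-linear (α ∘ suc) (f ∘ suc) (lin ∘ suc) a u)) (sym (distribˡ _ _ _))
        where
        open ℤSolver commutativeRing using (solve; _:=_; _:*_)
        swap : ∀ x y z → x * (y * z) ≈ y * (x * z)
        swap = solve 3 (λ x y z → x :* (y :* z) := y :* (x :* z)) refl

      lincomb-matrix : ∀ (α : Fin k → F.Carrier) ij → lincomb H α b ij F.≈ matrix (combination α op) ij
      lincomb-matrix α (i , j) = F.sym (F.trans (coord-cong (combination-app α op (e (toℕ j))) i)
        (form-sum (coordForm i) α (λ t → app (op t) (e (toℕ j)))))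

      generator : ∀ t → Member (span H b) (b t)
      generator t = UF.unit t , λ ij → F.sym (UF.sum-unit-* (λ t′ → b t′ ij) t)

    generatedCode : Code H D k d
    generatedCode = record
      { code = span H b
      ; supported = λ { (α , A≈) (i , j) ij∉D → F.trans (A≈ (i , j)) (UF.sum-zero _ λ t →
          F.trans (F.*-congˡ {α t} (coord-below (supported t j) i (ℕₚ.≮⇒≥ ij∉D))) (F.zeroʳ (α t))) }
      ; dimension = b , record
          { inside = generator
          ; independent = λ α αb≈0 → free α λ u → trans (sym (combination-app α op u))
              (matrix-zero (combination α op) (combination-linear α op linear)
                (λ ij → F.trans (F.sym (lincomb-matrix α ij)) (αb≈0 ij)) u)
          ; spanning = λ v∈ → v∈
          }
      ; distance = λ 0<k → record
          { attained = let t , op≈ = shift 0<k in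
              b t , generator t , b≉0 t op≈ , shift-rank d≤n (b t) (λ (i , j) → coord-cong (op≈ (e (toℕ j))) i)
          ; minimal = λ { A (α , A≈) → rank-bound 1≤d d≤n (combination α op) (combination-linear α op linear)
              (combination-op α short) A (λ ij → F.trans (A≈ ij) (lincomb-matrix α ij)) }
          }
      }
      where
      b≉0 : ∀ t → (∀ u → app (op t) u ≈ app (Δ ↑ (n ∸ d)) u) → ¬ (∀ ij → b t ij F.≈ F.0#)
      b≉0 t op≈ bt≈0 = 1≉0 (begin
        1#  ≈⟨ Δ↑-e-same n-d<n ⟨
        app (Δ ↑ (n ∸ d)) (e (n ∸ d))  ≈⟨ op≈ _ ⟨
        app (op t) (e (n ∸ d))         ≈⟨ matrix-zero (op t) (linear t) bt≈0 _ ⟩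
        0#                             ∎)
        where
        open SetoidReasoning setoid
        n-d<n : n ∸ d < n
        n-d<n = ℕₚ.∸-monoʳ-< {o = 0} 1≤d d≤n

-- Linear independence of the families e Δⁱ and Δⁱ e

module FreeFamilies {F : DecField c ℓ} {p n} (M : ShiftModel F p n) where
  private
    module F = DecField F
    module UF = Kronecker F.commutativeRing
    module ΣF = Sum F.semiring
  open ShiftModel M
  open DecField K
  open Sum semiring using (sum; sum-cong-≋; *-distribʳ-sum)
  open Endomorphisms commutativeRing
  open Difference θ
  open ShiftOperators M
  open Form
  open SetoidReasoning setoid

  Free : ∀ {k} → (Fin k → End) → Set _
  Free {k} f = ∀ (α : Fin k → F.Carrier) → (∀ u → sum (λ t → ⟦ ι ⟧ (α t) * app (f t) u) ≈ 0#) → ∀ t → α t F.≈ F.0#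

  module _ {k} (deg pos : Fin k → ℕ) (deg<n : ∀ t → deg t < n) (pos<n : ∀ t → pos t < n)
    (distinct : ∀ {t t′} → deg t ≡ deg t′ → pos t ≡ pos t′ → t ≡ t′) where

    private
      ι-0 : ∀ {a} v → a F.≈ F.0# → ⟦ ι ⟧ a * v ≈ 0#
      ι-0 v a≈0 = trans (*-congʳ (trans (⟦⟧-cong ι a≈0) (0-homo ι))) (zeroˡ v)

      coord-pos : ∀ t t₀ → coord (e (pos t)) (fromℕ< (pos<n t₀)) F.≈ UF.unit (fromℕ< (pos<n t)) (fromℕ< (pos<n t₀))
      coord-pos t t₀ = F.trans (coord-cong (reflexive (≡.cong e (≡.sym (toℕ-fromℕ< (pos<n t))))) _)
        (coord-e (fromℕ< (pos<n t)) (fromℕ< (pos<n t₀)))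

      coord-same : ∀ t → coord (e (pos t)) (fromℕ< (pos<n t)) F.≈ F.1#
      coord-same t = F.trans (coord-pos t t) (F.reflexive (UF.unit-≡ (fromℕ< (pos<n t))))

      coord-other : ∀ {t t₀} → ¬ pos t ≡ pos t₀ → coord (e (pos t)) (fromℕ< (pos<n t₀)) F.≈ F.0#
      coord-other {t} {t₀} pos≢ = F.trans (coord-pos t t₀) (F.reflexive (UF.unit-≢ λ eq → pos≢
        (≡.trans (≡.sym (toℕ-fromℕ< (pos<n t))) (≡.trans (≡.cong toℕ eq) (toℕ-fromℕ< (pos<n t₀))))))

      by-degree : ∀ (α : Fin k → F.Carrier) →
        (∀ t → (∀ t′ → deg t′ < deg t → α t′ F.≈ F.0#) → α t F.≈ F.0#) → ∀ t → α t F.≈ F.0#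
      by-degree α step t = below (suc (deg t)) t (ℕₚ.n<1+n _)
        where
        below : ∀ i t → deg t < i → α t F.≈ F.0#
        below (suc i) t (s≤s deg≤i) = step t λ t′ deg< → below i t′ (ℕₚ.<-≤-trans deg< deg≤i)

    -- Evaluation at e_i is triangular in the degree: Δʲ e_i = 0 for j > i and Δⁱ e_i = 1.
    left-free : Free (λ t → mulBy (e (pos t)) ⊚ (Δ ↑ deg t))
    left-free α α≈0 = by-degree α step
      where
      step : ∀ t → (∀ t′ → deg t′ < deg t → α t′ F.≈ F.0#) → α t F.≈ F.0#
      step t below = F.trans (F.sym value) (F.trans (F.sym single) vanishes)
        where
        i₀ = deg t
        j₀ = fromℕ< (pos<n t)
        term : Fin k → Carrier
        term t′ = e (pos t′) * app (Δ ↑ deg t′) (e i₀)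
        vanishes : ΣF.sum (λ t′ → α t′ F.* coord (term t′) j₀) F.≈ F.0#
        vanishes = F.trans (F.sym (form-sum (coordForm j₀) α term)) (coord-0 (α≈0 (e i₀)) j₀)
        term-same : ∀ {t′} → deg t′ ≡ i₀ → term t′ ≈ e (pos t′)
        term-same {t′} deg≡ = trans (*-congˡ (trans (reflexive (≡.cong (λ j → app (Δ ↑ j) (e i₀)) deg≡)) (Δ↑-e-same (deg<n t)))) (*-identityʳ _)
        single : ΣF.sum (λ t′ → α t′ F.* coord (term t′) j₀) F.≈ α t F.* coord (term t) j₀
        single = UF.sum-single _ t other
          where
          other : ∀ t′ → ¬ t′ ≡ t → α t′ F.* coord (term t′) j₀ F.≈ F.0#
          other t′ t′≢t with ℕₚ.<-cmp (deg t′) i₀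
          ... | tri< deg< _ _ = F.trans (F.*-congʳ (below t′ deg<)) (F.zeroˡ _)
          ... | tri≈ _ deg≡ _ = F.trans (F.*-congˡ (F.trans (coord-cong (term-same deg≡) j₀)
                (coord-other (λ pos≡ → t′≢t (distinct deg≡ pos≡))))) (F.zeroʳ _)
          ... | tri> _ _ deg> = F.trans (F.*-congˡ (coord-0 (trans (*-congˡ (Δ↑-e-0 deg> (deg<n t))) (zeroʳ _)) j₀)) (F.zeroʳ _)
        value : α t F.* coord (term t) j₀ F.≈ α t
        value = F.trans (F.*-congˡ (F.trans (coord-cong (term-same ≡.refl) j₀) (coord-same t))) (F.*-identityʳ _)

    -- Δⁿ⁻¹⁻ⁱ leaves only the terms of degree i, and Δⁿ⁻¹ (a w) = 1 for w = a⁻¹ e_{n−1}.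
    right-free : Free (λ t → (Δ ↑ deg t) ⊚ mulBy (e (pos t)))
    right-free α α≈0 = by-degree α step
      where
      step : ∀ t → (∀ t′ → deg t′ < deg t → α t′ F.≈ F.0#) → α t F.≈ F.0#
      step t below = F.trans (F.sym value) (F.trans (F.sym single) vanishes)
        where
        i₀ = deg t
        j₀ = fromℕ< (pos<n t)
        0<n : 0 < n
        0<n = ℕₚ.≤-<-trans z≤n (deg<n t)
        choose : ∀ {t′} → Dec (deg t′ ≡ i₀) → F.Carrier
        choose {t′} (yes _) = α t′
        choose {t′} (no _)  = F.0#
        β : Fin k → F.Carrier
        β t′ = choose {t′} (deg t′ ℕₚ.≟ i₀)
        a : Carrier
        a = sum (λ t′ → ⟦ ι ⟧ (β t′) * e (pos t′))
        term≈ : ∀ w t′ → app (Δ ↑ (n ∸ 1 ∸ i₀)) (⟦ ι ⟧ (α t′) * app (Δ ↑ deg t′) (e (pos t′) * w))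
          ≈ ⟦ ι ⟧ (β t′) * app (Δ ↑ (n ∸ 1)) (e (pos t′) * w)
        term≈ w t′ = trans (Δ↑-scale (θι (α t′)) (n ∸ 1 ∸ i₀) _)
            (trans (*-congˡ (sym (↑-+ Δ (n ∸ 1 ∸ i₀) (deg t′) (e (pos t′) * w)))) (cases (deg t′ ℕₚ.≟ i₀)))
          where
          m = n ∸ 1 ∸ i₀
          i₀≤n-1 : i₀ ≤ n ∸ 1
          i₀≤n-1 = ℕₚ.∸-monoˡ-≤ 1 (deg<n t)
          cases : (dec : Dec (deg t′ ≡ i₀)) → ⟦ ι ⟧ (α t′) * app (Δ ↑ (m ℕ.+ deg t′)) (e (pos t′) * w)
            ≈ ⟦ ι ⟧ (choose {t′} dec) * app (Δ ↑ (n ∸ 1)) (e (pos t′) * w)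
          cases (yes deg≡) = *-congˡ (reflexive (≡.cong (λ j → app (Δ ↑ j) (e (pos t′) * w))
            (≡.trans (≡.cong (m ℕ.+_) deg≡) (ℕₚ.m∸n+n≡m i₀≤n-1))))
          cases (no deg≢) = trans (by-order (ℕₚ.<-cmp (deg t′) i₀)) (sym (ι-0 _ F.refl))
            where
            by-order : _ → ⟦ ι ⟧ (α t′) * app (Δ ↑ (m ℕ.+ deg t′)) (e (pos t′) * w) ≈ 0#
            by-order (tri< deg< _ _) = ι-0 _ (below t′ deg<)
            by-order (tri≈ _ deg≡ _) = ⊥-elim (deg≢ deg≡)
            by-order (tri> _ _ deg>) = trans (*-congˡ (Δ↑-mono n≤m+deg (Δ-nilpotent _))) (zeroʳ _)
              where
              n≤m+deg : n ≤ m ℕ.+ deg t′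
              n≤m+deg = ≡.subst (_≤ m ℕ.+ deg t′) (≡.trans (ℕₚ.+-suc m i₀)
                  (≡.trans (≡.cong suc (ℕₚ.m∸n+n≡m i₀≤n-1)) (ℕₚ.suc-pred n {{ℕ.>-nonZero 0<n}})))
                (ℕₚ.+-monoʳ-≤ m deg>)
        Δ↑aw≈0 : ∀ w → app (Δ ↑ (n ∸ 1)) (a * w) ≈ 0#
        Δ↑aw≈0 w = begin
          app (Δ ↑ (n ∸ 1)) (a * w) ≈⟨ app-cong (Δ ↑ (n ∸ 1)) (*-distribʳ-sum w (λ t′ → ⟦ ι ⟧ (β t′) * e (pos t′))) ⟩
          app (Δ ↑ (n ∸ 1)) (sum (λ t′ → ⟦ ι ⟧ (β t′) * e (pos t′) * w))
            ≈⟨ app-sum (Δ ↑ (n ∸ 1)) (λ t′ → ⟦ ι ⟧ (β t′) * e (pos t′) * w) ⟩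
          sum (λ t′ → app (Δ ↑ (n ∸ 1)) (⟦ ι ⟧ (β t′) * e (pos t′) * w))
            ≈⟨ sum-cong-≋ (λ t′ → trans (app-cong (Δ ↑ (n ∸ 1)) (*-assoc (⟦ ι ⟧ (β t′)) (e (pos t′)) w))
                 (trans (Δ↑-scale (θι (β t′)) (n ∸ 1) (e (pos t′) * w)) (sym (term≈ w t′)))) ⟩
          sum (λ t′ → app (Δ ↑ (n ∸ 1 ∸ i₀)) (⟦ ι ⟧ (α t′) * app (Δ ↑ deg t′) (e (pos t′) * w)))
            ≈⟨ app-sum (Δ ↑ (n ∸ 1 ∸ i₀)) (λ t′ → ⟦ ι ⟧ (α t′) * app (Δ ↑ deg t′) (e (pos t′) * w)) ⟨
          app (Δ ↑ (n ∸ 1 ∸ i₀)) (sum (λ t′ → ⟦ ι ⟧ (α t′) * app (Δ ↑ deg t′) (e (pos t′) * w)))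
            ≈⟨ trans (app-cong (Δ ↑ (n ∸ 1 ∸ i₀)) (α≈0 w)) (app-0 (Δ ↑ (n ∸ 1 ∸ i₀))) ⟩
          0# ∎
        a≈0 : a ≈ 0#
        a≈0 with a ≟ 0#
        ... | yes a≈0 = a≈0
        ... | no  a≉0 = ⊥-elim (1≉0 (begin
          1#  ≈⟨ Δ↑-e-same (ℕₚ.∸-monoʳ-< {o = 0} (s≤s z≤n) 0<n) ⟨
          app (Δ ↑ (n ∸ 1)) (e (n ∸ 1))  ≈⟨ app-cong (Δ ↑ (n ∸ 1)) (trans (sym (*-assoc a a⁻¹ _))
                                                         (trans (*-congʳ (proj₂ (inverse a a≉0))) (*-identityˡ _))) ⟨
          app (Δ ↑ (n ∸ 1)) (a * (a⁻¹ * e (n ∸ 1))) ≈⟨ Δ↑aw≈0 _ ⟩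
          0#                                        ∎))
          where a⁻¹ = proj₁ (inverse a a≉0)
        vanishes : ΣF.sum (λ t′ → β t′ F.* coord (e (pos t′)) j₀) F.≈ F.0#
        vanishes = F.trans (F.sym (form-sum (coordForm j₀) β (λ t′ → e (pos t′)))) (coord-0 a≈0 j₀)
        single : ΣF.sum (λ t′ → β t′ F.* coord (e (pos t′)) j₀) F.≈ β t F.* coord (e (pos t)) j₀
        single = UF.sum-single _ t λ t′ t′≢t → other t′ t′≢t (deg t′ ℕₚ.≟ i₀)
          where
          other : ∀ t′ → ¬ t′ ≡ t → (dec : Dec (deg t′ ≡ i₀)) → choose {t′} dec F.* coord (e (pos t′)) j₀ F.≈ F.0#
          other t′ t′≢t (yes deg≡) = F.trans (F.*-congˡ (coord-other (λ pos≡ → t′≢t (distinct deg≡ pos≡)))) (F.zeroʳ _)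
          other t′ t′≢t (no _)     = F.zeroˡ _
        value : β t F.* coord (e (pos t)) j₀ F.≈ α t
        value = F.trans (F.*-congˡ (coord-same t)) (F.trans (F.*-identityʳ _) (chosen (deg t ℕₚ.≟ i₀)))
          where
          chosen : (dec : Dec (deg t ≡ i₀)) → choose {t} dec F.≈ α t
          chosen (yes _)   = F.refl
          chosen (no deg≢) = ⊥-elim (deg≢ ≡.refl)

-- Ferrers diagrams

νmin≤ν : ∀ {n} (D : FerrersDiagram n) {d j} → j < d → νmin D d ≤ ν D d j
νmin≤ν D {d} j<d = All.lookup (min≤xs (ν D d 0) (List.map (ν D d) (upTo d))) (∈-map⁺ (ν D d) (∈-upTo⁺ j<d))

-- The index set of a family of operators: `w` is the list of summands of some `ν`, and a cell is a
-- column together with an offset below its summand.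
Cell : ∀ {m} → (Fin m → ℕ) → Set
Cell {m} w = Σ (Fin m) λ i → Fin (w i)

-- Shaped like `ν`, so that a value of `ν` is such a total by definition.
total : ∀ {m} → (Fin m → ℕ) → ℕ
total w = ListAction.sum (tabulate w)

sucCell : ∀ {m} {w : Fin (suc m) → ℕ} → Cell (w ∘ suc) → Cell w
sucCell (i , s) = suc i , s

decode : ∀ {m} (w : Fin m → ℕ) → Fin (total w) → Cell w
decode {suc m} w x with splitAt (w zero) x
... | inj₁ s = zero , s
... | inj₂ y = sucCell (decode (w ∘ suc) y)

encode : ∀ {m} (w : Fin m → ℕ) → Cell w → Fin (total w)
encode w (zero  , s) = s ↑ˡ total (w ∘ suc)
encode w (suc i , s) = w zero ↑ʳ encode (w ∘ suc) (i , s)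

decode-encode : ∀ {m} (w : Fin m → ℕ) x → decode w (encode w x) ≡ x
decode-encode w (zero  , s) rewrite Finₚ.splitAt-↑ˡ (w zero) s (total (w ∘ suc)) = ≡.refl
decode-encode w (suc i , s) rewrite Finₚ.splitAt-↑ʳ (w zero) (total (w ∘ suc)) (encode (w ∘ suc) (i , s)) =
  ≡.cong sucCell (decode-encode (w ∘ suc) (i , s))

encode-decode : ∀ {m} (w : Fin m → ℕ) x → encode w (decode w x) ≡ x
encode-decode {suc m} w x with splitAt (w zero) x in eq
... | inj₁ s = Finₚ.splitAt⁻¹-↑ˡ eq
... | inj₂ y = ≡.trans (≡.cong (w zero ↑ʳ_) (encode-decode (w ∘ suc) y)) (Finₚ.splitAt⁻¹-↑ʳ eq)

record Selection {m} (w : Fin m → ℕ) (i₀ : Fin m) (k : ℕ) : Set where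
  field
    index    : Fin k → Fin m
    offset   : Fin k → ℕ
    offset<  : ∀ t → offset t < w (index t)
    distinct : ∀ {t t′} → index t ≡ index t′ → offset t ≡ offset t′ → t ≡ t′
    special  : 0 < k → ∃[ t ] index t ≡ i₀ × offset t ≡ 0

-- Exactly k of the cells are kept, and the cell at offset 0 of column i₀, meant for Δⁿ⁻ᵈ, has to be
-- among them. That cell exists as soon as there is any, because no column is taller than i₀.
select : ∀ {m} (w : Fin m → ℕ) (i₀ : Fin m) → (∀ i → w i ≤ w i₀) → ∀ k → k ≤ total w → Selection w i₀ k
select w i₀ w≤ zero _ = record
  { index = λ () ; offset = λ () ; offset< = λ () ; distinct = λ { {()} } ; special = λ () }
select {m} w i₀ w≤ (suc k) k<S = record
  { index    = λ t → proj₁ (decode w (g t))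
  ; offset   = λ t → toℕ (proj₂ (decode w (g t)))
  ; offset<  = λ t → toℕ<n (proj₂ (decode w (g t)))
  ; distinct = λ {t} {t′} e e′ → g-injective (≡.trans (≡.sym (encode-decode w (g t)))
      (≡.trans (≡.cong (encode w) (pair-≡ _ _ e e′)) (encode-decode w (g t′))))
  ; special  = λ _ → zero , ≡.cong proj₁ decode-g₀
      , ≡.trans (≡.cong (λ x → toℕ (proj₂ x)) decode-g₀) (toℕ-fromℕ< 0<w)
  }
  where
  pair-≡ : ∀ (x y : Cell w) → proj₁ x ≡ proj₁ y → toℕ (proj₂ x) ≡ toℕ (proj₂ y) → x ≡ y
  pair-≡ (i , s) (.i , s′) ≡.refl e = ≡.cong (i ,_) (toℕ-injective e)
  0<w : 0 < w i₀
  0<w = ℕₚ.<-≤-trans (ℕₚ.≤-<-trans z≤n (toℕ<n (proj₂ (decode w (fromℕ< k<S))))) (w≤ _)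
  x₀ : Cell w
  x₀ = i₀ , fromℕ< 0<w
  s₀ : Fin (total w)
  s₀ = encode w x₀
  -- Index 0 goes to the prescribed place, and the other indices fill places around it injectively.
  spread : ∀ {S} → suc k ≤ S → Fin S → Fin (suc k) → Fin S
  spread (s≤s k≤S) s zero    = s
  spread (s≤s k≤S) s (suc t) = punchIn s (inject≤ t k≤S)
  spread-injective : ∀ {S} (k<S : suc k ≤ S) s {t t′} → spread k<S s t ≡ spread k<S s t′ → t ≡ t′
  spread-injective (s≤s k≤S) s {zero}  {zero}   e = ≡.refl
  spread-injective (s≤s k≤S) s {zero}  {suc t′} e = ⊥-elim (Finₚ.punchInᵢ≢i s _ (≡.sym e))
  spread-injective (s≤s k≤S) s {suc t} {zero}   e = ⊥-elim (Finₚ.punchInᵢ≢i s _ e)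
  spread-injective (s≤s k≤S) s {suc t} {suc t′} e = ≡.cong suc
    (Finₚ.inject≤-injective k≤S k≤S t t′ (Finₚ.punchIn-injective s _ _ e))
  g : Fin (suc k) → Fin (total w)
  g = spread k<S s₀
  spread-zero : ∀ {S} (k<S : suc k ≤ S) s → spread k<S s zero ≡ s
  spread-zero (s≤s _) s = ≡.refl
  decode-g₀ : decode w (g zero) ≡ x₀
  decode-g₀ = ≡.trans (≡.cong (decode w) (spread-zero k<S s₀)) (decode-encode w x₀)
  g-injective : ∀ {t t′} → g t ≡ g t′ → t ≡ t′
  g-injective = spread-injective k<S s₀

-- Diagrams in blocks of length q and their contractions

module Blocks (q : ℕ) .{{_ : NonZero q}} {n} (D : FerrersDiagram n) (B : Blocked q D) where
  open Blocked B
  open import Data.Nat.Base using (_+_; _*_)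
  open ℕₚ.≤-Reasoning

  n′ : ℕ
  n′ = n / q

  D′ : FerrersDiagram n′
  D′ = contraction q D

  n′q≡n : n′ * q ≡ n
  n′q≡n = m/n*n≡m ∣order

  block : Fin n → Fin n′
  block i = fromℕ< (m<n*o⇒m/o<n (≡.subst (toℕ i <_) (≡.sym n′q≡n) (toℕ<n i)))

  toℕ-block : ∀ i → toℕ (block i) ≡ toℕ i / q
  toℕ-block i = toℕ-fromℕ< _

  block-lower : ∀ i → toℕ (block i) * q ≤ toℕ i
  block-lower i = ≡.subst (λ b → b * q ≤ toℕ i) (≡.sym (toℕ-block i)) (m/n*n≤m (toℕ i) q)

  block-upper : ∀ i → toℕ i < suc (toℕ (block i)) * q
  block-upper i = ≡.subst (λ b → toℕ i < suc b * q) (≡.sym (toℕ-block i)) (begin-strict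
    toℕ i  ≡⟨ m≡m%n+[m/n]*n (toℕ i) q ⟩
    toℕ i % q + toℕ i / q * q      <⟨ ℕₚ.+-monoˡ-< (toℕ i / q * q) (m%n<n (toℕ i) q) ⟩
    q + toℕ i / q * q              ∎)

  private
    -- `Blocked` counts its blocks from the right. As q divides n, the block I from the left is the
    -- block n′ - 1 - I from the right.
    opposite-block : ∀ (I : Fin n′) (i : Fin n) → toℕ I * q ≤ toℕ i → toℕ i < suc (toℕ I) * q →
      (n′ ∸ suc (toℕ I)) * q ≤ toℕ (opposite i) × toℕ (opposite i) < (n′ ∸ suc (toℕ I) + 1) * q
    opposite-block I i Iq≤i i<Iq+q = lower , upper
      where
      lower : (n′ ∸ suc (toℕ I)) * q ≤ toℕ (opposite i)
      lower = begin
        (n′ ∸ suc (toℕ I)) * q      ≡⟨ ℕₚ.*-distribʳ-∸ q n′ (suc (toℕ I)) ⟩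
        n′ * q ∸ suc (toℕ I) * q    ≡⟨ ≡.cong (_∸ suc (toℕ I) * q) n′q≡n ⟩
        n ∸ suc (toℕ I) * q         ≤⟨ ℕₚ.∸-monoʳ-≤ n i<Iq+q ⟩
        n ∸ suc (toℕ i)  ≡⟨ opposite-prop i ⟨
        toℕ (opposite i)            ∎
      upper : toℕ (opposite i) < (n′ ∸ suc (toℕ I) + 1) * q
      upper = begin-strict
        toℕ (opposite i)  ≡⟨ opposite-prop i ⟩
        n ∸ suc (toℕ i)             <⟨ ℕₚ.∸-monoʳ-< (ℕₚ.n<1+n (toℕ i)) (toℕ<n i) ⟩
        n ∸ toℕ i                   ≤⟨ ℕₚ.∸-monoʳ-≤ n Iq≤i ⟩
        n ∸ toℕ I * q  ≡⟨ ≡.cong (_∸ toℕ I * q) n′q≡n ⟨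
        n′ * q ∸ toℕ I * q          ≡⟨ ℕₚ.*-distribʳ-∸ q n′ (toℕ I) ⟨
        (n′ ∸ toℕ I) * q  ≡⟨ ≡.cong (_* q) (≡.trans (ℕₚ.+-∸-assoc 1 (toℕ<n I)) (≡.sym (ℕₚ.+-comm (n′ ∸ suc (toℕ I)) 1))) ⟩
        (n′ ∸ suc (toℕ I) + 1) * q  ∎

    toℕ-contractIndex : ∀ I → suc (toℕ (contractIndex q {n} I)) ≡ suc (toℕ I) * q
    toℕ-contractIndex I = ≡.trans (≡.cong suc (toℕ-fromℕ< (contractIndex< q {n} I)))
      (ℕₚ.suc-pred (suc (toℕ I) * q) {{ℕₚ.m*n≢0 (suc (toℕ I)) q}})

  height-block : ∀ i → height D i ≡ q * height D′ (block i)
  height-block i = begin-equality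
    height D i  ≡⟨ ≡.cong (height D) (opposite-involutive i) ⟨
    height D (opposite (opposite i))  ≡⟨ block-const (n′ ∸ suc (toℕ I)) (opposite i) (opposite i′)
                                                       (proj₁ bᵢ) (proj₂ bᵢ) (proj₁ b′) (proj₂ b′) ⟩
    height D (opposite (opposite i′))  ≡⟨ ≡.cong (height D) (opposite-involutive i′) ⟩
    height D i′  ≡⟨ m/n*n≡m (∣height i′) ⟨
    height D′ I * q  ≡⟨ ℕₚ.*-comm (height D′ I) q ⟩
    q * height D′ I                               ∎
    where
    I = block i
    -- The last column of the block of i, by which the contraction defines its height.
    i′ = contractIndex q {n} I
    bᵢ = opposite-block I i (block-lower i) (block-upper i)
    b′ = opposite-block I i′
      (ℕₚ.≤-pred (≡.subst (suc (toℕ I * q) ≤_) (≡.sym (toℕ-contractIndex I))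
        (ℕₚ.+-monoˡ-≤ (toℕ I * q) (ℕ.>-nonZero⁻¹ q))))
      (≡.subst (toℕ i′ <_) (toℕ-contractIndex I) (ℕₚ.n<1+n (toℕ i′)))

  block-mono : ∀ {i j} → toℕ i ≤ toℕ j → toℕ (block i) ≤ toℕ (block j)
  block-mono {i} {j} i≤j = ≡.subst₂ _≤_ (≡.sym (toℕ-block i)) (≡.sym (toℕ-block j)) (/-monoˡ-≤ q i≤j)

  private
    previous : ∀ {b} {I J : Fin n′} → toℕ J ≡ toℕ I + suc b → Σ (Fin n′) λ J⁻ → toℕ J⁻ ≡ toℕ I + b × toℕ J ≡ suc (toℕ J⁻)
    previous {b} {I} {J} e = fromℕ< lt , toℕ-fromℕ< lt , ≡.trans e (≡.trans (ℕₚ.+-suc (toℕ I) b) (≡.cong suc (≡.sym (toℕ-fromℕ< lt))))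
      where
      lt : toℕ I + b < n′
      lt = ℕₚ.<-trans (≡.subst (toℕ I + b <_) (≡.sym (≡.trans e (ℕₚ.+-suc (toℕ I) b))) (ℕₚ.n<1+n _)) (toℕ<n J)

  -- Strict growth is only guaranteed below the full height, hence the alternative in the
  -- conclusion.
  monotone-growth : Monotone D′ → ∀ b {I J} → toℕ J ≡ toℕ I + b → 0 < height D′ I →
    n′ ≤ height D′ J ⊎ height D′ I + b ≤ height D′ J
  monotone-growth mono zero {I} {J} e 0<c = inj₂ (ℕₚ.≤-reflexive (≡.trans (ℕₚ.+-identityʳ _)
    (≡.cong (height D′) (toℕ-injective (≡.trans (≡.sym (ℕₚ.+-identityʳ _)) (≡.sym e))))))
  monotone-growth mono (suc b) {I} {J} e 0<c = step (ℕₚ.≤-<-connex n′ (height D′ J⁻)) (monotone-growth mono b e⁻ 0<c)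
    where
    J⁻ = proj₁ (previous e)
    e⁻ = proj₁ (proj₂ (previous e))
    J≡1+J⁻ = proj₂ (proj₂ (previous e))
    step : n′ ≤ height D′ J⁻ ⊎ height D′ J⁻ < n′ → n′ ≤ height D′ J⁻ ⊎ height D′ I + b ≤ height D′ J⁻ →
      n′ ≤ height D′ J ⊎ height D′ I + suc b ≤ height D′ J
    step (inj₁ full) _ = inj₁ (ℕₚ.≤-trans full (height-mono D′ (≡.subst (toℕ J⁻ ≤_) (≡.sym J≡1+J⁻) (ℕₚ.n≤1+n _))))
    step (inj₂ c<n′) (inj₁ full) = ⊥-elim (ℕₚ.<⇒≱ c<n′ full)
    step (inj₂ c<n′) (inj₂ le) = inj₂ (≡.subst (_≤ height D′ J) (≡.sym (ℕₚ.+-suc _ b)) (ℕₚ.≤-<-trans le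
      (mono J⁻ J J≡1+J⁻ (ℕₚ.<-≤-trans 0<c (ℕₚ.≤-trans (ℕₚ.m≤m+n _ b) le)) c<n′)))

  convex-growth : Convex D′ → ∀ b {I J} → toℕ J ≡ toℕ I + b → height D′ J ≤ height D′ I + b
  convex-growth conv zero {I} {J} e = ℕₚ.≤-reflexive (≡.trans
    (≡.cong (height D′) (toℕ-injective (≡.trans e (ℕₚ.+-identityʳ _)))) (≡.sym (ℕₚ.+-identityʳ _)))
  convex-growth conv (suc b) {I} {J} e = begin
    height D′ J             ≤⟨ ℕₚ.≤-trans (ℕₚ.m≤n+m∸n (height D′ J) (height D′ J⁻)) (ℕₚ.+-monoʳ-≤ (height D′ J⁻) (conv J⁻ J (proj₂ (proj₂ (previous e))))) ⟩
    height D′ J⁻ + 1        ≤⟨ ℕₚ.+-monoˡ-≤ 1 (convex-growth conv b (proj₁ (proj₂ (previous e)))) ⟩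
    height D′ I + b + 1     ≡⟨ ≡.trans (ℕₚ.+-assoc _ b 1) (≡.cong (height D′ I +_) (ℕₚ.+-comm b 1)) ⟩
    height D′ I + suc b     ∎
    where J⁻ = proj₁ (previous e)

  -- Prepares `block-mul` for the product of e_pos, with pos below the height of column i, and
  -- e_(col - i). Here a + 1 is the contracted height at i and b the number of block steps from i to
  -- col; monotonicity yields contracted height at least a + 1 + b at col, unless it is full.
  monotone-blocks : Monotone D′ → ∀ i col → toℕ i ≤ toℕ col → 0 < height D i →
    ∃[ a ] ∃[ b ] height D i ≡ q * suc a × toℕ col ∸ toℕ i < q * suc b ×
      (n ≤ height D col ⊎ q * suc (a + b) ≤ height D col)
  monotone-blocks mono i col i≤col 0<c = a , b , trans-height , distance , growth (monotone-growth mono b C≡I+b 0<c′)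
    where
    I = block i
    C = block col
    b = toℕ C ∸ toℕ I
    C≡I+b : toℕ C ≡ toℕ I + b
    C≡I+b = ≡.sym (ℕₚ.m+[n∸m]≡n (block-mono {i} {col} i≤col))
    0<c′ : 0 < height D′ I
    0<c′ = ℕₚ.n≢0⇒n>0 λ c′≡0 → ℕₚ.<⇒≢ 0<c (≡.sym (≡.trans (height-block i) (≡.trans (≡.cong (q *_) c′≡0) (ℕₚ.*-zeroʳ q))))
    a = height D′ I ∸ 1
    c′≡1+a : height D′ I ≡ suc a
    c′≡1+a = ≡.sym (ℕₚ.suc-pred (height D′ I) {{ℕ.>-nonZero 0<c′}})
    trans-height : height D i ≡ q * suc a
    trans-height = ≡.trans (height-block i) (≡.cong (q *_) c′≡1+a)
    distance : toℕ col ∸ toℕ i < q * suc b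
    distance = ℕₚ.+-cancelʳ-< (toℕ i) _ _ (begin-strict
      toℕ col ∸ toℕ i + toℕ i       ≡⟨ ℕₚ.m∸n+n≡m i≤col ⟩
      toℕ col                       <⟨ block-upper col ⟩
      suc (toℕ C) * q  ≡⟨ ≡.cong (λ z → suc z * q) C≡I+b ⟩
      suc (toℕ I + b) * q           ≡⟨ lem (toℕ I) b q ⟩
      q * suc b + toℕ I * q         ≤⟨ ℕₚ.+-monoʳ-≤ (q * suc b) (block-lower i) ⟩
      q * suc b + toℕ i             ∎)
      where
      lem : ∀ I b q → suc (I + b) * q ≡ q * suc b + I * q
      lem = solve-∀
    growth : n′ ≤ height D′ C ⊎ height D′ I + b ≤ height D′ C → n ≤ height D col ⊎ q * suc (a + b) ≤ height D col
    growth (inj₁ full) = inj₁ (begin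
      n  ≡⟨ n′q≡n ⟨
      n′ * q              ≤⟨ ℕₚ.*-monoˡ-≤ q full ⟩
      height D′ C * q     ≡⟨ ℕₚ.*-comm (height D′ C) q ⟩
      q * height D′ C     ≡⟨ height-block col ⟨
      height D col        ∎)
    growth (inj₂ le) = inj₂ (begin
      q * suc (a + b)           ≡⟨ ≡.cong (λ z → q * (z + b)) c′≡1+a ⟨
      q * (height D′ I + b)     ≤⟨ ℕₚ.*-monoʳ-≤ q le ⟩
      q * height D′ C           ≡⟨ height-block col ⟨
      height D col              ∎)

  -- Prepares `block-mul` for the product of e_(n-1-j) and e_col, in blocks a and b. If δ is the
  -- number of block steps from col to j, then q (a + b + 1) = n - q δ, while convexity gives x ≤
  -- height at j ≤ height at col + q δ. Adding the two gives the bound.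
  convex-blocks : Convex D′ → ∀ col j → toℕ col ≤ toℕ j →
    ∃[ a ] ∃[ b ] n ∸ 1 ∸ toℕ j < q * suc a × toℕ col < q * suc b ×
      (∀ x → x ≤ height D j → q * suc (a + b) ≤ height D col + (n ∸ x))
  convex-blocks conv col j col≤j = a , b
    , (begin-strict
        n ∸ 1 ∸ toℕ j  ≡⟨ ℕₚ.∸-+-assoc n 1 (toℕ j) ⟩
        n ∸ suc (toℕ j)           ≡⟨ opposite-prop j ⟨
        toℕ (opposite j)          <⟨ proj₂ (opposite-block J j (block-lower j) (block-upper j)) ⟩
        (a + 1) * q  ≡⟨ ≡.trans (≡.cong (_* q) (ℕₚ.+-comm a 1)) (ℕₚ.*-comm (suc a) q) ⟩
        q * suc a                 ∎)
    , ≡.subst (toℕ col <_) (ℕₚ.*-comm (suc b) q) (block-upper col)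
    , λ x x≤c → ≡.subst (q * suc (a + b) ≤_) (ℕₚ.+-∸-assoc (height D col) (ℕₚ.≤-trans x≤c (height≤n D j)))
        (ℕₚ.m+n≤o⇒m≤o∸n _ (ℕₚ.≤-trans (ℕₚ.+-monoʳ-≤ (q * suc (a + b)) x≤c) bound))
    where
    J = block j
    C = block col
    a = n′ ∸ suc (toℕ J)
    b = toℕ C
    δ = toℕ J ∸ toℕ C
    J≡C+δ : toℕ J ≡ toℕ C + δ
    J≡C+δ = ≡.sym (ℕₚ.m+[n∸m]≡n (block-mono {col} {j} col≤j))
    bound : q * suc (a + b) + height D j ≤ height D col + n
    bound = begin
      q * suc (a + b) + height D j  ≡⟨ ≡.cong (q * suc (a + b) +_) (height-block j) ⟩
      q * suc (a + b) + q * height D′ J          ≤⟨ ℕₚ.+-monoʳ-≤ (q * suc (a + b)) (ℕₚ.*-monoʳ-≤ q (convex-growth conv δ J≡C+δ)) ⟩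
      q * suc (a + b) + q * (height D′ C + δ)    ≡⟨ lem q a b (height D′ C) δ ⟩
      q * height D′ C + (a + suc (b + δ)) * q    ≡⟨ ≡.cong₂ (λ y z → y + (a + suc z) * q) (height-block col) J≡C+δ ⟨
      height D col + (a + suc (toℕ J)) * q       ≡⟨ ≡.cong (λ z → height D col + z * q) (ℕₚ.m∸n+n≡m (toℕ<n J)) ⟩
      height D col + n′ * q  ≡⟨ ≡.cong (height D col +_) n′q≡n ⟩
      height D col + n                           ∎
      where
      lem : ∀ q a b c δ → q * suc (a + b) + q * (c + δ) ≡ q * c + (a + suc (b + δ)) * q
      lem = solve-∀

-- The generators for monotone and for convex contractions

module _ (H : HeytingField c ℓ₁ ℓ₂) (finite : IsFinite H) {p} (pp : Prime p) (char : HasCharacteristic H p)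
  {n} (M : ShiftModel (FiniteField.decField H finite pp char) p n)
  (D : FerrersDiagram n) {d} (1≤d : 1 ≤ d) (d≤n : d ≤ n)
  (h : ℕ) (blocked : Blocked (p ℕ.^ h) D) where
  open ShiftModel M
  open DecField K
  open Endomorphisms commutativeRing
  open Difference θ
  open ShiftOperators M
  open FreeFamilies M
  open Assembly H finite pp char M
  open ℤSolver commutativeRing using (solve; _:=_; _:*_)

  private
    instance
      p^h≢0 : NonZero (p ℕ.^ h)
      p^h≢0 = ℕₚ.m^n≢0 p h {{prime⇒nonZero pp}}
    module B = Blocks (p ℕ.^ h) D blocked

    mulBy-linear : ∀ v a u → v * (a * u) ≈ a * (v * u)
    mulBy-linear = solve 3 (λ v a u → v :* (a :* u) := a :* (v :* u)) refl

  monotoneGenerators : Monotone B.D′ → Generators D d (νmin D d)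
  monotoneGenerators mono = record
    { op        = λ t → mulBy (e (pos t)) ⊚ (Δ ↑ deg t)
    ; linear    = λ t a u → trans (*-congˡ (Δ↑-scale (θι a) (deg t) u)) (mulBy-linear _ _ _)
    ; short     = λ t → op-mulˡ (e (pos t)) (op-≤ (s≤s (deg≤ t)) (op-Δ↑ (deg t)))
    ; free      = left-free deg pos (λ t → ℕₚ.≤-<-trans (deg≤ t) n-d<n) pos<n
        (λ deg≡ → distinct (toℕ-injective deg≡))
    ; supported = λ t col → supported t col (ℕₚ.≤-<-connex (deg t) (toℕ col))
    ; shift     = λ 0<k → let t , index≡ , offset≡ = special 0<k in t , λ u →
        trans (*-cong (trans (reflexive (≡.cong e offset≡)) e-zero)
                      (reflexive (≡.cong (λ i → app (Δ ↑ i) u) (≡.trans (≡.cong toℕ index≡) (toℕ-fromℕ< last)))))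
              (*-identityˡ _)
    }
    where
    m = n ∸ (d ∸ 1)
    m≡1+n-d : m ≡ suc (n ∸ d)
    m≡1+n-d = lem d 1≤d d≤n
      where
      lem : ∀ d → 1 ≤ d → d ≤ n → n ∸ (d ∸ 1) ≡ suc (n ∸ d)
      lem (suc d) _ d<n = ℕₚ.+-∸-assoc 1 d<n
    column : Fin m → Fin n
    column i = inject≤ i (ℕₚ.m∸n≤m n (d ∸ 1))
    w : Fin m → ℕ
    -- The summand of `ν` at j = d - 1, where the correction cancels and the plain height remains.
    w i = (height D (column i) ℕ.+ 1 ℕ.+ (d ∸ 1)) ∸ d
    w≡height : ∀ i → w i ≡ height D (column i)
    w≡height i = ≡.trans (≡.cong (_∸ d) (≡.trans (ℕₚ.+-assoc _ 1 (d ∸ 1))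
        (≡.cong (height D (column i) ℕ.+_) (ℕₚ.suc-pred d {{ℕ.>-nonZero 1≤d}})))) (ℕₚ.m+n∸n≡m _ d)
    last : n ∸ d < m
    last = ℕₚ.≤-reflexive (≡.sym m≡1+n-d)
    -- The last of the first n - d + 1 columns is the tallest of them; its cell at offset 0 is the
    -- operator e₀ Δⁿ⁻ᵈ = Δⁿ⁻ᵈ.
    i₀ : Fin m
    i₀ = fromℕ< last
    index≤ : ∀ (i : Fin m) → toℕ i ≤ n ∸ d
    index≤ i = ℕₚ.≤-pred (≡.subst (toℕ i <_) m≡1+n-d (toℕ<n i))
    w≤ : ∀ i → w i ≤ w i₀
    w≤ i = ≡.subst₂ _≤_ (≡.sym (w≡height i)) (≡.sym (w≡height i₀)) (height-mono D
      (≡.subst₂ _≤_ (≡.sym (toℕ-inject≤ i _)) (≡.sym (≡.trans (toℕ-inject≤ i₀ _) (toℕ-fromℕ< last))) (index≤ i)))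
    open Selection (select w i₀ w≤ (νmin D d) (νmin≤ν D (ℕₚ.∸-monoʳ-< {o = 0} (s≤s z≤n) 1≤d)))
    deg pos : Fin (νmin D d) → ℕ
    deg t = toℕ (index t)
    pos t = offset t
    deg≤ : ∀ t → deg t ≤ n ∸ d
    deg≤ t = index≤ (index t)
    n-d<n : n ∸ d < n
    n-d<n = ℕₚ.∸-monoʳ-< {o = 0} 1≤d d≤n
    pos<height : ∀ t → pos t < height D (column (index t))
    pos<height t = ≡.subst (pos t <_) (w≡height (index t)) (offset< t)
    pos<n : ∀ t → pos t < n
    pos<n t = ℕₚ.<-≤-trans (pos<height t) (height≤n D _)
    supported : ∀ t (col : Fin n) → deg t ≤ toℕ col ⊎ toℕ col < deg t →
      app (Δ ↑ height D col) (e (pos t) * app (Δ ↑ deg t) (e (toℕ col))) ≈ 0#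
    supported t col (inj₂ col<deg) = trans (app-cong (Δ ↑ height D col)
      (trans (*-congˡ (Δ↑-e-0 col<deg (toℕ<n col))) (zeroʳ _))) (app-0 (Δ ↑ height D col))
    supported t col (inj₁ deg≤col) = trans (app-cong (Δ ↑ height D col) (*-congˡ Δ↑e≈)) (by-height fits)
      where
      i = column (index t)
      i≡deg : toℕ i ≡ deg t
      i≡deg = toℕ-inject≤ (index t) _
      Δ↑e≈ : app (Δ ↑ deg t) (e (toℕ col)) ≈ e (toℕ col ∸ deg t)
      Δ↑e≈ = trans (reflexive (≡.cong (λ j → app (Δ ↑ deg t) (e j)) (≡.sym (ℕₚ.m+[n∸m]≡n deg≤col))))
        (Δ↑-e (deg t) (≡.subst (_< n) (≡.sym (ℕₚ.m+[n∸m]≡n deg≤col)) (toℕ<n col)))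
      blocks = B.monotone-blocks mono i col (≡.subst (_≤ toℕ col) (≡.sym i≡deg) deg≤col) (ℕₚ.≤-<-trans z≤n (pos<height t))
      a = proj₁ blocks
      b = proj₁ (proj₂ blocks)
      height≡ = proj₁ (proj₂ (proj₂ blocks))
      distance = proj₁ (proj₂ (proj₂ (proj₂ blocks)))
      fits = proj₂ (proj₂ (proj₂ (proj₂ blocks)))
      by-height : n ≤ height D col ⊎ p ℕ.^ h ℕ.* suc (a ℕ.+ b) ≤ height D col →
        app (Δ ↑ height D col) (e (pos t) * e (toℕ col ∸ deg t)) ≈ 0#
      by-height (inj₁ n≤) = Δ↑-mono n≤ (Δ-nilpotent _)
      by-height (inj₂ ab≤) = Δ↑-mono ab≤ (block-mul h a b
        (Δ↑-e-0 (≡.subst (pos t <_) height≡ (pos<height t)) (pos<n t))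
        (Δ↑-e-0 (≡.subst (λ j → toℕ col ∸ j < p ℕ.^ h ℕ.* suc b) i≡deg distance) (ℕₚ.≤-<-trans (ℕₚ.m∸n≤m _ (deg t)) (toℕ<n col))))

  convexGenerators : Convex B.D′ → Generators D d (νmin D d)
  convexGenerators convex = record
    { op        = λ t → (Δ ↑ deg t) ⊚ mulBy (e (pos t))
    ; linear    = λ t a u → trans (app-cong (Δ ↑ deg t) (mulBy-linear _ _ _)) (Δ↑-scale (θι a) (deg t) _)
    ; short     = λ t → op-mulʳ (e (pos t)) (op-≤ (s≤s (ℕₚ.m∸n≤m (n ∸ d) (offset t))) (op-Δ↑ (deg t)))
    ; free      = right-free deg pos (λ t → ℕₚ.≤-<-trans (ℕₚ.m∸n≤m (n ∸ d) (offset t)) n-d<n) pos<n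
        (λ {t} {t′} deg≡ pos≡ → distinct
          (toℕ-injective (ℕₚ.∸-cancelˡ-≡ (index≤ (index t)) (index≤ (index t′)) pos≡))
          (ℕₚ.∸-cancelˡ-≡ (offset≤ t) (offset≤ t′) deg≡))
    ; supported = λ t col → supported t col (ℕₚ.≤-<-connex (toℕ col) (toℕ (column (index t))))
    ; shift     = λ 0<k → let t , index≡ , offset≡ = special 0<k in t , λ u →
        trans (reflexive (≡.cong (λ s → app (Δ ↑ (n ∸ d ∸ s)) (e (pos t) * u)) offset≡))
          (app-cong (Δ ↑ (n ∸ d)) (trans (*-congʳ (trans
            (reflexive (≡.cong e (≡.trans (≡.cong (n ∸ 1 ∸_) (≡.trans (≡.cong toℕ index≡) (toℕ-fromℕ< n-1<n))) (ℕₚ.n∸n≡0 (n ∸ 1)))))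
            e-zero)) (*-identityˡ u)))
    }
    where
    column : Fin n → Fin n
    column j = inject≤ j (ℕₚ.m∸n≤m n 0)
    w : Fin n → ℕ
    -- The summand of `ν` at j = 0, with all n columns present.
    w j = (height D (column j) ℕ.+ 1 ℕ.+ 0) ∸ d
    0<n : 0 < n
    0<n = ℕₚ.≤-trans 1≤d d≤n
    n-1<n : n ∸ 1 < n
    n-1<n = ℕₚ.∸-monoʳ-< {o = 0} (s≤s z≤n) 0<n
    n-d<n : n ∸ d < n
    n-d<n = ℕₚ.∸-monoʳ-< {o = 0} 1≤d d≤n
    j₀ : Fin n
    j₀ = fromℕ< n-1<n
    index≤ : ∀ (j : Fin n) → toℕ j ≤ n ∸ 1
    index≤ j = ℕₚ.∸-monoˡ-≤ 1 (toℕ<n j)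
    w≤ : ∀ j → w j ≤ w j₀
    w≤ j = ℕₚ.∸-monoˡ-≤ d (ℕₚ.+-monoˡ-≤ 0 (ℕₚ.+-monoˡ-≤ 1 (height-mono D
      (≡.subst₂ _≤_ (≡.sym (toℕ-inject≤ j _)) (≡.sym (≡.trans (toℕ-inject≤ j₀ _) (toℕ-fromℕ< n-1<n))) (index≤ j)))))
    open Selection (select w j₀ w≤ (νmin D d) (νmin≤ν D 1≤d))
    deg pos : Fin (νmin D d) → ℕ
    -- Both counts run downwards, so that offset 0 in the last column gives exponent n - d and e₀ =
    -- 1, that is, Δⁿ⁻ᵈ.
    deg t = n ∸ d ∸ offset t
    pos t = n ∸ 1 ∸ toℕ (index t)
    pos<n : ∀ t → pos t < n
    pos<n t = ℕₚ.≤-<-trans (ℕₚ.m∸n≤m (n ∸ 1) (toℕ (index t))) n-1<n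
    d+offset≤ : ∀ t → d ℕ.+ offset t ≤ height D (column (index t))
    d+offset≤ t = ≡.subst (_≤ height D (column (index t))) (ℕₚ.+-comm (offset t) d) (ℕₚ.≤-pred
        (≡.subst (suc (offset t ℕ.+ d) ≤_) (≡.trans (ℕₚ.+-identityʳ _) (ℕₚ.+-comm _ 1))
          (ℕₚ.m≤o∸n⇒m+n≤o (suc (offset t)) (ℕₚ.<⇒≤ (ℕₚ.m∸n≢0⇒n<m (ℕₚ.m<n⇒n≢0 (offset< t)))) (offset< t))))
    offset≤ : ∀ t → offset t ≤ n ∸ d
    offset≤ t = ℕₚ.m+n≤o⇒m≤o∸n (offset t) (≡.subst (_≤ n) (ℕₚ.+-comm d (offset t))
      (ℕₚ.≤-trans (d+offset≤ t) (height≤n D _)))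
    supported : ∀ t (col : Fin n) → toℕ col ≤ toℕ (column (index t)) ⊎ toℕ (column (index t)) < toℕ col →
      app (Δ ↑ height D col) (app (Δ ↑ deg t) (e (pos t) * e (toℕ col))) ≈ 0#
    supported t col case = trans (sym (↑-+ Δ (height D col) (deg t) _)) (by-case case)
      where
      j = column (index t)
      by-case : toℕ col ≤ toℕ j ⊎ toℕ j < toℕ col → app (Δ ↑ (height D col ℕ.+ deg t)) (e (pos t) * e (toℕ col)) ≈ 0#
      -- To the right of j the height is at least d + offset, so together with the exponent n - d -
      -- offset it already reaches n, where Δ vanishes.
      by-case (inj₂ j<col) = Δ↑-mono n≤ (Δ-nilpotent _)
        where
        n≤ : n ≤ height D col ℕ.+ deg t
        n≤ = ≡.subst (_≤ height D col ℕ.+ deg t) (≡.trans (ℕₚ.+-assoc d (offset t) (deg t))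
            (≡.trans (≡.cong (d ℕ.+_) (ℕₚ.m+[n∸m]≡n (offset≤ t))) (ℕₚ.m+[n∸m]≡n d≤n)))
          (ℕₚ.+-monoˡ-≤ (deg t) (ℕₚ.≤-trans (d+offset≤ t) (height-mono D (ℕₚ.<⇒≤ j<col))))
      by-case (inj₁ col≤j) = Δ↑-mono
          (≡.subst (λ x → p ℕ.^ h ℕ.* suc (a ℕ.+ b) ≤ height D col ℕ.+ x) (≡.sym (ℕₚ.∸-+-assoc n d (offset t)))
            (proj₂ (proj₂ (proj₂ (proj₂ blocks))) (d ℕ.+ offset t) (d+offset≤ t)))
          (block-mul h a b
            (Δ↑-e-0 (≡.subst (λ i → n ∸ 1 ∸ i < p ℕ.^ h ℕ.* suc a) (toℕ-inject≤ (index t) _) (proj₁ (proj₂ (proj₂ blocks)))) (pos<n t))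
            (Δ↑-e-0 (proj₁ (proj₂ (proj₂ (proj₂ blocks)))) (toℕ<n col)))
        where
        blocks = B.convex-blocks convex col j col≤j
        a = proj₁ blocks
        b = proj₁ (proj₂ blocks)

cyclicModel : ∀ (H : HeytingField c ℓ₁ ℓ₂) (finite : IsFinite H) {p} (pp : Prime p) (char : HasCharacteristic H p) m →
  ShiftModel (FiniteField.decField H finite pp char) p (p ℕ.^ m)
cyclicModel H finite pp char m = ToShiftModel.shiftModel decField pp p·1≈0 i·1≉0
  (Tower.tower decField pp p·1≈0 i·1≉0 (proj₁ artinSchreierNonRoot) (proj₂ artinSchreierNonRoot) m)
  where open FiniteField H finite pp char

open import Data.Nat.Base using (_^_)

theorem4p2 : ∀ {c ℓ₁ ℓ₂} (d m p : ℕ) → 0 < m → (p-prime : Prime p) → 1 ≤ d → d ≤ p ^ m →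
    (∀ (D : FerrersDiagram (p ^ m)) → PMonotone p-prime D →
    ∀ (F : HeytingField c ℓ₁ ℓ₂) → IsFinite F → HasCharacteristic F p →
    Code F D (νmin D d) d)
    ×
    (∀ (D : FerrersDiagram (p ^ m)) → PConvex p-prime D →
    ∀ (F : HeytingField c ℓ₁ ℓ₂) → IsFinite F → HasCharacteristic F p →
    Code F D (νmin D d) d)
theorem4p2 d m p 0<m pp 1≤d d≤n =
  (λ D (h , (blocked , _) , mono) F finite char →
    Assembly.generatedCode F finite pp char (cyclicModel F finite pp char m) 1≤d d≤n
      (monotoneGenerators F finite pp char (cyclicModel F finite pp char m) D 1≤d d≤n h blocked mono)) ,
  (λ D (h , (blocked , _) , convex) F finite char →
    Assembly.generatedCode F finite pp char (cyclicModel F finite pp char m) 1≤d d≤n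
      (convexGenerators F finite pp char (cyclicModel F finite pp char m) D 1≤d d≤n h blocked convex))
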